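{- Let $G$ be a 2-connected graph on $n$ vertices with $\delta(G)\geq k$, and let $C$ be a longest cycle in $G$, of length $c\in[10,n-1]$. If $e(G)>\max\{f(n,k+1,c),f(n,\lfloor c/2\rfloor,c)\}$, then the $C$-closure $\overline{G}$ of $G$ is isomorphic to $W_{n,k,c}$ or to $Z_{n,k,c}$.
   Context: Graphs are simple and finite. The $m$-closure of a graph is obtained by recursively joining pairs of nonadjacent vertices whose degree sum (in the current graph) is at least $m$ until no such pair remains. For a cycle $C$ of length $c$ in $G$, the $C$-closure $\overline{G}$ is obtained from $G$ by replacing $G[V(C)]$ by its $(c+1)$-closure. $W_{n,k,c}$: a clique $K_{c-k+1}$ plus $n-(c-k+1)$ new vertices each joined exactly to the same $k$ vertices of the clique. $f(n,k,c)=\binom{c-k+1}{2}+k(n-c+k-1)$. $Z_{n,k,c}$: union of a clique $K_{c-k+1}$ and $\frac{n-(c-k+1)}{k-1}$ cliques $K_{k+1}$ such that any two of these cliques share exactly the same two vertices. -}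

module Defs where

open import Data.Nat using (ℕ; zero; suc; _+_; _*_; _∸_; _≤_; _<_; _/_; _<ᵇ_; _≡ᵇ_; _≤ᵇ_)
open import Data.Nat.Combinatorics using (_C_)
open import Data.Bool using (Bool; true; false; _∧_; _∨_; not; if_then_else_)
open import Data.Fin using (Fin; toℕ; _≟_)
open import Data.List using (List; map; allFin)
open import Data.Nat.ListAction using (sum)
open import Data.Sum using (_⊎_)
open import Data.Product using (Σ; ∃; _×_; _,_)
open import Data.Unit using (⊤)
open import Relation.Nullary using (¬_)
open import Relation.Nullary.Decidable using (⌊_⌋)
open import Relation.Binary.PropositionalEquality using (_≡_; _≢_)
open import Relation.Binary.Construct.Closure.ReflexiveTransitive using (Star)
open import Function.Definitions using (Injective)
open import Function.Bundles using (_↔_; Inverse)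

record Graph (n : ℕ) : Set where
  field
    adj     : Fin n → Fin n → Bool
    adj-sym : ∀ u v → adj u v ≡ adj v u
    adj-irr : ∀ u → adj u u ≡ false
open Graph public

Edge : ∀ {n} → Graph n → Fin n → Fin n → Set
Edge G u v = adj G u v ≡ true

ind : Bool → ℕ
ind b = if b then 1 else 0

degree : ∀ {n} → Graph n → Fin n → ℕ
degree {n} G v = sum (map (λ u → ind (adj G v u)) (allFin n))

MinDegree≥ : ∀ {n} → Graph n → ℕ → Set
MinDegree≥ G k = ∀ v → k ≤ degree G v

edges : ∀ {n} → Graph n → ℕ
edges {n} G =
  sum (map (λ u → sum (map (λ v → ind (adj G u v ∧ (toℕ u <ᵇ toℕ v))) (allFin n))) (allFin n))

data Walk {n} (G : Graph n) (ok : Fin n → Set) : Fin n → Fin n → Set where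
  []   : ∀ {x} → ok x → Walk G ok x x
  step : ∀ {x y z} → ok x → Edge G x y → Walk G ok y z → Walk G ok x z

Connected : ∀ {n} → Graph n → Set
Connected {n} G = ∀ (x y : Fin n) → Walk G (λ _ → ⊤) x y

TwoConnected : ∀ {n} → Graph n → Set
TwoConnected {n} G =
  3 ≤ n × Connected G ×
  (∀ (v x y : Fin n) → x ≢ v → y ≢ v → Walk G (λ w → w ≢ v) x y)

Consecutive : ℕ → ℕ → ℕ → Set
Consecutive c i j = (suc i ≡ j) ⊎ (suc i ≡ c × j ≡ 0)

IsCycle : ∀ {n} → Graph n → (c : ℕ) → (Fin c → Fin n) → Set
IsCycle G c f =
  3 ≤ c × Injective _≡_ _≡_ f ×
  (∀ (i j : Fin c) → Consecutive c (toℕ i) (toℕ j) → Edge G (f i) (f j))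

IsLongestCycle : ∀ {n} → Graph n → (c : ℕ) → (Fin c → Fin n) → Set
IsLongestCycle {n} G c f =
  IsCycle G c f × (∀ (c′ : ℕ) (g : Fin c′ → Fin n) → IsCycle G c′ g → c′ ≤ c)

-- C-closure. f : Fin c → Fin n is (the vertex map of) the cycle C.
-- degC H v : degree of v in the induced subgraph H[V(C)]
-- (f is injective, so this counts the neighbours of v in V(C)).

degC : ∀ {n c} → (Fin c → Fin n) → Graph n → Fin n → ℕ
degC {n} {c} f H v = sum (map (λ i → ind (adj H v (f i))) (allFin c))

ClosureStep : ∀ {n c} → (Fin c → Fin n) → Graph n → Graph n → Set
ClosureStep {n} {c} f H H′ =
  Σ (Fin c) λ i → Σ (Fin c) λ j →
    f i ≢ f j × adj H (f i) (f j) ≡ false ×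
    suc c ≤ degC f H (f i) + degC f H (f j) ×
    (∀ u v → adj H′ u v ≡
       (adj H u v ∨ ((⌊ u ≟ f i ⌋ ∧ ⌊ v ≟ f j ⌋) ∨ (⌊ u ≟ f j ⌋ ∧ ⌊ v ≟ f i ⌋))))

ClosureStable : ∀ {n c} → (Fin c → Fin n) → Graph n → Set
ClosureStable {n} {c} f H =
  ∀ (i j : Fin c) → f i ≢ f j → adj H (f i) (f j) ≡ false →
    ¬ (suc c ≤ degC f H (f i) + degC f H (f j))

IsCClosure : ∀ {n c} → Graph n → (Fin c → Fin n) → Graph n → Set
IsCClosure G f H = Star (ClosureStep f) G H × ClosureStable f H

_≅_ : ∀ {n} → Graph n → (Fin n → Fin n → Bool) → Set
_≅_ {n} H A = Σ (Fin n ↔ Fin n) λ π →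
  ∀ u v → adj H u v ≡ A (Inverse.to π u) (Inverse.to π v)

f : ℕ → ℕ → ℕ → ℕ
f n k c = ((c ∸ k + 1) C 2) + k * (n ∸ (c ∸ k + 1))

-- W_{n,k,c}: vertices 0 .. c-k are the clique K_{c-k+1}; vertices 0 .. k-1
-- are the k special clique vertices; every other vertex is adjacent exactly
-- to the k special vertices.
Wadj : (n k c : ℕ) → Fin n → Fin n → Bool
Wadj n k c u v =
  not ⌊ u ≟ v ⌋ ∧
  (((toℕ u <ᵇ a) ∧ (toℕ v <ᵇ a)) ∨ (toℕ u <ᵇ k) ∨ (toℕ v <ᵇ k))
  where a = c ∸ k + 1

-- block index of an outside vertex (blocks of size k-1)
blk : ℕ → ℕ → ℕ
blk zero    i = 0
blk (suc j) i = i / suc j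

-- Z_{n,k,c} (meaningful when k ≥ 2 and (k-1) ∣ n-(c-k+1)):
-- vertices 0 .. c-k form the clique K_{c-k+1}; vertices 0,1 are the two
-- shared vertices; the remaining n-(c-k+1) vertices are split into
-- consecutive blocks of k-1 vertices, each block together with 0,1
-- forming a K_{k+1}.
Zadj : (n k c : ℕ) → Fin n → Fin n → Bool
Zadj n k c u v =
  not ⌊ u ≟ v ⌋ ∧
  ((toℕ u <ᵇ 2) ∨ (toℕ v <ᵇ 2) ∨
   ((toℕ u <ᵇ a) ∧ (toℕ v <ᵇ a)) ∨
   ((a ≤ᵇ toℕ u) ∧ (a ≤ᵇ toℕ v) ∧
    (blk (k ∸ 1) (toℕ u ∸ a) ≡ᵇ blk (k ∸ 1) (toℕ v ∸ a))))
  where a = c ∸ k + 1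

{-# OPTIONS --safe #-}
module Submission where

-- Let Ĝ be an edge-maximal supergraph of G without cycles longer than c: its non-adjacent vertices
-- are joined by paths on more than c vertices. Kopylov's lemma says that such a path P from u to v
-- satisfies d_P(u) + d_P(v) ≤ c; for longest paths between suitable sets it shows that the
-- ⌊c/2⌋-core of Ĝ is a clique, and that a maximal clique K of Ĝ, of size c + 1 - s, is reached by
-- repeatedly deleting vertices of degree at most s. Hence e(Ĝ) ≤ f(n,s,c), and convexity of f
-- forces s = k.
--
-- For a longest path P from u ∈ K to v ∉ K the lemma holds with equality, so that a shortest
-- crossing v ~ a, u ~ b (a before b on P) leaves no slack: outside the gap between a and b, every
-- vertex of P is in K or is preceded by a neighbour of v. It follows that the components of Ĝ - K
-- are cliques, all of them completely joined to the same set S ⊆ K and to nothing else in K, where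
-- |S| = 2 (giving Z) or |S| = k (giving W).
--
-- Vertices outside K have degree k in Ĝ, so G and Ĝ differ only inside K. Every cycle of length c
-- in Ĝ contains K, the edge bound makes all missing pairs of K eligible for the closure, and no
-- pair that is not an edge of Ĝ ever becomes eligible: the closure of G is Ĝ.

-- Since `K` has `c + 1 - k` vertices, a path between two vertices of `K` closes up through the rest
-- of the clique and so meets at most `k - 1` vertices outside `K`. This bound controls the
-- components that a longest path misses. One longest path into the complement of `K` yields, from
-- every vertex of `S`, a path through `S` and already understood outside vertices that meets
-- `k - 1` of the latter; an outside vertex attached to `K` in any other way would allow a path with
-- `k` of them. For this the study of the last vertex is made for longest paths into an arbitrary
-- union of components of the graph without `K`: once for the whole complement, once for the
-- vertices assumed to violate the description. Both times the degrees of the two ends are forced,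
-- because their lower bounds `k` and `length K - 1` add up to exactly `c`. Rotations supply the
-- remaining information: they turn further outside vertices into ends, and at the places where they
-- are applied they leave unchanged which vertices of `K` the end sees.

open import Defs
open import Data.Nat using (ℕ; zero; suc; _+_; _*_; _∸_; _≤_; _<_; z≤n; s≤s; s≤s⁻¹; _≤?_; _/_; _<ᵇ_; _≤ᵇ_; _≡ᵇ_)
open import Data.Nat.Properties
open import Data.Nat.ListAction using (sum)
open import Data.Nat.Tactic.RingSolver using (solve-∀)
open import Data.Nat.Combinatorics using (nCk+nC[k+1]≡[n+1]C[k+1]; nC1≡n) renaming (_C_ to _choose_)
open import Data.Nat.DivMod using (_%_; m≡m%n+[m/n]*n; m%n<n; m<n⇒m/n≡0; m/n≡1+[m∸n]/n)
open import Data.Nat.Divisibility using (_∣_; _∣0; ∣m∣n⇒∣m+n; ∣-refl)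
open import Data.Bool using (Bool; true; false; _∧_; _∨_; not; T)
open import Data.Bool.Properties using (∧-comm; ∨-comm; ∨-zeroʳ) renaming (_≟_ to _≟ᵇ_)
open import Data.Fin using (Fin; toℕ; fromℕ<; cast) renaming (zero to fzero; suc to fsuc; _≟_ to _≟F_)
open import Data.Fin.Properties using (any?; all?; toℕ-fromℕ<; toℕ-injective; toℕ-cast)
open import Data.List using (List; []; _∷_; _++_; [_]; map; length; reverse; lookup; allFin; tabulate; filter)
open import Data.List.Properties using (++-assoc; ++-identityʳ; length-++; length-reverse; unfold-reverse; reverse-++; length-tabulate; ∷-injective; map-cong)
open import Data.List.Relation.Unary.Any using (here; there)
open import Data.List.Relation.Unary.Any.Properties using (reverse⁺; reverse⁻)
open import Data.List.Relation.Unary.All using (All; []; _∷_)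
import Data.List.Relation.Unary.All as All
open import Data.List.Relation.Unary.All.Properties using () renaming (++⁺ to All-++⁺; ++⁻ˡ to All-++⁻ˡ; ++⁻ʳ to All-++⁻ʳ)
open import Data.List.Relation.Unary.Linked using (Linked; []; [-]; _∷_)
import Data.List.Relation.Unary.Linked as Linked
open import Data.List.Membership.Propositional using (_∈_; _∉_)
open import Data.List.Membership.Propositional.Properties using (∈-++⁺ˡ; ∈-++⁺ʳ; ∈-++⁻; ∈-∃++; ∈-allFin; ∈-filter⁺; ∈-filter⁻; ∈-lookup; ∈-insert; ∈-tabulate⁻)
open import Data.Product using (Σ; ∃; ∃-syntax; _×_; _,_; proj₁; proj₂)
open import Data.Sum using (_⊎_; inj₁; inj₂; [_,_]′) renaming (map to map⊎)
open import Data.Empty using (⊥; ⊥-elim)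
open import Data.Unit using (⊤; tt)
open import Function using (_∘_; id; case_of_)
open import Function.Bundles using (_↔_; mk↔ₛ′; Inverse)
open import Relation.Nullary using (¬_; Dec; yes; no)
open import Relation.Nullary.Decidable using (⌊_⌋; _×-dec_; _→-dec_; ¬?; map′; decidable-stable)
open import Relation.Binary.PropositionalEquality using (_≡_; _≢_; refl; sym; trans; cong; cong₂; subst; subst₂; ≢-sym; module ≡-Reasoning)
open import Relation.Binary.Construct.Closure.ReflexiveTransitive using (Star; ε; _◅_)

-- Discharges linear inequalities: the hypotheses are added up to x ≤ y and the remaining
-- identity is left to the ring solver.
linear : ∀ {a b x y} d → x ≤ y → a + y + d ≡ b + x → a ≤ b
linear {a} {b} {x} {y} d x≤y eq = +-cancelʳ-≤ x a b (begin
  a + x      ≤⟨ +-monoʳ-≤ a x≤y ⟩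
  a + y      ≤⟨ m≤m+n _ d ⟩
  a + y + d  ≡⟨ eq ⟩
  b + x      ∎)
  where open ≤-Reasoning

true≢false : ∀ {b} → b ≡ true → b ≡ false → ⊥
true≢false refl ()

¬true⇒false : ∀ {b} → ¬ (b ≡ true) → b ≡ false
¬true⇒false {true}  h = ⊥-elim (h refl)
¬true⇒false {false} h = refl

bool-ext : ∀ {a b} → (a ≡ true → b ≡ true) → (b ≡ true → a ≡ true) → a ≡ b
bool-ext {true}  {b}     h k = sym (h refl)
bool-ext {false} {true}  h k = k refl
bool-ext {false} {false} h k = refl

-- Sums over lists

module _ {A : Set} where

  Σₗ : (A → ℕ) → List A → ℕ
  Σₗ w []      = 0
  Σₗ w (x ∷ L) = w x + Σₗ w L

  Σₗ≡sum : ∀ w L → Σₗ w L ≡ sum (map w L)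
  Σₗ≡sum w []      = refl
  Σₗ≡sum w (x ∷ L) = cong (w x +_) (Σₗ≡sum w L)

  Σₗ-++ : ∀ w L M → Σₗ w (L ++ M) ≡ Σₗ w L + Σₗ w M
  Σₗ-++ w []      M = refl
  Σₗ-++ w (x ∷ L) M = trans (cong (w x +_) (Σₗ-++ w L M)) (sym (+-assoc (w x) (Σₗ w L) (Σₗ w M)))

  Σₗ-reverse : ∀ w L → Σₗ w (reverse L) ≡ Σₗ w L
  Σₗ-reverse w []      = refl
  Σₗ-reverse w (x ∷ L) = begin
    Σₗ w (reverse (x ∷ L))         ≡⟨ cong (Σₗ w) (unfold-reverse x L) ⟩
    Σₗ w (reverse L ++ x ∷ [])     ≡⟨ Σₗ-++ w (reverse L) (x ∷ []) ⟩
    Σₗ w (reverse L) + (w x + 0)   ≡⟨ cong₂ _+_ (Σₗ-reverse w L) (+-identityʳ (w x)) ⟩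
    Σₗ w L + w x                   ≡⟨ +-comm _ (w x) ⟩
    w x + Σₗ w L                   ∎
    where open ≡-Reasoning

  Σₗ-insert : ∀ w L x M → Σₗ w (L ++ x ∷ M) ≡ w x + Σₗ w (L ++ M)
  Σₗ-insert w L x M = begin
    Σₗ w (L ++ x ∷ M)            ≡⟨ Σₗ-++ w L (x ∷ M) ⟩
    Σₗ w L + (w x + Σₗ w M)      ≡⟨ swap-+ (Σₗ w L) (w x) (Σₗ w M) ⟩
    w x + (Σₗ w L + Σₗ w M)      ≡⟨ cong (w x +_) (Σₗ-++ w L M) ⟨
    w x + Σₗ w (L ++ M)          ∎
    where
    open ≡-Reasoning
    swap-+ : ∀ a b c → a + (b + c) ≡ b + (a + c)
    swap-+ = solve-∀

  Σₗ-mono : ∀ {w w′ : A → ℕ} L → (∀ {x} → x ∈ L → w x ≤ w′ x) → Σₗ w L ≤ Σₗ w′ L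
  Σₗ-mono []      h = z≤n
  Σₗ-mono (x ∷ L) h = +-mono-≤ (h (here refl)) (Σₗ-mono L (h ∘ there))

  Σₗ-cong : ∀ {w w′ : A → ℕ} L → (∀ {x} → x ∈ L → w x ≡ w′ x) → Σₗ w L ≡ Σₗ w′ L
  Σₗ-cong []      h = refl
  Σₗ-cong (x ∷ L) h = cong₂ _+_ (h (here refl)) (Σₗ-cong L (h ∘ there))

  Σₗ-+ : ∀ (w w′ : A → ℕ) L → Σₗ (λ x → w x + w′ x) L ≡ Σₗ w L + Σₗ w′ L
  Σₗ-+ w w′ []      = refl
  Σₗ-+ w w′ (x ∷ L) = trans (cong (w x + w′ x +_) (Σₗ-+ w w′ L)) (lem (w x) (w′ x) (Σₗ w L) (Σₗ w′ L))
    where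
    lem : ∀ a b c d → a + b + (c + d) ≡ a + c + (b + d)
    lem = solve-∀

  Σₗ-one : ∀ L → Σₗ (λ _ → 1) L ≡ length L
  Σₗ-one []      = refl
  Σₗ-one (x ∷ L) = cong suc (Σₗ-one L)

  -- Agreement of all weighted sums means that the lists are permutations of each other. Rearranged
  -- paths are compared in this form: one identity for an arbitrary weight gives freedom from
  -- repetition (weights `δ x`) and the length (weight 1) at once.
  Σₗ⇒length : ∀ L M → (∀ w → Σₗ w L ≡ Σₗ w M) → length L ≡ length M
  Σₗ⇒length L M h = trans (sym (Σₗ-one L)) (trans (h (λ _ → 1)) (Σₗ-one M))

  length-insert : ∀ (L : List A) {x M} → length (L ++ x ∷ M) ≡ suc (length (L ++ M))
  length-insert L {x} {M} = trans (length-++ L) (trans (+-suc (length L) (length M)) (cong suc (sym (length-++ L))))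

  Σₗ-∈ : ∀ w {x L} → x ∈ L → w x ≤ Σₗ w L
  Σₗ-∈ w {L = x ∷ L} (here refl) = m≤m+n (w x) (Σₗ w L)
  Σₗ-∈ w {L = y ∷ L} (there x∈L) = ≤-trans (Σₗ-∈ w x∈L) (m≤n+m (Σₗ w L) (w y))

  Σₗ-zero : ∀ w L → (∀ {x} → x ∈ L → w x ≡ 0) → Σₗ w L ≡ 0
  Σₗ-zero w []      h = refl
  Σₗ-zero w (x ∷ L) h = cong₂ _+_ (h (here refl)) (Σₗ-zero w L (h ∘ there))

  Σₗ-tight : ∀ {w w′ : A → ℕ} L → (∀ {x} → x ∈ L → w x ≤ w′ x) → Σₗ w′ L ≤ Σₗ w L →
             ∀ {x} → x ∈ L → w′ x ≤ w x
  Σₗ-tight {w} {w′} (y ∷ L) h le (here refl) =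
    +-cancelʳ-≤ (Σₗ w L) _ _ (≤-trans (+-monoʳ-≤ (w′ y) (Σₗ-mono L (h ∘ there))) le)
  Σₗ-tight {w} {w′} (y ∷ L) h le (there x∈L) =
    Σₗ-tight L (h ∘ there) (+-cancelˡ-≤ (w y) _ _ (≤-trans (+-monoˡ-≤ _ (h (here refl))) le)) x∈L

  snoc : ∀ (x : A) L → ∃[ M ] ∃[ y ] x ∷ L ≡ M ++ [ y ]
  snoc x []      = [] , x , refl
  snoc x (y ∷ L) with snoc y L
  ... | M , z , eq = x ∷ M , z , cong (x ∷_) eq

-- Repetition-free lists of vertices

module _ {n : ℕ} where

  private V = Fin n

  infix 4 _∈?_
  _∈?_ : (x : V) (L : List V) → Dec (x ∈ L)
  x ∈? []      = no λ ()
  x ∈? (y ∷ L) with x ≟F y | x ∈? L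
  ... | yes refl | _       = yes (here refl)
  ... | no _     | yes x∈L = yes (there x∈L)
  ... | no x≢y   | no x∉L  = no λ { (here eq) → x≢y eq ; (there x∈L) → x∉L x∈L }

  δ : V → V → ℕ
  δ x y = ind ⌊ x ≟F y ⌋

  δ-refl : ∀ x → δ x x ≡ 1
  δ-refl x with x ≟F x
  ... | yes _  = refl
  ... | no x≢x = ⊥-elim (x≢x refl)

  count : V → List V → ℕ
  count x = Σₗ (δ x)

  ∈⇒count : ∀ {x L} → x ∈ L → 1 ≤ count x L
  ∈⇒count {x} {L} x∈L = subst (_≤ count x L) (δ-refl x) (Σₗ-∈ (δ x) x∈L)

  count⇒∈ : ∀ {x} L → 1 ≤ count x L → x ∈ L
  count⇒∈ {x} (y ∷ L) h with x ≟F y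
  ... | yes refl = here refl
  ... | no _     = there (count⇒∈ L h)

  -- Freedom from repetition is expressed by multiplicities, so that cutting, reversing and regluing
  -- lists becomes arithmetic of sums.
  record Uniq (L : List V) : Set where
    constructor uniq
    field count≤1 : ∀ x → count x L ≤ 1
  open Uniq public

  Uniq-≤ : ∀ {L M} → (∀ x → count x M ≤ count x L) → Uniq L → Uniq M
  Uniq-≤ h u = uniq λ x → ≤-trans (h x) (count≤1 u x)

  Uniq-[] : Uniq []
  Uniq-[] = uniq λ x → z≤n

  Uniq-∷ : ∀ {x L} → x ∉ L → Uniq L → Uniq (x ∷ L)
  Uniq-∷ {x} {L} x∉L u = uniq go
    where
    go : ∀ z → count z (x ∷ L) ≤ 1
    go z with z ≟F x
    ... | no _     = count≤1 u z
    ... | yes refl = s≤s (≮⇒≥ λ lt → x∉L (count⇒∈ L lt))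

  Uniq-tail : ∀ {x L} → Uniq (x ∷ L) → Uniq L
  Uniq-tail {x} {L} = Uniq-≤ λ z → m≤n+m (count z L) (δ z x)

  Uniq-head : ∀ {x L} → Uniq (x ∷ L) → x ∉ L
  Uniq-head {x} {L} u x∈L =
    1+n≰n (≤-trans (s≤s (∈⇒count x∈L)) (subst (λ d → d + count x L ≤ 1) (δ-refl x) (count≤1 u x)))

  Uniq-++⁻ˡ : ∀ L {M} → Uniq (L ++ M) → Uniq L
  Uniq-++⁻ˡ L {M} = Uniq-≤ λ x → ≤-trans (m≤m+n (count x L) (count x M)) (≤-reflexive (sym (Σₗ-++ (δ x) L M)))

  Uniq-++⁻ʳ : ∀ L {M} → Uniq (L ++ M) → Uniq M
  Uniq-++⁻ʳ L {M} = Uniq-≤ λ x → ≤-trans (m≤n+m (count x M) (count x L)) (≤-reflexive (sym (Σₗ-++ (δ x) L M)))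

  Uniq-disjoint : ∀ L {M x} → Uniq (L ++ M) → x ∈ L → x ∈ M → ⊥
  Uniq-disjoint L {M} {x} u x∈L x∈M =
    1+n≰n (≤-trans (+-mono-≤ (∈⇒count x∈L) (∈⇒count x∈M)) (subst (_≤ 1) (Σₗ-++ (δ x) L M) (count≤1 u x)))

  Uniq-++ : ∀ L {M} → Uniq L → Uniq M → (∀ {x} → x ∈ L → x ∈ M → ⊥) → Uniq (L ++ M)
  Uniq-++ []      u v d = v
  Uniq-++ (x ∷ L) u v d = Uniq-∷
    (λ x∈ → [ Uniq-head u , d (here refl) ]′ (∈-++⁻ L x∈))
    (Uniq-++ L (Uniq-tail u) v (d ∘ there))

  Uniq-[x] : ∀ {x : V} → Uniq (x ∷ [])
  Uniq-[x] = Uniq-∷ (λ ()) Uniq-[]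

  Uniq-reverse : ∀ {L} → Uniq L → Uniq (reverse L)
  Uniq-reverse {L} = Uniq-≤ (λ x → ≤-reflexive (Σₗ-reverse (δ x) L))

  Uniq-remove : ∀ L {x M} → Uniq (L ++ x ∷ M) → Uniq (L ++ M)
  Uniq-remove L {x} {M} = Uniq-≤ λ z → ≤-trans (m≤n+m _ (δ z x)) (≤-reflexive (sym (Σₗ-insert (δ z) L x M)))

  Uniq-middle : ∀ L {x M} → Uniq (L ++ x ∷ M) → x ∉ L ++ M
  Uniq-middle L {x} {M} u x∈ = [ (λ x∈L → Uniq-disjoint L u x∈L (here refl)) , Uniq-head (Uniq-++⁻ʳ L u) ]′ (∈-++⁻ L x∈)

  ∈-remove : ∀ L {x z : V} {M} → z ∈ L ++ x ∷ M → z ≢ x → z ∈ L ++ M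
  ∈-remove L z∈ z≢x with ∈-++⁻ L z∈
  ... | inj₁ z∈L          = ∈-++⁺ˡ z∈L
  ... | inj₂ (here refl)  = ⊥-elim (z≢x refl)
  ... | inj₂ (there z∈M)  = ∈-++⁺ʳ L z∈M

  ∈-weaken : ∀ L {x z : V} {M} → z ∈ L ++ M → z ∈ L ++ x ∷ M
  ∈-weaken L z∈ = [ ∈-++⁺ˡ , ∈-++⁺ʳ L ∘ there ]′ (∈-++⁻ L z∈)

  -- Only entries of nonzero weight have to lie in `M`. For the adjacency indicator of `v` this
  -- compares degrees as soon as the neighbours of `v` in `L` are known to lie in `M`.
  Σₗ-⊆ : ∀ w L M → Uniq L → (∀ {x} → x ∈ L → w x ≢ 0 → x ∈ M) → Σₗ w L ≤ Σₗ w M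
  Σₗ-⊆ w []      M u h = z≤n
  Σₗ-⊆ w (x ∷ L) M u h with w x ≟ 0
  ... | yes w≡0 = subst (λ d → d + Σₗ w L ≤ Σₗ w M) (sym w≡0) (Σₗ-⊆ w L M (Uniq-tail u) (h ∘ there))
  ... | no w≢0 with ∈-∃++ (h (here refl) w≢0)
  ...   | A , B , refl = ≤-trans
    (+-monoʳ-≤ (w x) (Σₗ-⊆ w L (A ++ B) (Uniq-tail u)
      (λ z∈L wz → ∈-remove A (h (there z∈L) wz) λ { refl → Uniq-head u z∈L })))
    (≤-reflexive (sym (Σₗ-insert w A x B)))

  length-⊆ : ∀ L M → Uniq L → (∀ {x : V} → x ∈ L → x ∈ M) → length L ≤ length M
  length-⊆ L M u h = subst₂ _≤_ (Σₗ-one L) (Σₗ-one M) (Σₗ-⊆ (λ _ → 1) L M u (λ x∈ _ → h x∈))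

  Uniq-tabulate : ∀ {m} (g : Fin m → V) → (∀ {i j} → g i ≡ g j → i ≡ j) → Uniq (tabulate g)
  Uniq-tabulate {zero}  g inj = Uniq-[]
  Uniq-tabulate {suc m} g inj = Uniq-∷ first∉ (Uniq-tabulate (g ∘ fsuc) λ eq → fsuc-inj (inj eq))
    where
    fsuc-inj : ∀ {i j : Fin m} → fsuc i ≡ fsuc j → i ≡ j
    fsuc-inj refl = refl
    first∉ : g fzero ∉ tabulate (g ∘ fsuc)
    first∉ x∈ with ∈-tabulate⁻ x∈
    ... | k , eq = case inj eq of λ ()

  Uniq-allFin : Uniq (allFin n)
  Uniq-allFin = Uniq-tabulate id id

  length-allFin : length (allFin n) ≡ n
  length-allFin = length-tabulate id

  length≤n : ∀ {L : List V} → Uniq L → length L ≤ n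
  length≤n {L} u = subst (length L ≤_) length-allFin (length-⊆ L (allFin n) u (λ {x} _ → ∈-allFin x))

  filter-count : ∀ {P : V → Set} (P? : ∀ x → Dec (P x)) L x → count x (filter P? L) ≤ count x L
  filter-count P? []      x = z≤n
  filter-count P? (y ∷ L) x with P? y
  ... | yes _ = +-monoʳ-≤ (δ x y) (filter-count P? L x)
  ... | no _  = ≤-trans (filter-count P? L x) (m≤n+m (count x L) (δ x y))

  Uniq-filter : ∀ {P : V → Set} (P? : ∀ x → Dec (P x)) {L} → Uniq L → Uniq (filter P? L)
  Uniq-filter P? {L} = Uniq-≤ (filter-count P? L)

  lookup-injective : ∀ {L : List V} → Uniq L → ∀ {i j} → lookup L i ≡ lookup L j → i ≡ j
  lookup-injective {x ∷ L} u {fzero}  {fzero}  eq = refl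
  lookup-injective {x ∷ L} u {fzero}  {fsuc j} eq = ⊥-elim (Uniq-head u (subst (_∈ L) (sym eq) (∈-lookup j)))
  lookup-injective {x ∷ L} u {fsuc i} {fzero}  eq = ⊥-elim (Uniq-head u (subst (_∈ L) eq (∈-lookup i)))
  lookup-injective {x ∷ L} u {fsuc i} {fsuc j} eq = cong fsuc (lookup-injective (Uniq-tail u) eq)

  first-split : ∀ {α : V → Set} → (∀ x → Dec (α x)) → ∀ L →
                All (λ w → ¬ α w) L ⊎ ∃[ M ] ∃[ b ] ∃[ Y ] (L ≡ M ++ b ∷ Y × All (λ w → ¬ α w) M × α b)
  first-split α? [] = inj₁ []
  first-split α? (x ∷ L) with α? x | first-split α? L
  ... | yes αx | _ = inj₂ ([] , x , L , refl , [] , αx)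
  ... | no ¬αx | inj₁ none = inj₁ (¬αx ∷ none)
  ... | no ¬αx | inj₂ (M , b , Y , refl , none , αb) = inj₂ (x ∷ M , b , Y , refl , ¬αx ∷ none , αb)

  last-split : ∀ {α : V → Set} → (∀ x → Dec (α x)) → ∀ L →
               All (λ w → ¬ α w) L ⊎ ∃[ X ] ∃[ a ] ∃[ M ] (L ≡ X ++ a ∷ M × All (λ w → ¬ α w) M × α a)
  last-split α? [] = inj₁ []
  last-split α? (x ∷ L) with last-split α? L | α? x
  ... | inj₂ (X , a , M , refl , none , αa) | _ = inj₂ (x ∷ X , a , M , refl , none , αa)
  ... | inj₁ none | yes αx = inj₂ ([] , x , L , refl , none , αx)
  ... | inj₁ none | no ¬αx = inj₁ (¬αx ∷ none)

  -- A closest pair with a `β`-vertex before an `α`-vertex, or no such pair at all. In the separated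
  -- case one vertex may still be both the last `α`-vertex and the first `β`-vertex.
  data Scan (α β : V → Set) : List V → Set where
    crossing  : ∀ X a M b Y → β a → α b → All (λ w → ¬ α w × ¬ β w) M → Scan α β (X ++ a ∷ M ++ b ∷ Y)
    separated : ∀ {L} → (∀ A a M → L ≡ A ++ a ∷ M → α a → All (λ w → ¬ β w) A) → Scan α β L

  scan : ∀ {α β : V → Set} → (∀ x → Dec (α x)) → (∀ x → Dec (β x)) → ∀ L → Scan α β L
  scan α? β? [] = separated λ { [] _ _ () _ ; (_ ∷ _) _ _ () _ }
  scan α? β? (x ∷ L) with scan α? β? L
  ... | crossing X a M b Y βa αb none = crossing (x ∷ X) a M b Y βa αb none
  ... | separated sep with β? x
  ...   | no ¬βx = separated λ { [] _ _ _ _ → [] ; (_ ∷ A) a M refl αa → ¬βx ∷ sep A a M refl αa }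
  ...   | yes βx with first-split α? L
  ...     | inj₁ none = separated λ { [] _ _ _ _ → [] ; (_ ∷ A) a M refl αa → ⊥-elim (All.head (All-++⁻ʳ A none) αa) }
  ...     | inj₂ (M , b , Y′ , refl , noαM , αb) with last-split β? M
  ...       | inj₁ noβM = crossing [] x M b Y′ βx αb (All.zip (noαM , noβM))
  ...       | inj₂ (M₁ , a , M₂ , refl , noβM₂ , βa) = subst (Scan _ _)
                (cong (x ∷_) (sym (++-assoc M₁ (a ∷ M₂) (b ∷ Y′))))
                (crossing (x ∷ M₁) a M₂ b Y′ βa αb (All.zip (All.tail (All-++⁻ʳ M₁ noαM) , noβM₂)))

-- Paths

sym-edge : ∀ {n} (G : Graph n) {x y} → Edge G x y → Edge G y x
sym-edge G {x} {y} e = trans (adj-sym G y x) e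

irrefl : ∀ {n} (G : Graph n) {x y} → Edge G x y → x ≢ y
irrefl G {x} e refl = true≢false e (adj-irr G x)

infixr 5 _◂_
data Path {n} (G : Graph n) : Fin n → Fin n → List (Fin n) → Set where
  stop : ∀ {x} → Path G x x (x ∷ [])
  _◂_  : ∀ {x y z L} → Edge G x y → Path G y z L → Path G x z (x ∷ L)

module _ {n : ℕ} where

  private V = Fin n

  _⊑_ : Graph n → Graph n → Set
  G ⊑ G′ = ∀ {x y} → Edge G x y → Edge G′ x y

  path-mono : ∀ {G G′ : Graph n} → G ⊑ G′ → ∀ {x y L} → Path G x y L → Path G′ x y L
  path-mono h stop    = stop
  path-mono h (e ◂ p) = h e ◂ path-mono h p

  module _ {G : Graph n} where

    path-head : ∀ {x y L} → Path G x y L → ∃[ M ] L ≡ x ∷ M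
    path-head stop    = [] , refl
    path-head (e ◂ p) = _ , refl

    path-last : ∀ {x y L} → Path G x y L → ∃[ M ] L ≡ M ++ [ y ]
    path-last stop = [] , refl
    path-last (_◂_ {x = x} e p) with path-last p
    ... | M , refl = x ∷ M , refl

    first∈ : ∀ {x y L} → Path G x y L → x ∈ L
    first∈ stop    = here refl
    first∈ (_ ◂ _) = here refl

    last∈ : ∀ {x y L} → Path G x y L → y ∈ L
    last∈ stop    = here refl
    last∈ (e ◂ p) = there (last∈ p)

    path-++ : ∀ {x y z w L M} → Path G x y L → Edge G y z → Path G z w M → Path G x w (L ++ M)
    path-++ stop     e q = e ◂ q
    path-++ (e′ ◂ p) e q = e′ ◂ path-++ p e q

    path-join : ∀ {x y z L M} → Path G x y L → Path G y z (y ∷ M) → Path G x z (L ++ M)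
    path-join stop    q = q
    path-join (e ◂ p) q = e ◂ path-join p q

    path-reverse : ∀ {x y L} → Path G x y L → Path G y x (reverse L)
    path-reverse stop = stop
    path-reverse {x} {y} (_◂_ {L = L} e p) =
      subst (Path G y x) (sym (unfold-reverse x L)) (path-++ (path-reverse p) (sym-edge G e) stop)

    path-split : ∀ A {x y z B} → Path G x y (A ++ z ∷ B) → Path G x z (A ++ [ z ]) × Path G z y (z ∷ B)
    path-split []      stop    = stop , stop
    path-split []      (e ◂ p) = stop , e ◂ p
    path-split (a ∷ []) (e ◂ p) with path-split [] p
    ... | q , r = e ◂ q , r
    path-split (a ∷ b ∷ A) (e ◂ p) with path-split (b ∷ A) p
    ... | q , r = e ◂ q , r

    path-uncons : ∀ {x y z w L} → Path G x y (z ∷ w ∷ L) → x ≡ z × Edge G x w × Path G w y (w ∷ L)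
    path-uncons (e ◂ stop)     = refl , e , stop
    path-uncons (e ◂ (e′ ◂ p)) = refl , e , e′ ◂ p

    path-cut : ∀ A {x y z w B} → Path G x y (A ++ z ∷ w ∷ B) →
               Path G x z (A ++ [ z ]) × Edge G z w × Path G w y (w ∷ B)
    path-cut A p with path-split A p
    ... | q , r with path-uncons r
    ...   | refl , e , s = q , e , s

    path-last≡ : ∀ A {x y z} → Path G x y (A ++ [ z ]) → y ≡ z
    path-last≡ []          stop    = refl
    path-last≡ (a ∷ [])    (e ◂ p) = path-last≡ [] p
    path-last≡ (a ∷ b ∷ A) (e ◂ p) = path-last≡ (b ∷ A) p

    path-head≡ : ∀ {x y z L} → Path G x y (z ∷ L) → x ≡ z
    path-head≡ stop    = refl
    path-head≡ (e ◂ p) = refl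

    closed-path : ∀ {x L} → Path G x x L → Uniq L → L ≡ x ∷ []
    closed-path stop    u = refl
    closed-path (e ◂ p) u = ⊥-elim (Uniq-head u (last∈ p))

    path? : ∀ x y L → Dec (Path G x y L)
    path? x y [] = no λ ()
    path? x y (z ∷ []) with x ≟F z | y ≟F z
    ... | yes refl | yes refl = yes stop
    ... | no x≢z   | _        = no λ p → x≢z (path-head≡ p)
    ... | yes _    | no y≢z   = no λ p → y≢z (path-last≡ [] p)
    path? x y (z ∷ w ∷ L) with x ≟F z | adj G x w ≟ᵇ true | path? w y (w ∷ L)
    ... | no x≢z   | _     | _     = no λ p → x≢z (path-head≡ p)
    ... | yes refl | no ¬e | _     = no λ p → ¬e (proj₁ (proj₂ (path-uncons p)))
    ... | yes refl | yes e | yes p = yes (e ◂ p)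
    ... | yes refl | yes e | no ¬p = no λ p → ¬p (proj₂ (proj₂ (path-uncons p)))

    path-lookup : ∀ {x y L} → Path G x y L → ∀ (i j : Fin (length L)) → suc (toℕ i) ≡ toℕ j →
                  Edge G (lookup L i) (lookup L j)
    path-lookup stop    fzero    fzero    ()
    path-lookup (e ◂ p) fzero (fsuc j) eq with path-head p
    path-lookup (e ◂ p) fzero (fsuc fzero)    eq | M , refl = e
    path-lookup (e ◂ p) fzero (fsuc (fsuc j)) () | M , refl
    path-lookup (e ◂ p) (fsuc i) (fsuc j) eq = path-lookup p i j (suc-injective eq)

    lookup-first : ∀ {x y L} → Path G x y L → ∀ (i : Fin (length L)) → toℕ i ≡ 0 → lookup L i ≡ x
    lookup-first stop    fzero eq = refl
    lookup-first (e ◂ p) fzero eq = refl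

    lookup-last : ∀ {x y L} → Path G x y L → ∀ (i : Fin (length L)) → suc (toℕ i) ≡ length L → lookup L i ≡ y
    lookup-last stop    fzero    eq = refl
    lookup-last (e ◂ p) fzero    eq with path-head p
    lookup-last (e ◂ p) fzero    () | M , refl
    lookup-last (e ◂ p) (fsuc i) eq = lookup-last p i (suc-injective eq)

  -- A cycle is a repetition-free path together with an edge between its ends. A single edge run
  -- back and forth counts as well, which is harmless once `c` is at least 2.
  NoLong : Graph n → ℕ → Set
  NoLong G c = ∀ {x y L} → Path G x y L → Uniq L → Edge G y x → length L ≤ c

  longest⇒NoLong : ∀ (G : Graph n) c C → IsLongestCycle G c C → NoLong G c
  longest⇒NoLong G c C (isC , longest) {x} {y} {L} p u e with length L ≤? c
  ... | yes le = le
  -- Here `L` has more than `c ≥ 3` vertices, so the closed path is a genuine cycle.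
  ... | no gt  = longest (length L) (lookup L)
    ( ≤-trans (proj₁ isC) (<⇒≤ (≰⇒> gt))
    , (λ {i} {j} → lookup-injective u {i} {j})
    , λ { i j (inj₁ eq) → path-lookup p i j eq
        ; i j (inj₂ (eq , eq′)) → subst₂ (Edge G) (sym (lookup-last p i eq)) (sym (lookup-first p j eq′)) e })

  LongPath : Graph n → ℕ → V → V → Set
  LongPath G c x y = ∃[ L ] (Path G x y L × Uniq L × c < length L)

  longPath-sym : ∀ {G c x y} → LongPath G c x y → LongPath G c y x
  longPath-sym (L , p , u , lt) = reverse L , path-reverse p , Uniq-reverse u , subst (_ <_) (sym (length-reverse L)) lt

-- Exhaustive search over lists of vertices

  ∃-length? : ∀ {P : List V → Set} → (∀ L → Dec (P L)) → ∀ m → Dec (∃[ L ] (length L ≡ m × P L))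
  ∃-length? P? zero with P? []
  ... | yes p = yes ([] , refl , p)
  ... | no ¬p = no λ { ([] , _ , p) → ¬p p }
  ∃-length? P? (suc m) with any? (λ x → ∃-length? (λ L → P? (x ∷ L)) m)
  ... | yes (x , L , refl , p) = yes (x ∷ L , refl , p)
  ... | no ¬p = no λ { (x ∷ L , eq , p) → ¬p (x , L , suc-injective eq , p) }

  ∃-bounded? : ∀ {P : List V → Set} → (∀ L → Dec (P L)) → ∀ m → Dec (∃[ L ] (length L ≤ m × P L))
  ∃-bounded? P? zero with ∃-length? P? zero
  ... | yes (L , eq , p) = yes (L , ≤-reflexive eq , p)
  ... | no ¬p = no λ { (L , le , p) → ¬p (L , n≤0⇒n≡0 le , p) }
  ∃-bounded? P? (suc m) with ∃-length? P? (suc m) | ∃-bounded? P? m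
  ... | yes (L , eq , p) | _ = yes (L , ≤-reflexive eq , p)
  ... | no _ | yes (L , le , p) = yes (L , m≤n⇒m≤1+n le , p)
  ... | no ¬p | no ¬q = no λ { (L , le , p) → [ (λ lt → ¬q (L , s≤s⁻¹ lt , p)) , (λ eq → ¬p (L , eq , p)) ]′ (m≤n⇒m<n∨m≡n le) }

  ∃-longest : ∀ {P : List V → Set} → (∀ L → Dec (P L)) → ∀ m → (∀ L → P L → length L ≤ m) → ∃ P →
              ∃[ L ] (P L × (∀ M → P M → length M ≤ length L))
  ∃-longest P? zero bound (L , p) = L , p , λ M q → ≤-trans (bound M q) z≤n
  ∃-longest P? (suc m) bound (L , p) with ∃-length? P? (suc m)
  ... | yes (M , eq , q) = M , q , λ N r → subst (length N ≤_) (sym eq) (bound N r)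
  ... | no ¬q = ∃-longest P? m
    (λ M q → [ s≤s⁻¹ , (λ eq → ⊥-elim (¬q (M , eq , q))) ]′ (m≤n⇒m<n∨m≡n (bound M q))) (L , p)

  uniq? : (L : List V) → Dec (Uniq L)
  uniq? [] = yes Uniq-[]
  uniq? (x ∷ L) with x ∈? L | uniq? L
  ... | yes x∈L | _     = no λ u → Uniq-head u x∈L
  ... | no x∉L  | yes u = yes (Uniq-∷ x∉L u)
  ... | no x∉L  | no ¬u = no (¬u ∘ Uniq-tail)

  -- A repetition-free list has at most `n` entries, so the search is finite; its outcome decides
  -- whether a pair may be joined.
  longPath? : ∀ G c x y → Dec (LongPath G c x y)
  longPath? G c x y = map′ (λ { (L , _ , p , u , lt) → L , p , u , lt })
                           (λ { (L , p , u , lt) → L , length≤n u , p , u , lt })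
    (∃-bounded? (λ L → path? x y L ×-dec uniq? L ×-dec (suc c ≤? length L)) n)

-- Edge-maximal graphs without long cycles

  sameEdge : V → V → V → V → Bool
  sameEdge a b u v = (⌊ u ≟F a ⌋ ∧ ⌊ v ≟F b ⌋) ∨ (⌊ u ≟F b ⌋ ∧ ⌊ v ≟F a ⌋)

  sameEdge-true : ∀ a b u v → sameEdge a b u v ≡ true → (u ≡ a × v ≡ b) ⊎ (u ≡ b × v ≡ a)
  sameEdge-true a b u v eq with u ≟F a | v ≟F b | u ≟F b | v ≟F a
  ... | yes p | yes q | _     | _     = inj₁ (p , q)
  ... | yes _ | no _  | yes p | yes q = inj₂ (p , q)
  ... | no _  | _     | yes p | yes q = inj₂ (p , q)

  addEdge : Graph n → (a b : V) → a ≢ b → Graph n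
  addEdge G a b a≢b = record
    { adj     = λ u v → adj G u v ∨ sameEdge a b u v
    ; adj-sym = λ u v → cong₂ _∨_ (adj-sym G u v)
        (trans (∨-comm (⌊ u ≟F a ⌋ ∧ ⌊ v ≟F b ⌋) _) (cong₂ _∨_ (∧-comm ⌊ u ≟F b ⌋ _) (∧-comm ⌊ u ≟F a ⌋ _)))
    ; adj-irr = irr
    }
    where
    irr : ∀ u → adj G u u ∨ sameEdge a b u u ≡ false
    irr u rewrite adj-irr G u with u ≟F a | u ≟F b
    ... | yes refl | yes refl = ⊥-elim (a≢b refl)
    ... | yes _    | no _     = refl
    ... | no _     | yes _    = refl
    ... | no _     | no _     = refl

  module _ (G : Graph n) {a b : V} (a≢b : a ≢ b) where

    private G⁺ = addEdge G a b a≢b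

    ⊑-addEdge : G ⊑ G⁺
    ⊑-addEdge {x} {y} e rewrite e = refl

    addEdge-new : Edge G⁺ a b
    addEdge-new with a ≟F a | b ≟F b
    ... | yes _ | yes _ = ∨-zeroʳ _
    ... | no h  | _     = ⊥-elim (h refl)
    ... | yes _ | no h  = ⊥-elim (h refl)

    New : V → V → Set
    New x y = (x ≡ a × y ≡ b) ⊎ (x ≡ b × y ≡ a)

    addEdge-edge : ∀ {x y} → Edge G⁺ x y → Edge G x y ⊎ New x y
    addEdge-edge {x} {y} e with adj G x y
    ... | true  = inj₁ refl
    ... | false = inj₂ (sameEdge-true a b x y e)

    -- The new edge cannot be traversed without visiting `z`, one of its ends.
    path-avoiding : ∀ {x y L z w} → New z w → Path G⁺ x y L → z ∉ L → Path G x y L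
    path-avoiding nw stop z∉ = stop
    path-avoiding nw (e ◂ p) z∉ with addEdge-edge e | path-avoiding nw p (z∉ ∘ there)
    ... | inj₁ e′ | q = e′ ◂ q
    path-avoiding (inj₁ (refl , refl)) (e ◂ p) z∉ | inj₂ (inj₁ (refl , refl)) | q = ⊥-elim (z∉ (here refl))
    path-avoiding (inj₂ (refl , refl)) (e ◂ p) z∉ | inj₂ (inj₁ (refl , refl)) | q = ⊥-elim (z∉ (there (first∈ p)))
    path-avoiding (inj₁ (refl , refl)) (e ◂ p) z∉ | inj₂ (inj₂ (refl , refl)) | q = ⊥-elim (z∉ (there (first∈ p)))
    path-avoiding (inj₂ (refl , refl)) (e ◂ p) z∉ | inj₂ (inj₂ (refl , refl)) | q = ⊥-elim (z∉ (here refl))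

    -- A repetition-free path traverses the new edge at most once; `used` keeps the two parts on
    -- either side of it.
    data Usage (x y : V) : List V → Set where
      unused : ∀ {L} → Path G x y L → Usage x y L
      used   : ∀ {p q A B} → New p q → Path G x p A → Path G q y B → Usage x y (A ++ B)

    usage : ∀ {x y L} → Path G⁺ x y L → Uniq L → Usage x y L
    usage stop u = unused stop
    usage (e ◂ p) u with addEdge-edge e
    ... | inj₂ nw = used nw stop (path-avoiding nw p (Uniq-head u))
    ... | inj₁ e′ with usage p (Uniq-tail u)
    ...   | unused q       = unused (e′ ◂ q)
    ...   | used nw q r    = used nw (e′ ◂ q) r

    -- A long cycle that is not already in `G` contains the new edge, and deleting that edge leaves
    -- a long path of `G` between `a` and `b` on the same vertices. The edge may be the closing one
    -- or lie on the path. It is both only for a path on two vertices, which is not long because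
    -- `2 ≤ c`.
    addEdge-NoLong : ∀ {c} → 2 ≤ c → NoLong G c → ¬ LongPath G c a b → NoLong G⁺ c
    addEdge-NoLong {c} 2≤c nl nlp {x} {y} {L} p u e with length L ≤? c
    ... | yes le = le
    ... | no nle = ⊥-elim (contra (≰⇒> nle) (usage p u) (addEdge-edge e) u)
      where
      no-new : ∀ {z w} → New z w → ¬ LongPath G c w z
      no-new (inj₁ (refl , refl)) lp = nlp (longPath-sym lp)
      no-new (inj₂ (refl , refl)) lp = nlp lp
      contra : ∀ {L} → c < length L → Usage x y L → Edge G y x ⊎ New y x → Uniq L → ⊥
      contra lt (unused q) (inj₁ e′) u = <⇒≱ lt (nl q u e′)
      contra lt (unused q) (inj₂ nw) u = no-new nw (_ , q , u , lt)
      contra lt (used {A = A} {B} nw q r) (inj₁ e′) u = no-new nw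
        ( B ++ A , path-++ r e′ q
        , Uniq-≤ (λ z → ≤-reflexive (trans (Σₗ-++ (δ z) B A) (trans (+-comm (count z B) _) (sym (Σₗ-++ (δ z) A B))))) u
        , subst (c <_) (trans (length-++ A) (trans (+-comm (length A) _) (sym (length-++ B)))) lt )
      contra lt (used {p} {q} {A} {B} nw q₁ r) (inj₂ nw′) u with x ≟F p | q ≟F y
      ... | yes refl | yes refl with closed-path q₁ (Uniq-++⁻ˡ A u) | closed-path r (Uniq-++⁻ʳ A u)
      ...   | refl | refl = <⇒≱ lt 2≤c
      contra lt (used {p} {q} {A} {B} nw q₁ r) (inj₂ nw′) u | no x≢p | _ = absurd nw nw′
        where
        absurd : New p q → New y x → ⊥
        absurd (inj₁ (refl , refl)) (inj₁ (refl , refl)) = Uniq-disjoint A u (first∈ q₁) (first∈ r)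
        absurd (inj₁ (refl , refl)) (inj₂ (refl , refl)) = x≢p refl
        absurd (inj₂ (refl , refl)) (inj₁ (refl , refl)) = x≢p refl
        absurd (inj₂ (refl , refl)) (inj₂ (refl , refl)) = Uniq-disjoint A u (first∈ q₁) (first∈ r)
      contra lt (used {p} {q} {A} {B} nw q₁ r) (inj₂ nw′) u | yes refl | no q≢y = absurd nw nw′
        where
        absurd : New p q → New y x → ⊥
        absurd (inj₁ (refl , refl)) (inj₁ (refl , refl)) = a≢b refl
        absurd (inj₁ (refl , refl)) (inj₂ (refl , refl)) = q≢y refl
        absurd (inj₂ (refl , refl)) (inj₁ (refl , refl)) = q≢y refl
        absurd (inj₂ (refl , refl)) (inj₂ (refl , refl)) = a≢b refl

  ⊑-trans : ∀ {G G′ G″ : Graph n} → G ⊑ G′ → G′ ⊑ G″ → G ⊑ G″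
  ⊑-trans h k e = k (h e)

  -- All three alternatives survive the addition of edges, so a pair treated once stays settled and
  -- a single pass over all pairs produces an edge-maximal graph.
  Settled : Graph n → ℕ → V → V → Set
  Settled G c x y = x ≡ y ⊎ Edge G x y ⊎ LongPath G c x y

  settled-mono : ∀ {G G′ : Graph n} {c x y} → G ⊑ G′ → Settled G c x y → Settled G′ c x y
  settled-mono h (inj₁ eq)                    = inj₁ eq
  settled-mono h (inj₂ (inj₁ e))              = inj₂ (inj₁ (h e))
  settled-mono h (inj₂ (inj₂ (L , p , u , lt))) = inj₂ (inj₂ (L , path-mono h p , u , lt))

  settle : ∀ {c} → 2 ≤ c → (G : Graph n) → NoLong G c → ∀ x y →
           ∃[ G′ ] (G ⊑ G′ × NoLong G′ c × Settled G′ c x y)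
  settle {c} 2≤c G nl x y with x ≟F y | longPath? G c x y
  ... | yes eq | _      = G , id , nl , inj₁ eq
  ... | no _   | yes lp = G , id , nl , inj₂ (inj₂ lp)
  ... | no x≢y | no ¬lp = addEdge G x y x≢y , ⊑-addEdge G x≢y , addEdge-NoLong G x≢y 2≤c nl ¬lp
                        , inj₂ (inj₁ (addEdge-new G x≢y))

  settle-row : ∀ {c} → 2 ≤ c → (G : Graph n) → NoLong G c → ∀ x (L : List V) →
               ∃[ G′ ] (G ⊑ G′ × NoLong G′ c × (∀ {y} → y ∈ L → Settled G′ c x y))
  settle-row 2≤c G nl x [] = G , id , nl , λ ()
  settle-row 2≤c G nl x (y ∷ L) with settle 2≤c G nl x y
  ... | G₁ , G⊑ , nl₁ , st with settle-row 2≤c G₁ nl₁ x L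
  ...   | G₂ , G₁⊑ , nl₂ , sts = G₂ , ⊑-trans {G} {G₁} {G₂} G⊑ G₁⊑ , nl₂
        , λ { (here refl) → settled-mono {G₁} {G₂} G₁⊑ st ; (there y∈) → sts y∈ }

  settle-all : ∀ {c} → 2 ≤ c → (G : Graph n) → NoLong G c → ∀ (L : List V) →
               ∃[ G′ ] (G ⊑ G′ × NoLong G′ c × (∀ {x} → x ∈ L → ∀ y → Settled G′ c x y))
  settle-all 2≤c G nl [] = G , id , nl , λ ()
  settle-all 2≤c G nl (x ∷ L) with settle-row 2≤c G nl x (allFin n)
  ... | G₁ , G⊑ , nl₁ , st with settle-all 2≤c G₁ nl₁ L
  ...   | G₂ , G₁⊑ , nl₂ , sts = G₂ , ⊑-trans {G} {G₁} {G₂} G⊑ G₁⊑ , nl₂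
        , λ { (here refl) y → settled-mono {G₁} {G₂} G₁⊑ (st (∈-allFin y)) ; (there x∈) → sts x∈ }

  saturate : ∀ {c} → 2 ≤ c → (G : Graph n) → NoLong G c →
             ∃[ G′ ] (G ⊑ G′ × NoLong G′ c × (∀ x y → Settled G′ c x y))
  saturate 2≤c G nl with settle-all 2≤c G nl (allFin n)
  ... | G′ , G⊑ , nl′ , st = G′ , G⊑ , nl′ , λ x y → st (∈-allFin x) y

-- Walks

  walk⇒path : ∀ {G : Graph n} {ok : V → Set} {x y} → Walk G ok x y → ∃[ L ] (Path G x y L × Uniq L × (∀ {z} → z ∈ L → ok z))
  walk⇒path ([] {x} okx) = x ∷ [] , stop , Uniq-[x] , λ { (here refl) → okx }
  walk⇒path {G} (step {x} okx e w) with walk⇒path w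
  ... | L , p , u , h with x ∈? L
  ...   | no x∉L = x ∷ L , e ◂ p , Uniq-∷ x∉L u , λ { (here refl) → okx ; (there z∈) → h z∈ }
  ...   | yes x∈L with ∈-∃++ x∈L
  ...     | A , B , refl = x ∷ B , proj₂ (path-split A p) , Uniq-++⁻ʳ A u , λ z∈ → h (∈-++⁺ʳ A z∈)

  NoCutvertex : Graph n → Set
  NoCutvertex G = ∀ v x y → x ≢ v → y ≢ v → ∃[ L ] (Path G x y L × Uniq L × v ∉ L)

  twoConnected⇒NoCutvertex : ∀ {G G′ : Graph n} → G ⊑ G′ → TwoConnected G → NoCutvertex G′
  twoConnected⇒NoCutvertex h (_ , _ , tc) v x y x≢v y≢v with walk⇒path (tc v x y x≢v y≢v)
  ... | L , p , u , ok = L , path-mono h p , u , λ v∈L → ok v∈L refl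

-- Kopylov's lemma

module _ {n : ℕ} (G : Graph n) where

  private V = Fin n

  edge? : ∀ x y → Dec (Edge G x y)
  edge? x y = adj G x y ≟ᵇ true

  deg : V → List V → ℕ
  deg v = Σₗ (λ w → ind (adj G v w))

  ind-true : ∀ {b} → b ≡ true → ind b ≡ 1
  ind-true refl = refl

  ind-false : ∀ {b} → ¬ (b ≡ true) → ind b ≡ 0
  ind-false {true}  h = ⊥-elim (h refl)
  ind-false {false} h = refl

  ind≤1 : ∀ b → ind b ≤ 1
  ind≤1 true  = ≤-refl
  ind≤1 false = z≤n

  ind≢0 : ∀ {b} → ind b ≢ 0 → b ≡ true
  ind≢0 {true}  h = refl
  ind≢0 {false} h = ⊥-elim (h refl)

  deg≤length : ∀ v L → deg v L ≤ length L
  deg≤length v L = subst (deg v L ≤_) (Σₗ-one L) (Σₗ-mono L (λ {x} _ → ind≤1 (adj G v x)))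

  deg-none : ∀ v {L} → All (λ w → ¬ Edge G v w) L → deg v L ≡ 0
  deg-none v {L} none = Σₗ-zero _ L (λ x∈ → ind-false (All.lookup none x∈))

  deg-first : ∀ {x y L} → Path G x y L → deg x L < length L
  deg-first {x} p with path-head p
  ... | M , refl rewrite adj-irr G x = s≤s (deg≤length x M)

  -- With u's neighbours all inside A ++ [ a ], the path returned enters at p, runs back to u,
  -- jumps to the first neighbour of u beyond p and goes on to a; only non-neighbours are lost.
  foldEnd : ∀ {u a p} A → Path G u a (A ++ [ a ]) → Uniq (A ++ [ a ]) → Edge G u a → p ∈ A →
            ∃[ F ] (Path G p a F × Uniq F × (∀ {x} → x ∈ F → x ∈ A ++ [ a ]) × deg u (A ++ [ a ]) < length F)
  foldEnd {u} {a} {p} A pth un e p∈A with ∈-∃++ p∈A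
  ... | A₁ , A₂ , refl with first-split (edge? u) (A₂ ++ [ a ])
  ...   | inj₁ none = ⊥-elim (All.head (All-++⁻ʳ A₂ none) e)
  ...   | inj₂ (N , i , I , eq , none , ei) = F , pathF , Uniq-≤ cnt un′ , F⊆ , len
    where
    whole : (A₁ ++ p ∷ A₂) ++ [ a ] ≡ A₁ ++ p ∷ N ++ i ∷ I
    whole = trans (++-assoc A₁ (p ∷ A₂) [ a ]) (cong (λ l → A₁ ++ p ∷ l) eq)
    pth′ : Path G u a (A₁ ++ p ∷ N ++ i ∷ I)
    pth′ = subst (Path G u a) whole pth
    un′ : Uniq (A₁ ++ p ∷ N ++ i ∷ I)
    un′ = subst Uniq whole un
    F : List V
    F = reverse (A₁ ++ [ p ]) ++ i ∷ I
    split : Path G u p (A₁ ++ [ p ]) × Path G p a (p ∷ N ++ i ∷ I)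
    split = path-split A₁ pth′
    pathF : Path G p a F
    pathF = path-++ (path-reverse (proj₁ split)) ei (proj₂ (path-split (p ∷ N) (proj₂ split)))
    Σ-whole : ∀ w → Σₗ w (A₁ ++ p ∷ N ++ i ∷ I) ≡ Σₗ w (A₁ ++ [ p ]) + Σₗ w N + Σₗ w (i ∷ I)
    Σ-whole w rewrite Σₗ-++ w A₁ (p ∷ N ++ i ∷ I) | Σₗ-++ w N (i ∷ I) | Σₗ-++ w A₁ [ p ] =
      lem (Σₗ w A₁) (w p) (Σₗ w N) (w i + Σₗ w I)
      where
      lem : ∀ a b c d → a + (b + (c + d)) ≡ a + (b + 0) + c + d
      lem = solve-∀
    cnt : ∀ x → count x F ≤ count x (A₁ ++ p ∷ N ++ i ∷ I)
    cnt x rewrite Σ-whole (δ x) | Σₗ-++ (δ x) (reverse (A₁ ++ [ p ])) (i ∷ I) | Σₗ-reverse (δ x) (A₁ ++ [ p ]) =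
      +-monoˡ-≤ (count x (i ∷ I)) (m≤m+n (count x (A₁ ++ [ p ])) (count x N))
    F⊆ : ∀ {x} → x ∈ F → x ∈ (A₁ ++ p ∷ A₂) ++ [ a ]
    F⊆ {x} x∈F = subst (x ∈_) (sym whole) (count⇒∈ _ (≤-trans (∈⇒count x∈F) (cnt x)))
    len : deg u ((A₁ ++ p ∷ A₂) ++ [ a ]) < length F
    len = begin-strict
      deg u ((A₁ ++ p ∷ A₂) ++ [ a ])                        ≡⟨ cong (deg u) whole ⟩
      deg u (A₁ ++ p ∷ N ++ i ∷ I)                           ≡⟨ Σ-whole _ ⟩
      deg u (A₁ ++ [ p ]) + deg u N + deg u (i ∷ I)          ≡⟨ cong (λ k → deg u (A₁ ++ [ p ]) + k + deg u (i ∷ I)) (deg-none u none) ⟩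
      deg u (A₁ ++ [ p ]) + 0 + deg u (i ∷ I)                ≡⟨ cong (_+ deg u (i ∷ I)) (+-identityʳ (deg u (A₁ ++ [ p ]))) ⟩
      deg u (A₁ ++ [ p ]) + deg u (i ∷ I)                    <⟨ +-mono-<-≤ (deg-first (proj₁ split)) (deg≤length u (i ∷ I)) ⟩
      length (A₁ ++ [ p ]) + length (i ∷ I)                  ≡⟨ cong (_+ length (i ∷ I)) (length-reverse (A₁ ++ [ p ])) ⟨
      length (reverse (A₁ ++ [ p ])) + length (i ∷ I)        ≡⟨ length-++ (reverse (A₁ ++ [ p ])) ⟨
      length F                                               ∎
      where open ≤-Reasoning

  record Connection (Src Dst : List V) (x : V) : Set where
    field
      start end : V
      mid       : List V
      path      : Path G start end (start ∷ mid ++ [ end ])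
      unique    : Uniq (start ∷ mid ++ [ end ])
      start∈    : start ∈ Src
      end∈      : end ∈ Dst
      mid∉Src   : ∀ {z} → z ∈ mid → z ∉ Src
      mid∉Dst   : ∀ {z} → z ∈ mid → z ∉ Dst
      avoids    : x ∉ start ∷ mid ++ [ end ]

  -- The path from `y` to `z` avoiding `x` starts in `Src` and ends in `Dst`, so it contains a
  -- vertex of `Src` followed, after a stretch missing both sets, by a vertex of `Dst`.
  connect : NoCutvertex G → ∀ (Src Dst : List V) {x y z} → y ∈ Src → z ∈ Dst → y ≢ z → y ≢ x → z ≢ x → Connection Src Dst x
  connect tc Src Dst {x} {y} {z} y∈ z∈ y≢z y≢x z≢x with tc x y z y≢x z≢x
  ... | L , p , u , x∉L = go p u x∉L (scan (_∈? Dst) (_∈? Src) L)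
    where
    go : ∀ {L} → Path G y z L → Uniq L → x ∉ L → Scan (_∈ Dst) (_∈ Src) L → Connection Src Dst x
    go p u x∉L (crossing X a M b Y a∈ b∈ none) = record
      { start = a ; end = b ; mid = M
      ; path = proj₁ (path-split (a ∷ M) (proj₂ (path-split X p)))
      ; unique = Uniq-++⁻ˡ (a ∷ M ++ [ b ]) (subst Uniq regroup (Uniq-++⁻ʳ X u))
      ; start∈ = a∈ ; end∈ = b∈
      ; mid∉Src = λ z∈M → proj₂ (All.lookup none z∈M)
      ; mid∉Dst = λ z∈M → proj₁ (All.lookup none z∈M)
      ; avoids = λ x∈ → x∉L (∈-++⁺ʳ X (subst (x ∈_) (sym regroup) (∈-++⁺ˡ x∈)))
      }
      where
      regroup : a ∷ M ++ b ∷ Y ≡ (a ∷ M ++ [ b ]) ++ Y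
      regroup = cong (a ∷_) (sym (++-assoc M [ b ] Y))
    go p u x∉L (separated sep) with path-head p | ∈-∃++ (last∈ p)
    ... | M , refl | [] , B , refl = ⊥-elim (y≢z refl)
    ... | M , refl | _ ∷ A , B , eq = ⊥-elim (All.head (sep (_ ∷ A) z B eq z∈) (subst (_∈ Src) (proj₁ (∷-injective eq)) y∈))

  -- Two disjoint paths leaving the initial segment A ++ [ a ] of a path, one from a and one from
  -- some vertex p of A; one of them ends at w and the other in R, the part of the path beyond w.
  record Linkage (A : List V) (a w : V) (R : List V) : Set where
    field
      p s s′ q : V
      Sw Sq    : List V
      p∈A      : p ∈ A
      starts   : (s ≡ a × s′ ≡ p) ⊎ (s ≡ p × s′ ≡ a)
      q∈R      : q ∈ R
      path-w   : Path G s w Sw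
      path-q   : Path G s′ q Sq
      uniq-w   : Uniq Sw
      uniq-q   : Uniq Sq
      disjoint : ∀ {x} → x ∈ Sw → x ∈ Sq → ⊥
      w-R      : ∀ {x} → x ∈ Sw → x ∈ R → ⊥
      q-R      : ∀ {x} → x ∈ Sq → x ∈ R → x ≡ q
      w-A      : ∀ {x} → x ∈ Sw → x ∈ A ++ [ a ] → x ≡ s
      q-A      : ∀ {x} → x ∈ Sq → x ∈ A ++ [ a ] → x ≡ s′

  -- For `w = a` one path is the single vertex `a`; the other bypasses `a`, which is not a
  -- cutvertex.
  baseLinkage : NoCutvertex G → ∀ A a R {u v} → u ∈ A → v ∈ R → Uniq (A ++ a ∷ R) → Linkage A a a R
  baseLinkage tc A a R {u} {v} u∈A v∈R un = record
    { p = start ; s = a ; s′ = start ; q = end ; Sw = [ a ] ; Sq = start ∷ mid ++ [ end ]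
    ; p∈A = start∈ ; starts = inj₁ (refl , refl) ; q∈R = end∈
    ; path-w = stop ; path-q = path ; uniq-w = Uniq-[x] ; uniq-q = unique
    ; disjoint = λ { (here refl) x∈ → avoids x∈ }
    ; w-R = λ { (here refl) x∈ → Uniq-head (Uniq-++⁻ʳ A un) x∈ }
    ; q-R = λ { (here refl) x∈R → ⊥-elim (A∩R start∈ x∈R)
              ; (there x∈) x∈R → [ (λ x∈mid → ⊥-elim (mid∉Dst x∈mid x∈R)) , (λ { (here eq) → eq }) ]′ (∈-++⁻ mid x∈) }
    ; w-A = λ { (here refl) _ → refl }
    ; q-A = q-A′
    }
    where
    A∩R : ∀ {x} → x ∈ A → x ∈ R → ⊥
    A∩R x∈A x∈R = Uniq-disjoint A un x∈A (there x∈R)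
    a≢ : ∀ {x} → x ∈ A → x ≢ a
    a≢ x∈A refl = Uniq-disjoint A un x∈A (here refl)
    ≢a : ∀ {x} → x ∈ R → x ≢ a
    ≢a x∈R refl = Uniq-head (Uniq-++⁻ʳ A un) x∈R
    connection : Connection A R a
    connection = connect tc A R u∈A v∈R (λ { refl → A∩R u∈A v∈R }) (a≢ u∈A) (≢a v∈R)
    open Connection connection
    q-A′ : ∀ {x} → x ∈ start ∷ mid ++ [ end ] → x ∈ A ++ [ a ] → x ≡ start
    q-A′ {x} x∈ x∈Aa with ∈-++⁻ A x∈Aa
    ... | inj₂ (here refl) = ⊥-elim (avoids x∈)
    ... | inj₁ x∈A with x∈
    ...   | here eq = eq
    ...   | there x∈′ with ∈-++⁻ mid x∈′
    ...     | inj₁ x∈mid      = ⊥-elim (mid∉Src x∈mid x∈A)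
    ...     | inj₂ (here refl) = ⊥-elim (A∩R x∈A end∈)

  module _ (tc : NoCutvertex G) {A : List V} {a w w′ : V} {R : List V} {u v : V}
           (u∈A : u ∈ A) (v∈R : v ∈ R) (e : Edge G w w′)
           (uR : Uniq (w′ ∷ R)) (A∩R : ∀ {x} → x ∈ A ++ [ a ] → x ∈ w′ ∷ R → ⊥)
           (lk : Linkage A a w (w′ ∷ R)) where

    open Linkage lk

    private
      Src : List V
      Src = (A ++ [ a ]) ++ Sw ++ Sq

      A⊆Src : ∀ {x} → x ∈ A ++ [ a ] → x ∈ Src
      A⊆Src = ∈-++⁺ˡ

      Sw⊆Src : ∀ {x} → x ∈ Sw → x ∈ Src
      Sw⊆Src x∈ = ∈-++⁺ʳ (A ++ [ a ]) (∈-++⁺ˡ x∈)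

      Sq⊆Src : ∀ {x} → x ∈ Sq → x ∈ Src
      Sq⊆Src x∈ = ∈-++⁺ʳ (A ++ [ a ]) (∈-++⁺ʳ Sw x∈)

      module _ (C : Connection Src R w′) where

        open Connection C

        relink : ∀ {p₁ s₁ s₁′ W T} → p₁ ∈ A → (s₁ ≡ a × s₁′ ≡ p₁) ⊎ (s₁ ≡ p₁ × s₁′ ≡ a) →
                 Path G s₁ w′ W → Uniq W → (∀ {x} → x ∈ W → x ∈ Src) → (∀ {x} → x ∈ W → x ∈ R → ⊥) →
                 (∀ {x} → x ∈ W → x ∈ A ++ [ a ] → x ≡ s₁) →
                 Path G s₁′ start T → Uniq T → (∀ {x} → x ∈ T → x ∈ Src) → (∀ {x} → x ∈ T → x ∈ R → ⊥) →
                 (∀ {x} → x ∈ T → x ∈ A ++ [ a ] → x ≡ s₁′) → (∀ {x} → x ∈ W → x ∈ T → ⊥) →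
                 Linkage A a w′ R
        relink {W = W} {T} p₁∈ st pW uW W⊆ W∩R W-A pT uT T⊆ T∩R T-A W∩T = record
          { p∈A = p₁∈ ; starts = st ; q∈R = end∈ ; path-w = pW ; path-q = path-join pT path
          ; uniq-w = uW
          ; uniq-q = Uniq-++ T uT (Uniq-tail unique) λ x∈T x∈ →
              [ (λ x∈mid → mid∉Src x∈mid (T⊆ x∈T)) , (λ { (here refl) → T∩R x∈T end∈ }) ]′ (∈-++⁻ mid x∈)
          ; disjoint = λ x∈W x∈ → [ W∩T x∈W , (λ x∈′ → [ (λ x∈mid → mid∉Src x∈mid (W⊆ x∈W))
                                                      , (λ { (here refl) → W∩R x∈W end∈ }) ]′ (∈-++⁻ mid x∈′)) ]′ (∈-++⁻ T x∈)
          ; w-R = W∩R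
          ; q-R = λ x∈ x∈R → [ (λ x∈T → ⊥-elim (T∩R x∈T x∈R))
                             , (λ x∈′ → [ (λ x∈mid → ⊥-elim (mid∉Dst x∈mid x∈R)) , (λ { (here eq) → eq }) ]′ (∈-++⁻ mid x∈′)) ]′ (∈-++⁻ T x∈)
          ; w-A = W-A
          ; q-A = λ x∈ x∈A → [ (λ x∈T → T-A x∈T x∈A)
                             , (λ x∈′ → [ (λ x∈mid → ⊥-elim (mid∉Src x∈mid (A⊆Src x∈A)))
                                        , (λ { (here refl) → ⊥-elim (A∩R x∈A (there end∈)) }) ]′ (∈-++⁻ mid x∈′)) ]′ (∈-++⁻ T x∈)
          }

    -- An augmenting step. If the second path does not end at `w′`, the first one simply takes the
    -- edge from `w` to `w′`. Otherwise a connection avoiding `w′` leads from the present structure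
    -- to `R`. If it leaves from `Sw`, the two paths exchange roles; if from `Sq`, the first path
    -- takes the edge and the second is diverted; if from `A`, it replaces the path that began in
    -- `A`, while the path beginning at `a` is the one that reaches `w′`.
    advance : Linkage A a w′ R
    advance with q ≟F w′
    ... | no q≢w′ = record
      { p∈A = p∈A ; starts = starts
      ; q∈R = q∈R′ q∈R
      ; path-w = path-++ path-w e stop ; path-q = path-q
      ; uniq-w = Uniq-++ Sw uniq-w Uniq-[x] (λ { x∈ (here refl) → w-R x∈ (here refl) })
      ; uniq-q = uniq-q
      ; disjoint = λ x∈ x∈q → [ (λ x∈w → disjoint x∈w x∈q) , (λ { (here refl) → q≢w′ (sym (q-R x∈q (here refl))) }) ]′ (∈-++⁻ Sw x∈)
      ; w-R = λ x∈ x∈R → [ (λ x∈w → w-R x∈w (there x∈R)) , (λ { (here refl) → Uniq-head uR x∈R }) ]′ (∈-++⁻ Sw x∈)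
      ; q-R = λ x∈ x∈R → q-R x∈ (there x∈R)
      ; w-A = λ x∈ x∈A → [ (λ x∈w → w-A x∈w x∈A) , (λ { (here refl) → ⊥-elim (A∩R x∈A (here refl)) }) ]′ (∈-++⁻ Sw x∈)
      ; q-A = q-A
      }
      where
      q∈R′ : q ∈ w′ ∷ R → q ∈ R
      q∈R′ (here eq) = ⊥-elim (q≢w′ eq)
      q∈R′ (there h) = h
    ... | yes refl = reroute
      where
      u≢w′ : u ≢ w′
      u≢w′ refl = A∩R (∈-++⁺ˡ u∈A) (here refl)
      v≢w′ : v ≢ w′
      v≢w′ refl = Uniq-head uR v∈R
      C : Connection Src R w′
      C = connect tc Src R (A⊆Src (∈-++⁺ˡ u∈A)) v∈R (λ { refl → A∩R (∈-++⁺ˡ u∈A) (there v∈R) }) u≢w′ v≢w′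
      open Connection C
      start≢w′ : start ≢ w′
      start≢w′ eq = avoids (here (sym eq))
      Sq∩R : ∀ {x} → x ∈ Sq → x ∈ R → ⊥
      Sq∩R x∈ x∈R with q-R x∈ (there x∈R)
      ... | refl = Uniq-head uR x∈R
      Sw⁺ : List V
      Sw⁺ = Sw ++ [ w′ ]
      uniq-Sw⁺ : Uniq Sw⁺
      uniq-Sw⁺ = Uniq-++ Sw uniq-w Uniq-[x] (λ { x∈ (here refl) → w-R x∈ (here refl) })
      Sw⁺⊆Src : ∀ {x} → x ∈ Sw⁺ → x ∈ Src
      Sw⁺⊆Src x∈ = [ Sw⊆Src , (λ { (here refl) → Sq⊆Src (last∈ path-q) }) ]′ (∈-++⁻ Sw x∈)
      Sw⁺∩R : ∀ {x} → x ∈ Sw⁺ → x ∈ R → ⊥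
      Sw⁺∩R x∈ x∈R = [ (λ x∈w → w-R x∈w (there x∈R)) , (λ { (here refl) → Uniq-head uR x∈R }) ]′ (∈-++⁻ Sw x∈)
      Sw⁺-A : ∀ {x} → x ∈ Sw⁺ → x ∈ A ++ [ a ] → x ≡ s
      Sw⁺-A x∈ x∈A = [ (λ x∈w → w-A x∈w x∈A) , (λ { (here refl) → ⊥-elim (A∩R x∈A (here refl)) }) ]′ (∈-++⁻ Sw x∈)
      flip-starts : (s ≡ a × s′ ≡ p) ⊎ (s ≡ p × s′ ≡ a) → (s′ ≡ a × s ≡ p) ⊎ (s′ ≡ p × s ≡ a)
      flip-starts (inj₁ (h , k)) = inj₂ (k , h)
      flip-starts (inj₂ (h , k)) = inj₁ (k , h)
      reroute : Linkage A a w′ R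
      reroute with start ∈? Sw | start ∈? Sq
      ... | yes st∈ | _ = case ∈-∃++ st∈ of λ { (B₁ , B₂ , eq) →
        let B⊆ : ∀ {x} → x ∈ B₁ ++ [ start ] → x ∈ Sw
            B⊆ {x} x∈ = subst (x ∈_) (trans (++-assoc B₁ [ start ] B₂) (sym eq)) (∈-++⁺ˡ x∈)
            uB : Uniq (B₁ ++ [ start ])
            uB = Uniq-++⁻ˡ (B₁ ++ [ start ]) (subst Uniq (trans eq (sym (++-assoc B₁ [ start ] B₂))) uniq-w)
        in relink C p∈A (flip-starts starts) path-q uniq-q Sq⊆Src Sq∩R q-A
             (proj₁ (path-split B₁ (subst (Path G s w) eq path-w))) uB (Sw⊆Src ∘ B⊆)
             (λ x∈ x∈R → w-R (B⊆ x∈) (there x∈R)) (λ x∈ → w-A (B⊆ x∈)) (λ x∈q x∈ → disjoint (B⊆ x∈) x∈q) }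
      ... | no _ | yes st∈ = case ∈-∃++ st∈ of λ { (B₁ , B₂ , eq) →
        let B⊆ : ∀ {x} → x ∈ B₁ ++ [ start ] → x ∈ Sq
            B⊆ {x} x∈ = subst (x ∈_) (trans (++-assoc B₁ [ start ] B₂) (sym eq)) (∈-++⁺ˡ x∈)
            uB : Uniq (B₁ ++ [ start ])
            uB = Uniq-++⁻ˡ (B₁ ++ [ start ]) (subst Uniq (trans eq (sym (++-assoc B₁ [ start ] B₂))) uniq-q)
            split : Path G s′ start (B₁ ++ [ start ]) × Path G start w′ (start ∷ B₂)
            split = path-split B₁ (subst (Path G s′ w′) eq path-q)
            w′∉ : w′ ∉ B₁ ++ [ start ]
            w′∉ w′∈ = case path-last (proj₂ split) of λ
              { ([] , eq′) → start≢w′ (proj₁ (∷-injective eq′))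
              ; (_ ∷ B₃ , eq′) → Uniq-disjoint (B₁ ++ [ start ])
                  (subst Uniq (trans eq (sym (++-assoc B₁ [ start ] B₂))) uniq-q) w′∈
                  (subst (w′ ∈_) (sym (proj₂ (∷-injective eq′))) (∈-++⁺ʳ B₃ (here refl))) }
        in relink C p∈A starts (path-++ path-w e stop) uniq-Sw⁺ Sw⁺⊆Src Sw⁺∩R Sw⁺-A
             (proj₁ split) uB (Sq⊆Src ∘ B⊆) (λ x∈ → Sq∩R (B⊆ x∈)) (λ x∈ → q-A (B⊆ x∈))
             (λ x∈ x∈B → [ (λ x∈w → disjoint x∈w (B⊆ x∈B)) , (λ { (here refl) → w′∉ x∈B }) ]′ (∈-++⁻ Sw x∈)) }
      ... | no st∉w | no st∉q = fresh starts
        where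
        start∈Aa : start ∈ A ++ [ a ]
        start∈Aa = [ id , (λ st∈ → [ (λ h → ⊥-elim (st∉w h)) , (λ h → ⊥-elim (st∉q h)) ]′ (∈-++⁻ Sw st∈)) ]′ (∈-++⁻ (A ++ [ a ]) start∈)
        fresh : (s ≡ a × s′ ≡ p) ⊎ (s ≡ p × s′ ≡ a) → Linkage A a w′ R
        fresh (inj₁ (refl , refl)) =
          relink C st∈A (inj₁ (refl , refl)) (path-++ path-w e stop) uniq-Sw⁺ Sw⁺⊆Src Sw⁺∩R Sw⁺-A
            stop Uniq-[x] (λ { (here refl) → start∈ }) (λ { (here refl) x∈R → A∩R start∈Aa (there x∈R) })
            (λ { (here refl) _ → refl })
            (λ { x∈ (here refl) → [ st∉w , (λ { (here eq) → start≢w′ eq }) ]′ (∈-++⁻ Sw x∈) })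
          where
          st∈A : start ∈ A
          st∈A with ∈-++⁻ A start∈Aa
          ... | inj₁ h           = h
          ... | inj₂ (here eq) = ⊥-elim (st∉w (subst (_∈ Sw) (sym eq) (first∈ path-w)))
        fresh (inj₂ (refl , refl)) =
          relink C st∈A (inj₁ (refl , refl)) path-q uniq-q Sq⊆Src Sq∩R q-A
            stop Uniq-[x] (λ { (here refl) → start∈ }) (λ { (here refl) x∈R → A∩R start∈Aa (there x∈R) })
            (λ { (here refl) _ → refl }) (λ { x∈ (here refl) → st∉q x∈ })
          where
          st∈A : start ∈ A
          st∈A with ∈-++⁻ A start∈Aa
          ... | inj₁ h           = h
          ... | inj₂ (here eq) = ⊥-elim (st∉q (subst (_∈ Sq) (sym eq) (first∈ path-q)))

  advanceTo : NoCutvertex G → ∀ {A a u v} → u ∈ A → ∀ M {w b B} → v ∈ B → Path G w v (w ∷ M ++ b ∷ B) →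
              Uniq (M ++ b ∷ B) → (∀ {x} → x ∈ A ++ [ a ] → x ∈ M ++ b ∷ B → ⊥) →
              Linkage A a w (M ++ b ∷ B) → Linkage A a b B
  advanceTo tc u∈A []      v∈B p un dis lk = advance tc u∈A v∈B (proj₁ (proj₂ (path-uncons p))) un dis lk
  advanceTo tc u∈A (x ∷ M) v∈B p un dis lk =
    advanceTo tc u∈A M v∈B (proj₂ (proj₂ (path-uncons p))) (Uniq-tail un) (λ x∈A x∈ → dis x∈A (there x∈))
      (advance tc u∈A (∈-++⁺ʳ M (there v∈B)) (proj₁ (proj₂ (path-uncons p))) un dis lk)

  module _ {c : ℕ} (nl : NoLong G c) where

    -- Closes up p ⋯ a ⋯ e₁ ⋯ e₂ with a fourth path from p to e₂.
    closeRing : ∀ {p a e₁ e₂ FA S FB T} → Path G p a FA → Path G a e₁ (a ∷ S) → Path G e₁ e₂ (e₁ ∷ FB) →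
                Path G p e₂ T → p ≢ e₂ → Uniq FA → Uniq (a ∷ S) → Uniq (e₁ ∷ FB) → Uniq T →
                (∀ {x} → x ∈ FA → x ∈ S → ⊥) → (∀ {x} → x ∈ FA → x ∈ FB → ⊥) → (∀ {x} → x ∈ FA → x ∈ T → x ≡ p) →
                (∀ {x} → x ∈ S → x ∈ FB → ⊥) → (∀ {x} → x ∈ S → x ∈ T → ⊥) → (∀ {x} → x ∈ FB → x ∈ T → x ≡ e₂) →
                length FA + length FB ≤ c
    closeRing pA pS pB stop p≢ _ _ _ _ _ _ _ _ _ _ = ⊥-elim (p≢ refl)
    closeRing {p} {e₂ = e₂} {FA} {S} {FB} pA pS pB (_◂_ {y = t} {L = T} e pT) p≢ uA uS uB uT A∩S A∩B A∩T S∩B S∩T B∩T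
      with path-last pT
    ... | I , refl = ≤-trans len (nl
      (path-join (path-join (path-join pA pS) pB) (subst (Path G e₂ t) (reverse-++ I [ e₂ ]) (path-reverse pT)))
      uniqAll (sym-edge G e))
      where
      I⊆ : ∀ {x} → x ∈ reverse I → x ∈ I
      I⊆ = reverse⁻
      uI : Uniq (I ++ [ e₂ ])
      uI = Uniq-tail uT
      uniqAll : Uniq (((FA ++ S) ++ FB) ++ reverse I)
      uniqAll = Uniq-++ _ (Uniq-++ _ (Uniq-++ FA uA (Uniq-tail uS) A∩S) (Uniq-tail uB)
          (λ x∈ x∈B → [ (λ x∈A → A∩B x∈A x∈B) , (λ x∈S → S∩B x∈S x∈B) ]′ (∈-++⁻ FA x∈)))
        (Uniq-reverse (Uniq-++⁻ˡ I uI))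
        λ x∈ x∈I → case ∈-++⁻ (FA ++ S) x∈ of λ
          { (inj₂ x∈B) → case B∩T x∈B (there (∈-++⁺ˡ (I⊆ x∈I))) of λ { refl → Uniq-disjoint I uI (I⊆ x∈I) (here refl) }
          ; (inj₁ x∈′) → case ∈-++⁻ FA x∈′ of λ
            { (inj₁ x∈A) → case A∩T x∈A (there (∈-++⁺ˡ (I⊆ x∈I))) of λ { refl → Uniq-head uT (∈-++⁺ˡ (I⊆ x∈I)) }
            ; (inj₂ x∈S) → S∩T x∈S (there (∈-++⁺ˡ (I⊆ x∈I))) } }
      len : length FA + length FB ≤ length (((FA ++ S) ++ FB) ++ reverse I)
      len rewrite length-++ ((FA ++ S) ++ FB) {reverse I} | length-++ (FA ++ S) {FB} | length-++ FA {S} =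
        ≤-trans (+-monoˡ-≤ (length FB) (m≤m+n (length FA) (length S))) (m≤m+n _ _)

    -- The two folded ends `FA` and `FB` and the two linking paths form a cycle. Each folded end has
    -- more vertices than the degree it represents, and one vertex of `FB` also lies on a linking
    -- path. Hence the degree sum plus 2 is at most `c + 1`.
    closeLinkage : ∀ {u v} A a b B → Path G u a (A ++ [ a ]) → Uniq (A ++ [ a ]) → Edge G u a →
                   Path G b v (b ∷ B) → Uniq (b ∷ B) → Edge G v b →
                   (∀ {x} → x ∈ A ++ [ a ] → x ∈ B → ⊥) → b ∉ A → Linkage A a b B →
                   deg u (A ++ [ a ]) + deg v (b ∷ B) < c
    closeLinkage {u} {v} A a b B pA uA ea pB uB eb A∩B b∉A lk
      with foldEnd A pA uA ea (Linkage.p∈A lk)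
         | foldEnd {p = Linkage.q lk} (reverse B) (subst (Path G v b) (unfold-reverse b B) (path-reverse pB))
             (subst Uniq (unfold-reverse b B) (Uniq-reverse uB)) eb (reverse⁺ (Linkage.q∈R lk))
    ... | FA , pFA , uFA , FA⊆ , lenA | FB , pFB , uFB , FB⊆′ , lenB = finish (Linkage.starts lk)
      where
      open Linkage lk
      degB : deg v (b ∷ B) ≡ deg v (reverse B ++ [ b ])
      degB = trans (sym (Σₗ-reverse _ (b ∷ B))) (cong (deg v) (unfold-reverse b B))
      FB⊆ : ∀ {x} → x ∈ FB → x ∈ B ⊎ x ≡ b
      FB⊆ x∈ = map⊎ reverse⁻ (λ { (here eq) → eq }) (∈-++⁻ (reverse B) (FB⊆′ x∈))
      bound : ∀ k → length FB ≡ suc k → length FA + k ≤ c → deg u (A ++ [ a ]) + deg v (b ∷ B) < c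
      bound k eq le = linear 0 (+-mono-≤ (+-mono-≤ lenA (subst₂ _<_ (sym degB) eq lenB)) le)
        (lem (deg u (A ++ [ a ])) (deg v (b ∷ B)) (length FA) k c)
        where
        lem : ∀ d e f k c → suc (d + e) + (f + suc k + c) + 0 ≡ c + (suc d + suc e + (f + k))
        lem = solve-∀
      finish : (s ≡ a × s′ ≡ p) ⊎ (s ≡ p × s′ ≡ a) → deg u (A ++ [ a ]) + deg v (b ∷ B) < c
      finish (inj₁ (refl , refl)) with path-head path-w | path-head (path-reverse pFB)
      ... | S , refl | F , eqF = bound (length F) (trans (sym (length-reverse FB)) (cong length eqF))
        (closeRing pFA path-w (subst (Path G b q) eqF (path-reverse pFB)) path-q
          (λ { refl → A∩B (∈-++⁺ˡ p∈A) q∈R }) uFA uniq-w uF uniq-q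
          (λ x∈A x∈S → case w-A (there x∈S) (FA⊆ x∈A) of λ { refl → Uniq-head uniq-w x∈S })
          (λ x∈A x∈F → A∩B (FA⊆ x∈A) (F⊆ x∈F))
          (λ x∈A x∈T → q-A x∈T (FA⊆ x∈A))
          (λ x∈S x∈F → w-R (there x∈S) (F⊆ x∈F))
          (λ x∈S x∈T → disjoint (there x∈S) x∈T)
          (λ x∈F x∈T → q-R x∈T (F⊆ x∈F)))
        where
        uF : Uniq (b ∷ F)
        uF = subst Uniq eqF (Uniq-reverse uFB)
        F⊆ : ∀ {x} → x ∈ F → x ∈ B
        F⊆ {x} x∈F with FB⊆ (reverse⁻ (subst (x ∈_) (sym eqF) (there x∈F)))
        ... | inj₁ x∈B = x∈B
        ... | inj₂ refl = ⊥-elim (Uniq-head uF x∈F)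
      finish (inj₂ (refl , refl)) with path-head path-q | path-head pFB
      ... | S , refl | F , refl = bound (length F) refl
        (closeRing pFA path-q pFB path-w (λ { refl → b∉A p∈A }) uFA uniq-q uFB uniq-w
          (λ x∈A x∈S → case q-A (there x∈S) (FA⊆ x∈A) of λ { refl → Uniq-head uniq-q x∈S })
          (λ x∈A x∈F → [ A∩B (FA⊆ x∈A)
                       , (λ { refl → case w-A (last∈ path-w) (FA⊆ x∈A) of λ { refl → b∉A p∈A } }) ]′ (FB⊆ (there x∈F)))
          (λ x∈A x∈T → w-A x∈T (FA⊆ x∈A))
          (λ x∈S x∈F → [ (λ x∈B → case q-R (there x∈S) x∈B of λ { refl → Uniq-head uFB x∈F })
                       , (λ { refl → disjoint (last∈ path-w) (there x∈S) }) ]′ (FB⊆ (there x∈F)))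
          (λ x∈S x∈T → disjoint x∈T (there x∈S))
          (λ x∈F x∈T → [ (λ x∈B → ⊥-elim (w-R x∈T x∈B)) , id ]′ (FB⊆ (there x∈F))))

    has-neighbour : ∀ {x y L} → Path G x y L → x ≢ y → ∃[ w ] (w ∈ L × Edge G x w)
    has-neighbour stop    x≢y = ⊥-elim (x≢y refl)
    has-neighbour (e ◂ p) x≢y = _ , there (first∈ p) , e

    -- Let `a` be the last neighbour of `u` and `b` the first neighbour of `v`. Separation puts `b`
    -- at or beyond `a`, so a linkage carried from `a` to `b` joins the two end segments that
    -- contain all neighbours. The strict inequality is what later forces a crossing in the case of
    -- equality.
    separated-bound : NoCutvertex G → ∀ {u v P} → Path G u v P → Uniq P → u ≢ v →
                      (∀ A a M → P ≡ A ++ a ∷ M → Edge G u a → All (λ w → ¬ Edge G v w) A) →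
                      deg u P + deg v P < c
    separated-bound tc {u} {v} {P} p un u≢v sep with last-split (edge? u) P
    ... | inj₁ none = case has-neighbour p u≢v of λ { (w , w∈ , e) → ⊥-elim (All.lookup none w∈ e) }
    ... | inj₂ (A , a , M , refl , noM , ea) with first-split (edge? v) (a ∷ M)
    ...   | inj₁ none = case has-neighbour (path-reverse p) (≢-sym u≢v) of λ
            { (w , w∈ , e) → ⊥-elim (All.lookup (All-++⁺ (sep A a M refl ea) none) (reverse⁻ w∈) e) }
    ...   | inj₂ (N , b , B , eq , noN , eb) = go N eq noN
      where
      noA : All (λ w → ¬ Edge G v w) A
      noA = sep A a M refl ea
      pA : Path G u a (A ++ [ a ])
      pA = proj₁ (path-split A p)
      u∈A : u ∈ A
      u∈A with ∈-++⁻ A (first∈ pA)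
      ... | inj₁ h           = h
      ... | inj₂ (here refl) = ⊥-elim (irrefl G ea refl)
      v∈B : ∀ {B} → Path G b v (b ∷ B) → v ∈ B
      v∈B q with last∈ q
      ... | here refl = ⊥-elim (irrefl G eb refl)
      ... | there h   = h
      uAa : Uniq (A ++ [ a ])
      uAa = Uniq-++⁻ˡ (A ++ [ a ]) (subst Uniq (sym (++-assoc A [ a ] M)) un)
      degu : deg u (A ++ a ∷ M) ≡ deg u (A ++ [ a ])
      degu = begin
        deg u (A ++ a ∷ M)             ≡⟨ cong (deg u) (++-assoc A [ a ] M) ⟨
        deg u ((A ++ [ a ]) ++ M)      ≡⟨ Σₗ-++ _ (A ++ [ a ]) M ⟩
        deg u (A ++ [ a ]) + deg u M   ≡⟨ cong (deg u (A ++ [ a ]) +_) (deg-none u noM) ⟩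
        deg u (A ++ [ a ]) + 0         ≡⟨ +-identityʳ (deg u (A ++ [ a ])) ⟩
        deg u (A ++ [ a ])             ∎
        where open ≡-Reasoning
      degv : deg v (A ++ a ∷ M) ≡ deg v (b ∷ B)
      degv = begin
        deg v (A ++ a ∷ M)             ≡⟨ Σₗ-++ _ A (a ∷ M) ⟩
        deg v A + deg v (a ∷ M)        ≡⟨ cong₂ _+_ (deg-none v noA) (cong (deg v) eq) ⟩
        deg v (N ++ b ∷ B)             ≡⟨ Σₗ-++ _ N (b ∷ B) ⟩
        deg v N + deg v (b ∷ B)        ≡⟨ cong (_+ deg v (b ∷ B)) (deg-none v noN) ⟩
        deg v (b ∷ B)                  ∎
        where open ≡-Reasoning
      conclude : b ∉ A → Path G b v (b ∷ B) → Uniq (b ∷ B) → (∀ {x} → x ∈ A ++ [ a ] → x ∈ B → ⊥) →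
                 Linkage A a b B → deg u (A ++ a ∷ M) + deg v (A ++ a ∷ M) < c
      conclude b∉A pB uB dis lk = subst₂ (λ k l → k + l < c) (sym degu) (sym degv)
        (closeLinkage A a b B pA uAa ea pB uB eb dis b∉A lk)
      go : ∀ N → a ∷ M ≡ N ++ b ∷ B → All (λ w → ¬ Edge G v w) N → deg u (A ++ a ∷ M) + deg v (A ++ a ∷ M) < c
      -- Here `b` is `a`, and the initial linkage is already in place.
      go [] refl _ = conclude (λ b∈A → Uniq-disjoint A un b∈A (here refl)) pB (Uniq-++⁻ʳ A un)
        (λ x∈ x∈B → Uniq-disjoint (A ++ [ a ]) (subst Uniq (sym (++-assoc A [ a ] B)) un) x∈ x∈B)
        (baseLinkage tc A a B u∈A (v∈B pB) un)
        where
        pB : Path G a v (a ∷ B)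
        pB = proj₂ (path-split A p)
      go (_ ∷ N′) refl _ = conclude (λ b∈A → Uniq-disjoint A un b∈A (there (∈-++⁺ʳ N′ (here refl)))) pB
        (Uniq-++⁻ʳ N′ (Uniq-tail (Uniq-++⁻ʳ A un)))
        (λ x∈ x∈B → dis x∈ (∈-++⁺ʳ N′ (there x∈B)))
        (advanceTo tc u∈A N′ (v∈B pB) (proj₂ (path-split A p)) (Uniq-tail (Uniq-++⁻ʳ A un)) dis
          (baseLinkage tc A a (N′ ++ b ∷ B) u∈A (∈-++⁺ʳ N′ (there (v∈B pB))) un))
        where
        pB : Path G b v (b ∷ B)
        pB = proj₂ (path-split (a ∷ N′) (proj₂ (path-split A p)))
        dis : ∀ {x} → x ∈ A ++ [ a ] → x ∈ N′ ++ b ∷ B → ⊥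
        dis = Uniq-disjoint (A ++ [ a ]) (subst Uniq (sym (++-assoc A [ a ] (N′ ++ b ∷ B))) un)

    -- The cycle runs from `u` to `a`, jumps to `v`, runs back to `b` and returns to `u`; it omits
    -- exactly `M`.
    cross-cycle : ∀ {u v P} X a M b Y → P ≡ X ++ a ∷ M ++ b ∷ Y → Path G u v P → Uniq P → Edge G v a → Edge G u b →
                  length X + suc (suc (length Y)) ≤ c
    cross-cycle {u} {v} X a M b Y refl p un ea eb = subst (_≤ c) len
      (nl (path-++ (proj₁ halves) (sym-edge G ea) (path-reverse (proj₂ (path-split (a ∷ M) (proj₂ halves)))))
          (Uniq-≤ cnt un) (sym-edge G eb))
      where
      halves : Path G u a (X ++ [ a ]) × Path G a v (a ∷ M ++ b ∷ Y)
      halves = path-split X p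
      cnt : ∀ x → count x ((X ++ [ a ]) ++ reverse (b ∷ Y)) ≤ count x (X ++ a ∷ M ++ b ∷ Y)
      cnt x rewrite Σₗ-++ (δ x) (X ++ [ a ]) (reverse (b ∷ Y)) | Σₗ-++ (δ x) X [ a ] | Σₗ-reverse (δ x) (b ∷ Y)
                  | Σₗ-++ (δ x) X (a ∷ M ++ b ∷ Y) | Σₗ-++ (δ x) M (b ∷ Y) =
        linear (count x M) z≤n (lem (count x X) (δ x a) (count x M) (δ x b) (count x Y))
        where
        lem : ∀ X a M b Y → X + (a + 0) + (b + Y) + 0 + M ≡ X + (a + (M + (b + Y))) + 0
        lem = solve-∀
      len : length ((X ++ [ a ]) ++ reverse (b ∷ Y)) ≡ length X + suc (suc (length Y))
      len rewrite length-++ (X ++ [ a ]) {reverse (b ∷ Y)} | length-++ X {[ a ]} | length-reverse (b ∷ Y) =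
        lem (length X) (length Y)
        where
        lem : ∀ x y → x + 1 + suc y ≡ x + suc (suc y)
        lem = solve-∀

    no-crossing : ∀ {u v P} A x y B → P ≡ A ++ x ∷ y ∷ B → Path G u v P → Uniq P → c < length P →
                  Edge G v x → Edge G u y → ⊥
    no-crossing A x y B refl p un lt ex ey =
      <⇒≱ (subst (c <_) (length-++ A) lt) (cross-cycle A x [] y B refl p un ex ey)

-- Relations between consecutive vertices

module _ {A : Set} {R : A → A → Set} where

  linked-join : ∀ X {a W} → Linked R (X ++ [ a ]) → Linked R (a ∷ W) → Linked R (X ++ a ∷ W)
  linked-join []          _       k = k
  linked-join (x ∷ [])    (r ∷ _) k = r ∷ k
  linked-join (x ∷ y ∷ X) (r ∷ h) k = r ∷ linked-join (y ∷ X) h k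

  linked-splitˡ : ∀ X {a W} → Linked R (X ++ a ∷ W) → Linked R (X ++ [ a ])
  linked-splitˡ []          h       = [-]
  linked-splitˡ (x ∷ [])    (r ∷ _) = r ∷ [-]
  linked-splitˡ (x ∷ y ∷ X) (r ∷ h) = r ∷ linked-splitˡ (y ∷ X) h

  linked-splitʳ : ∀ X {W} → Linked R (X ++ W) → Linked R W
  linked-splitʳ []      h           = h
  linked-splitʳ (x ∷ X) h           = linked-splitʳ X (Linked.tail h)

  linked-prefix : ∀ X {W} → Linked R (X ++ W) → Linked R X
  linked-prefix []          _       = []
  linked-prefix (x ∷ [])    _       = [-]
  linked-prefix (x ∷ y ∷ X) (r ∷ h) = r ∷ linked-prefix (y ∷ X) h

  linked-at : ∀ X {x y W} → Linked R (X ++ x ∷ y ∷ W) → R x y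
  linked-at X h with linked-splitʳ X h
  ... | r ∷ _ = r

  splits⇒linked : ∀ L → (∀ X x y W → L ≡ X ++ x ∷ y ∷ W → R x y) → Linked R L
  splits⇒linked []          h = []
  splits⇒linked (x ∷ [])    h = [-]
  splits⇒linked (x ∷ y ∷ L) h = h [] x y L refl ∷ splits⇒linked (y ∷ L) (λ X a b W eq → h (x ∷ X) a b W (cong (x ∷_) eq))

-- The degree sum of the ends of a path, and its equality case

module _ {n : ℕ} (G : Graph n) {c : ℕ} (nl : NoLong G c) where

  private V = Fin n

  module _ (u v : V) where

    -- A neighbour of `u` is charged to the pair in which it comes second, a neighbour of `v` to the
    -- pair in which it comes first. On a path from `u` to `v` the two terms left over at the ends
    -- vanish, so `pairSum` is the degree sum.
    pair : V → V → ℕ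
    pair x y = ind (adj G u y) + ind (adj G v x)

    pairSum : List V → ℕ
    pairSum []          = 0
    pairSum (x ∷ [])    = 0
    pairSum (x ∷ y ∷ L) = pair x y + pairSum (y ∷ L)

    pairSum-total : ∀ {x y L} → Path G x y L →
                    pairSum L + ind (adj G u x) + ind (adj G v y) ≡ deg G u L + deg G v L
    pairSum-total {x} stop = lem (ind (adj G u x)) (ind (adj G v x))
      where
      lem : ∀ a b → 0 + a + b ≡ a + 0 + (b + 0)
      lem = solve-∀
    pairSum-total {x} {z} (_◂_ {y = y} e p) with path-head p | pairSum-total p
    ... | M , refl | ih = trans (lem₁ (ind (adj G u x)) (ind (adj G u y)) (ind (adj G v x)) (pairSum (y ∷ M)) (ind (adj G v z)))
      (trans (cong (λ k → ind (adj G u x) + ind (adj G v x) + k) ih)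
        (lem₂ (ind (adj G u x)) (ind (adj G v x)) (deg G u (y ∷ M)) (deg G v (y ∷ M))))
      where
      lem₁ : ∀ ux uy vx s vz → uy + vx + s + ux + vz ≡ ux + vx + (s + uy + vz)
      lem₁ = solve-∀
      lem₂ : ∀ a b c d → a + b + (c + d) ≡ a + c + (b + d)
      lem₂ = solve-∀

    pairSum-split : ∀ X a W → pairSum (X ++ a ∷ W) ≡ pairSum (X ++ [ a ]) + pairSum (a ∷ W)
    pairSum-split []          a W = refl
    pairSum-split (x ∷ [])    a W = cong (_+ pairSum (a ∷ W)) (sym (+-identityʳ (pair x a)))
    pairSum-split (x ∷ y ∷ X) a W = trans (cong (pair x y +_) (pairSum-split (y ∷ X) a W)) (sym (+-assoc (pair x y) _ _))

    AtMostOne Covered : V → V → Set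
    AtMostOne x y = pair x y ≤ 1
    Covered x y = Edge G v x ⊎ Edge G u y

    pairSum≤ : ∀ {x L} → Linked AtMostOne (x ∷ L) → pairSum (x ∷ L) ≤ length L
    pairSum≤ [-]     = z≤n
    pairSum≤ (r ∷ h) = +-mono-≤ r (pairSum≤ h)

    pair-covered : ∀ {x y} → 1 ≤ pair x y → Covered x y
    pair-covered {x} {y} h with adj G v x ≟ᵇ true | adj G u y ≟ᵇ true
    ... | yes e | _     = inj₁ e
    ... | no _  | yes e = inj₂ e
    ... | no d  | no e  = ⊥-elim (1+n≰n (≤-trans h (≤-reflexive (cong₂ _+_ (ind-false G e) (ind-false G d)))))

    pairSum-tight : ∀ {x L} → Linked AtMostOne (x ∷ L) → length L ≤ pairSum (x ∷ L) → Linked Covered (x ∷ L)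
    pairSum-tight [-] h = [-]
    pairSum-tight {x} {y ∷ L} (r ∷ k) h =
      pair-covered (+-cancelʳ-≤ (length L) _ _ (≤-trans h (+-monoʳ-≤ (pair x y) (pairSum≤ k))))
      ∷ pairSum-tight k (+-cancelˡ-≤ 1 _ _ (≤-trans h (+-monoˡ-≤ _ r)))

    pairSum-gap : ∀ {m M b} → All (λ w → ¬ Edge G u w × ¬ Edge G v w) (m ∷ M) → pairSum (m ∷ M ++ [ b ]) ≤ 1
    pairSum-gap {m} {[]} {b} ((_ , ¬vm) ∷ []) rewrite ind-false G ¬vm =
      ≤-trans (≤-reflexive (trans (+-identityʳ _) (+-identityʳ _))) (ind≤1 G (adj G u b))
    pairSum-gap {m} {m′ ∷ M} ((_ , ¬vm) ∷ (¬um′ , q) ∷ h) rewrite ind-false G ¬vm | ind-false G ¬um′ = pairSum-gap ((¬um′ , q) ∷ h)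

  -- `gap` makes the crossing a closest one. `cover` is the equality case: every consecutive pair of
  -- `P` contributes to the degree sum, apart from pairs inside `M`.
  record Crossing (u v : V) (P : List V) : Set where
    field
      X M Y : List V
      a b   : V
      shape : P ≡ X ++ a ∷ M ++ b ∷ Y
      va    : Edge G v a
      ub    : Edge G u b
      gap   : All (λ w → ¬ Edge G u w × ¬ Edge G v w) M
      short : length X + suc (suc (length Y)) ≤ c
      sum≤  : deg G u P + deg G v P ≤ c
      cover : c ≤ deg G u P + deg G v P → Linked (λ x y → Edge G v x ⊎ Edge G u y ⊎ (x ∈ M × y ∈ M)) P

  -- If both edges of a consecutive pair were present, all of `P` would close into a cycle, so each
  -- pair contributes at most 1. At a closest crossing the pairs up to `a` contribute at most
  -- `length X`, those from `a` to `b` at most 2 and the others at most `length Y`. The total is the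
  -- length of the cycle that omits `M`, hence at most `c`.
  kopylov : 1 ≤ c → NoCutvertex G → ∀ {u v P} → Path G u v P → Uniq P → c < length P →
            deg G u P + deg G v P < c ⊎ Crossing u v P
  kopylov 1≤c tc {u} {v} {P} p un lt = go (scan (edge? G u) (edge? G v) P) p un lt
    where
    u≢v : u ≢ v
    u≢v refl with closed-path p un
    ... | refl = <⇒≱ lt 1≤c
    go : ∀ {P} → Scan (Edge G u) (Edge G v) P → Path G u v P → Uniq P → c < length P →
         deg G u P + deg G v P < c ⊎ Crossing u v P
    go (separated sep) p un lt = inj₁ (separated-bound G nl tc p un u≢v sep)
    go (crossing X a [] b Y va ub gap) p un lt = ⊥-elim (no-crossing G nl X a b Y refl p un lt va ub)
    go (crossing X a (m ∷ M) b Y va ub gap) p un lt = inj₂ record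
      { shape = refl ; va = va ; ub = ub ; gap = gap ; short = short ; sum≤ = sum≤ ; cover = cover }
      where
      P′ : List V
      P′ = X ++ a ∷ m ∷ M ++ b ∷ Y
      short : length X + suc (suc (length Y)) ≤ c
      short = cross-cycle G nl X a (m ∷ M) b Y refl p un va ub
      amo : ∀ x y → ¬ (Edge G v x × Edge G u y) → AtMostOne u v x y
      amo x y h with adj G v x | adj G u y
      ... | true  | true  = ⊥-elim (h (refl , refl))
      ... | true  | false = ≤-refl
      ... | false | true  = ≤-refl
      ... | false | false = z≤n
      linked : Linked (AtMostOne u v) P′
      linked = splits⇒linked P′ λ A x y B eq → amo x y λ { (ex , ey) → no-crossing G nl A x y B eq p un lt ex ey }
      linkedX : Linked (AtMostOne u v) (X ++ [ a ])
      linkedX = linked-splitˡ X linked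
      linkedY : Linked (AtMostOne u v) (b ∷ Y)
      linkedY = linked-splitʳ (m ∷ M) (linked-splitʳ (a ∷ []) (linked-splitʳ X linked))
      total : deg G u P′ + deg G v P′ ≡ pairSum u v (X ++ [ a ]) + (pairSum u v (a ∷ m ∷ M ++ [ b ]) + pairSum u v (b ∷ Y))
      total = begin
        deg G u P′ + deg G v P′                                  ≡⟨ pairSum-total u v p ⟨
        pairSum u v P′ + ind (adj G u u) + ind (adj G v v)       ≡⟨ cong₂ (λ k l → pairSum u v P′ + ind k + ind l) (adj-irr G u) (adj-irr G v) ⟩
        pairSum u v P′ + 0 + 0                                   ≡⟨ trans (+-identityʳ _) (+-identityʳ _) ⟩
        pairSum u v P′                                           ≡⟨ pairSum-split u v X a _ ⟩
        pairSum u v (X ++ [ a ]) + pairSum u v (a ∷ m ∷ M ++ b ∷ Y)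
                                                                 ≡⟨ cong (pairSum u v (X ++ [ a ]) +_) (pairSum-split u v (a ∷ m ∷ M) b Y) ⟩
        pairSum u v (X ++ [ a ]) + (pairSum u v (a ∷ m ∷ M ++ [ b ]) + pairSum u v (b ∷ Y)) ∎
        where open ≡-Reasoning
      lenX : ∀ L {x} → length (L ++ [ x ]) ≡ suc (length L)
      lenX L = trans (length-++ L) (+-comm (length L) 1)
      X≤ : pairSum u v (X ++ [ a ]) ≤ length X
      X≤ = bound X linkedX
        where
        bound : ∀ L → Linked (AtMostOne u v) (L ++ [ a ]) → pairSum u v (L ++ [ a ]) ≤ length L
        bound []      h = z≤n
        bound (x ∷ L) h = ≤-trans (pairSum≤ u v h) (≤-reflexive (lenX L))
      M≤ : pairSum u v (a ∷ m ∷ M ++ [ b ]) ≤ 2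
      M≤ = +-mono-≤ (≤-trans (+-monoˡ-≤ _ (≤-reflexive (ind-false G (proj₁ (All.head gap))))) (ind≤1 G (adj G v a))) (pairSum-gap u v gap)
      Y≤ : pairSum u v (b ∷ Y) ≤ length Y
      Y≤ = pairSum≤ u v linkedY
      sum≤ : deg G u P′ + deg G v P′ ≤ c
      sum≤ rewrite total = linear 0 (+-mono-≤ (+-mono-≤ X≤ M≤) (+-mono-≤ Y≤ short))
        (lem (pairSum u v (X ++ [ a ])) (pairSum u v (a ∷ m ∷ M ++ [ b ])) (pairSum u v (b ∷ Y)) (length X) (length Y) c)
        where
        lem : ∀ p q r x y c → p + (q + r) + (x + 2 + (y + c)) + 0 ≡ c + (p + q + (r + (x + suc (suc y))))
        lem = solve-∀
      module _ (tight : c ≤ deg G u P′ + deg G v P′) where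
        tight′ : c ≤ pairSum u v (X ++ [ a ]) + (pairSum u v (a ∷ m ∷ M ++ [ b ]) + pairSum u v (b ∷ Y))
        tight′ = subst (c ≤_) total tight
        X≥ : length X ≤ pairSum u v (X ++ [ a ])
        X≥ = linear 0 (+-mono-≤ (+-mono-≤ M≤ Y≤) (+-mono-≤ short tight′))
          (lem (pairSum u v (X ++ [ a ])) (pairSum u v (a ∷ m ∷ M ++ [ b ])) (pairSum u v (b ∷ Y)) (length X) (length Y) c)
          where
          lem : ∀ p q r x y c → x + (2 + y + (c + (p + (q + r)))) + 0 ≡ p + (q + r + (x + suc (suc y) + c))
          lem = solve-∀
        Y≥ : length Y ≤ pairSum u v (b ∷ Y)
        Y≥ = linear 0 (+-mono-≤ (+-mono-≤ M≤ X≤) (+-mono-≤ short tight′))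
          (lem (pairSum u v (X ++ [ a ])) (pairSum u v (a ∷ m ∷ M ++ [ b ])) (pairSum u v (b ∷ Y)) (length X) (length Y) c)
          where
          lem : ∀ p q r x y c → y + (2 + x + (c + (p + (q + r)))) + 0 ≡ r + (q + p + (x + suc (suc y) + c))
          lem = solve-∀
        R : V → V → Set
        R x y = Edge G v x ⊎ Edge G u y ⊎ (x ∈ m ∷ M × y ∈ m ∷ M)
        weaken : ∀ {x y} → Covered u v x y → R x y
        weaken = map⊎ id inj₁
        coverX : Linked R (X ++ [ a ])
        coverX = part X linkedX X≥
          where
          part : ∀ L → Linked (AtMostOne u v) (L ++ [ a ]) → length L ≤ pairSum u v (L ++ [ a ]) → Linked R (L ++ [ a ])
          part []      h k = [-]
          part (x ∷ L) h k = Linked.map weaken (pairSum-tight u v h (≤-trans (≤-reflexive (lenX L)) k))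
        coverM : ∀ {w} N → (∀ {x} → x ∈ w ∷ N → x ∈ m ∷ M) → Linked R (w ∷ N ++ [ b ])
        coverM []      N⊆ = inj₂ (inj₁ ub) ∷ [-]
        coverM (z ∷ N) N⊆ = inj₂ (inj₂ (N⊆ (here refl) , N⊆ (there (here refl)))) ∷ coverM N (N⊆ ∘ there)
        cover : Linked R P′
        cover = linked-join X coverX (inj₁ va ∷ linked-join (m ∷ M) (coverM M id)
          (Linked.map weaken (pairSum-tight u v linkedY Y≥)))

-- Counting edges along an ordering of the vertices


choose-suc : ∀ m → (suc m) choose 2 ≡ m + m choose 2
choose-suc m = trans (sym (nCk+nC[k+1]≡[n+1]C[k+1] m 1)) (cong (_+ m choose 2) (nC1≡n m))

module _ {n : ℕ} (G : Graph n) where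

  private V = Fin n

  edgesIn : List V → ℕ
  edgesIn []      = 0
  edgesIn (x ∷ L) = deg G x L + edgesIn L

  private
    up : V → V → ℕ
    up u v = ind (adj G u v ∧ (toℕ u <ᵇ toℕ v))

    up-irrefl : ∀ u → up u u ≡ 0
    up-irrefl u rewrite adj-irr G u = refl

    up-antisym : ∀ u v → up u v + up v u ≤ ind (adj G u v)
    up-antisym u v rewrite adj-sym G v u with adj G u v
    ... | false = z≤n
    ... | true with toℕ u <ᵇ toℕ v in lt | toℕ v <ᵇ toℕ u in gt
    ...   | true  | true  = ⊥-elim (<-asym (<ᵇ⇒< (toℕ u) (toℕ v) (subst T (sym lt) tt)) (<ᵇ⇒< (toℕ v) (toℕ u) (subst T (sym gt) tt)))
    ...   | true  | false = ≤-refl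
    ...   | false | true  = ≤-refl
    ...   | false | false = z≤n

    up≤edgesIn : ∀ L → Σₗ (λ u → Σₗ (up u) L) L ≤ edgesIn L
    up≤edgesIn []      = z≤n
    up≤edgesIn (x ∷ L) = begin
      up x x + Σₗ (up x) L + Σₗ (λ u → up u x + Σₗ (up u) L) L
        ≡⟨ cong₂ (λ k l → k + Σₗ (up x) L + l) (up-irrefl x) (Σₗ-+ (λ u → up u x) (λ u → Σₗ (up u) L) L) ⟩
      Σₗ (up x) L + (Σₗ (λ u → up u x) L + Σₗ (λ u → Σₗ (up u) L) L)
        ≡⟨ +-assoc (Σₗ (up x) L) _ _ ⟨
      Σₗ (up x) L + Σₗ (λ u → up u x) L + Σₗ (λ u → Σₗ (up u) L) L
        ≡⟨ cong (_+ Σₗ (λ u → Σₗ (up u) L) L) (Σₗ-+ (up x) (λ u → up u x) L) ⟨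
      Σₗ (λ y → up x y + up y x) L + Σₗ (λ u → Σₗ (up u) L) L
        ≤⟨ +-mono-≤ (Σₗ-mono L (λ {y} _ → up-antisym x y)) (up≤edgesIn L) ⟩
      deg G x L + edgesIn L ∎
      where open ≤-Reasoning

  edges≤edgesIn : edges G ≤ edgesIn (allFin n)
  edges≤edgesIn = subst (_≤ edgesIn (allFin n))
    (trans (Σₗ≡sum (λ u → Σₗ (up u) (allFin n)) (allFin n))
           (cong sum (map-cong (λ u → Σₗ≡sum (up u) (allFin n)) (allFin n))))
    (up≤edgesIn (allFin n))

  degree≡deg : ∀ v → degree G v ≡ deg G v (allFin n)
  degree≡deg v = sym (Σₗ≡sum _ (allFin n))

  deg-insert-self : ∀ A x B → deg G x (A ++ x ∷ B) ≡ deg G x (A ++ B)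
  deg-insert-self A x B = trans (Σₗ-insert _ A x B) (cong (λ b → ind b + deg G x (A ++ B)) (adj-irr G x))

  deg-∈ : ∀ {v L} → v ∈ L → suc (deg G v L) ≤ length L
  deg-∈ {v} v∈ with ∈-∃++ v∈
  ... | A , B , refl = begin
    suc (deg G v (A ++ v ∷ B))   ≡⟨ cong suc (deg-insert-self A v B) ⟩
    suc (deg G v (A ++ B))       ≤⟨ s≤s (deg≤length G v (A ++ B)) ⟩
    suc (length (A ++ B))        ≡⟨ cong suc (length-++ A) ⟩
    suc (length A + length B)    ≡⟨ trans (length-++ A) (+-suc (length A) (length B)) ⟨
    length (A ++ v ∷ B)          ∎
    where open ≤-Reasoning

  deg-all : ∀ {w} L → (∀ {x} → x ∈ L → Edge G w x) → deg G w L ≡ length L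
  deg-all L h = trans (Σₗ-cong L (λ x∈ → ind-true G (h x∈))) (Σₗ-one L)

  -- By symmetry of adjacency any vertex may be counted first, so the value does not depend on the
  -- order of the list, as deletion arguments require.
  edgesIn-insert : ∀ A x B → edgesIn (A ++ x ∷ B) ≡ deg G x (A ++ B) + edgesIn (A ++ B)
  edgesIn-insert []      x B = refl
  edgesIn-insert (a ∷ A) x B = begin
    deg G a (A ++ x ∷ B) + edgesIn (A ++ x ∷ B)
      ≡⟨ cong₂ _+_ (Σₗ-insert _ A x B) (edgesIn-insert A x B) ⟩
    ind (adj G a x) + deg G a (A ++ B) + (deg G x (A ++ B) + edgesIn (A ++ B))
      ≡⟨ cong (λ b → ind b + deg G a (A ++ B) + (deg G x (A ++ B) + edgesIn (A ++ B))) (adj-sym G a x) ⟩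
    ind (adj G x a) + deg G a (A ++ B) + (deg G x (A ++ B) + edgesIn (A ++ B))
      ≡⟨ lem (ind (adj G x a)) (deg G a (A ++ B)) (deg G x (A ++ B)) (edgesIn (A ++ B)) ⟩
    ind (adj G x a) + deg G x (A ++ B) + (deg G a (A ++ B) + edgesIn (A ++ B)) ∎
    where
    open ≡-Reasoning
    lem : ∀ p q r s → p + q + (r + s) ≡ p + r + (q + s)
    lem = solve-∀

  edgesIn-⊆ : ∀ L M → Uniq L → (∀ {x} → x ∈ L → x ∈ M) → edgesIn L ≤ edgesIn M
  edgesIn-⊆ []      M u h = z≤n
  edgesIn-⊆ (x ∷ L) M u h with ∈-∃++ (h (here refl))
  ... | A , B , refl = subst (deg G x L + edgesIn L ≤_) (sym (edgesIn-insert A x B))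
    (+-mono-≤ (Σₗ-⊆ _ L (A ++ B) (Uniq-tail u) (λ z∈ _ → L⊆ z∈)) (edgesIn-⊆ L (A ++ B) (Uniq-tail u) L⊆))
    where
    L⊆ : ∀ {z} → z ∈ L → z ∈ A ++ B
    L⊆ z∈ = ∈-remove A (h (there z∈)) λ { refl → Uniq-head u z∈ }

  edgesIn≤choose : ∀ L → edgesIn L ≤ (length L) choose 2
  edgesIn≤choose []      = z≤n
  edgesIn≤choose (x ∷ L) = subst (deg G x L + edgesIn L ≤_) (sym (choose-suc (length L)))
    (+-mono-≤ (deg≤length G x L) (edgesIn≤choose L))

  -- Vertices of degree at most `α` are deleted until `j` are left: each of the `m` deletions costs
  -- at most `α` edges. If the process stops earlier, what remains is the core. For `α = t`,
  -- `j = c - t + 1` and `m = n - j` the bound is `f n t c`.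
  disintegrate : ∀ α j m L → Uniq L → length L ≡ m + j →
                 edgesIn L ≤ j choose 2 + α * m ⊎ ∃[ Y ] (Uniq Y × j < length Y × (∀ {y} → y ∈ Y → α < deg G y Y))
  disintegrate α j zero L u eq = inj₁ (subst (edgesIn L ≤_) (trans (cong (_choose 2) eq) (sym (trans (cong (j choose 2 +_) (*-zeroʳ α)) (+-identityʳ _)))) (edgesIn≤choose L))
  disintegrate α j (suc m) L u eq with first-split (λ x → deg G x L ≤? α) L
  ... | inj₁ none = inj₂ (L , u , subst (j <_) (sym eq) (s≤s (m≤n+m j m)) , λ y∈ → ≰⇒> (All.lookup none y∈))
  ... | inj₂ (A , x , B , refl , _ , le) with disintegrate α j m (A ++ B) (Uniq-remove A u)
                                              (suc-injective (trans (sym (length-insert A)) eq))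
  ...   | inj₂ core = inj₂ core
  ...   | inj₁ le′ = inj₁ (begin
    edgesIn (A ++ x ∷ B)                         ≡⟨ edgesIn-insert A x B ⟩
    deg G x (A ++ B) + edgesIn (A ++ B)          ≤⟨ +-mono-≤ (subst (_≤ α) (deg-insert-self A x B) le) le′ ⟩
    α + (j choose 2 + α * m)                          ≡⟨ lem α (j choose 2) m ⟩
    j choose 2 + α * suc m                            ∎)
    where
    open ≤-Reasoning
    lem : ∀ α b m → α + (b + α * m) ≡ b + α * suc m
    lem = solve-∀

  peel : ∀ s K m D → length D ≡ m → Uniq D → (∀ {x} → x ∈ D → x ∉ K) →
         (∀ D → Uniq D → (∀ {x} → x ∈ D → x ∉ K) → ∀ {d} → d ∈ D → ∃[ v ] (v ∈ D × deg G v (D ++ K) ≤ s)) →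
         edgesIn (D ++ K) ≤ s * m + edgesIn K
  peel s K zero    []      eq u dis h = m≤n+m _ _
  peel s K (suc m) (d ∷ D) eq u dis h with h (d ∷ D) u dis (here refl)
  ... | v , v∈ , le with ∈-∃++ v∈
  ...   | A , B , eq′ = begin
    edgesIn ((d ∷ D) ++ K)                           ≡⟨ cong edgesIn whole ⟩
    edgesIn (A ++ v ∷ B ++ K)                        ≡⟨ edgesIn-insert A v (B ++ K) ⟩
    deg G v (A ++ B ++ K) + edgesIn (A ++ B ++ K)    ≡⟨ cong₂ _+_ (deg-insert-self A v (B ++ K)) (cong edgesIn (++-assoc A B K)) ⟨
    deg G v (A ++ v ∷ B ++ K) + edgesIn ((A ++ B) ++ K)
      ≤⟨ +-mono-≤ (subst (λ L → deg G v L ≤ s) whole le)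
                  (peel s K m (A ++ B) len (Uniq-remove A (subst Uniq eq′ u)) (λ x∈ → dis (subst (_ ∈_) (sym eq′) (∈-weaken A x∈))) h) ⟩
    s + (s * m + edgesIn K)                          ≡⟨ lem s m (edgesIn K) ⟩
    s * suc m + edgesIn K                            ∎
    where
    open ≤-Reasoning
    whole : (d ∷ D) ++ K ≡ A ++ v ∷ B ++ K
    whole = trans (cong (_++ K) eq′) (++-assoc A (v ∷ B) K)
    len : length (A ++ B) ≡ m
    len = suc-injective (trans (sym (trans (cong length eq′) (trans (length-++ A) (trans (+-suc (length A) (length B)) (cong suc (sym (length-++ A))))))) eq)
    lem : ∀ s m e → s + (s * m + e) ≡ s * suc m + e
    lem = solve-∀

deg-mono : ∀ {n} {G G′ : Graph n} → G ⊑ G′ → ∀ v L → deg G v L ≤ deg G′ v L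
deg-mono {G = G} {G′} h v L = Σₗ-mono L (λ {x} _ → pointwise x)
  where
  pointwise : ∀ x → ind (adj G v x) ≤ ind (adj G′ v x)
  pointwise x with adj G v x in eq
  ... | false = z≤n
  ... | true  = ≤-reflexive (sym (ind-true G (h eq)))

edgesIn-mono : ∀ {n} {G G′ : Graph n} → G ⊑ G′ → ∀ L → edgesIn G L ≤ edgesIn G′ L
edgesIn-mono h []      = z≤n
edgesIn-mono {G = G} {G′} h (x ∷ L) = +-mono-≤ (deg-mono {G = G} {G′} h x L) (edgesIn-mono {G = G} {G′} h L)

-- Longest paths between two vertex sets, and cliques

module Saturated {n : ℕ} (G : Graph n) {c : ℕ} (2≤c : 2 ≤ c) (nl : NoLong G c) (tc : NoCutvertex G)
                 (settled : ∀ x y → Settled G c x y) where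

  private V = Fin n

  -- The comparison is with all paths from `A` to `B`, whatever their ends. So a neighbour of `u` in
  -- `A`, or of `v` in `B`, that is off the path would prolong it.
  record Extremal (A B : List V) (u v : V) (P : List V) : Set where
    field
      u∈A     : u ∈ A
      v∈B     : v ∈ B
      path    : Path G u v P
      unique  : Uniq P
      long    : c < length P
      longest : ∀ {x y L} → x ∈ A → y ∈ B → Path G x y L → Uniq L → length L ≤ length P

    nonadjacent : ¬ Edge G u v
    nonadjacent e = <⇒≱ long (nl path unique (sym-edge G e))

    u-closed : ∀ {w} → w ∈ A → Edge G u w → w ∈ P
    u-closed {w} w∈A e with w ∈? P
    ... | yes w∈P = w∈P
    ... | no w∉P  = ⊥-elim (1+n≰n (longest w∈A v∈B (sym-edge G e ◂ path) (Uniq-∷ w∉P unique)))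

    v-closed : ∀ {w} → w ∈ B → Edge G v w → w ∈ P
    v-closed {w} w∈B e with w ∈? P
    ... | yes w∈P = w∈P
    ... | no w∉P  = ⊥-elim (1+n≰n (subst (_≤ length P) (trans (length-++ P) (+-comm (length P) 1))
      (longest u∈A w∈B (path-++ path e stop) (Uniq-++ P unique Uniq-[x] λ { x∈ (here refl) → w∉P x∈ }))))

    degree-sum : deg G u P + deg G v P ≤ c
    degree-sum with kopylov G nl (≤-trans (s≤s z≤n) 2≤c) tc path unique long
    ... | inj₁ lt = <⇒≤ lt
    ... | inj₂ cr = Crossing.sum≤ cr

  extremal : ∀ A B {x y} → x ∈ A → y ∈ B → x ≢ y → ¬ Edge G x y → ∃[ u ] ∃[ v ] ∃[ P ] Extremal A B u v P
  extremal A B {x} {y} x∈A y∈B x≢y ¬e with settled x y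
  ... | inj₁ eq = ⊥-elim (x≢y eq)
  ... | inj₂ (inj₁ e) = ⊥-elim (¬e e)
  ... | inj₂ (inj₂ (L , p , un , lt)) with ∃-longest Joins? n (λ { _ (_ , _ , _ , _ , _ , un) → length≤n un }) (L , x , y , x∈A , y∈B , p , un)
    where
    Joins : List V → Set
    Joins L = ∃[ x ] ∃[ y ] (x ∈ A × y ∈ B × Path G x y L × Uniq L)
    Joins? : ∀ L → Dec (Joins L)
    Joins? L = any? λ x → any? λ y → (x ∈? A) ×-dec (y ∈? B) ×-dec path? x y L ×-dec uniq? L
  ...   | P , (u , v , u∈A , v∈B , q , unP) , longest = u , v , P , record
    { u∈A = u∈A ; v∈B = v∈B ; path = q ; unique = unP
    ; long = ≤-trans lt (longest L (x , y , x∈A , y∈B , p , un))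
    ; longest = λ x∈ y∈ r un′ → longest _ (_ , _ , x∈ , y∈ , r , un′) }

  Clique : List V → Set
  Clique K = ∀ {x y} → x ∈ K → y ∈ K → x ≢ y → Edge G x y

  clique-path : ∀ x L → Uniq (x ∷ L) → Clique (x ∷ L) → ∃[ y ] (y ∈ x ∷ L × Path G x y (x ∷ L))
  clique-path x []      u cl = x , here refl , stop
  clique-path x (y ∷ L) u cl with clique-path y L (Uniq-tail u) (λ a b → cl (there a) (there b))
  ... | z , z∈ , p = z , there z∈ , cl (here refl) (there (here refl)) (λ { refl → Uniq-head u (here refl) }) ◂ p

  clique-length : ∀ K → Uniq K → Clique K → length K ≤ c
  clique-length []      u cl = z≤n
  clique-length (x ∷ L) u cl with clique-path x L u cl
  ... | y , y∈ , p with x ≟F y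
  ...   | no x≢y = nl p u (cl y∈ (here refl) (≢-sym x≢y))
  ...   | yes refl with closed-path p u
  ...     | refl = ≤-trans (s≤s z≤n) 2≤c

  -- The ends of a longest path between core vertices have at least `t + 1` neighbours in the core,
  -- all on the path. Their degree sum there is at least `2t + 2`, which exceeds `c`.
  core-clique : ∀ t Y → c ≤ suc (t + t) → Uniq Y → (∀ {y} → y ∈ Y → t < deg G y Y) → Clique Y
  core-clique t Y c≤ un core {x} {y} x∈ y∈ x≢y with edge? G x y
  ... | yes e = e
  ... | no ¬e with extremal Y Y x∈ y∈ x≢y ¬e
  ...   | u , v , P , ext = ⊥-elim (<⇒≱ (s≤s c≤) (≤-trans (≤-trans (≤-reflexive (cong suc (sym (+-suc t t))))
            (+-mono-≤ (≤-trans (core u∈A) (Σₗ-⊆ _ Y P un λ w∈ nz → u-closed w∈ (ind≢0 G nz)))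
                      (≤-trans (core v∈B) (Σₗ-⊆ _ Y P un λ w∈ nz → v-closed w∈ (ind≢0 G nz))))) degree-sum))
    where open Extremal ext

  Maximal : List V → Set
  Maximal K = ∀ {v} → v ∉ K → ∃[ u ] (u ∈ K × ¬ Edge G u v)

  maximal-clique : ∀ m Y → Uniq Y → Clique Y → n ≤ m + length Y →
                   ∃[ K ] (Uniq K × Clique K × Maximal K × length Y ≤ length K)
  maximal-clique m Y un cl le with first-split (λ v → ¬? (v ∈? Y) ×-dec All.all? (λ u → edge? G u v) Y) (allFin n)
  ... | inj₁ none = Y , un , cl , max , ≤-refl
    where
    max : Maximal Y
    max {v} v∉ with first-split (λ u → ¬? (edge? G u v)) Y
    ... | inj₂ (A , u , B , refl , _ , ¬e) = u , ∈-insert A , ¬e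
    ... | inj₁ all = ⊥-elim (All.lookup none (∈-allFin v) (v∉ , All.map (λ {u} → decidable-stable (edge? G u v)) all))
  maximal-clique zero    Y un cl le | inj₂ (_ , v , _ , _ , _ , v∉ , _) = ⊥-elim (1+n≰n (≤-trans (length≤n (Uniq-∷ v∉ un)) le))
  maximal-clique (suc m) Y un cl le | inj₂ (_ , v , _ , _ , _ , v∉ , all)
    with maximal-clique m (v ∷ Y) (Uniq-∷ v∉ un) cl′ (≤-trans le (≤-reflexive (sym (+-suc m (length Y)))))
    where
    cl′ : Clique (v ∷ Y)
    cl′ (here refl) (here refl) x≢y = ⊥-elim (x≢y refl)
    cl′ (here refl) (there y∈)  x≢y = sym-edge G (All.lookup all y∈)
    cl′ (there x∈)  (here refl) x≢y = All.lookup all x∈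
    cl′ (there x∈)  (there y∈)  x≢y = cl x∈ y∈ x≢y
  ... | K , unK , clK , maxK , len = K , unK , clK , maxK , ≤-trans (n≤1+n _) len

  clique-degree : ∀ {K} → Uniq K → Clique K → ∀ {u} → u ∈ K → length K ≤ suc (deg G u K)
  clique-degree un cl u∈ with ∈-∃++ u∈
  clique-degree un cl {u} u∈ | A , B , refl = begin
    length (A ++ u ∷ B)              ≡⟨ trans (length-++ A) (+-suc (length A) (length B)) ⟩
    suc (length A + length B)        ≡⟨ cong suc (length-++ A) ⟨
    suc (length (A ++ B))            ≡⟨ cong suc (Σₗ-one (A ++ B)) ⟨
    suc (Σₗ (λ _ → 1) (A ++ B))      ≤⟨ s≤s (Σₗ-mono (A ++ B) (λ z∈ → ≤-reflexive (sym (ind-true G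
                                          (cl (∈-insert A) (∈-weaken A z∈) λ { refl → Uniq-middle A un z∈ }))))) ⟩
    suc (deg G u (A ++ B))           ≡⟨ cong suc (deg-insert-self G A u B) ⟨
    suc (deg G u (A ++ u ∷ B))       ∎
    where open ≤-Reasoning

  module MaximalClique {K : List V} (unK : Uniq K) (clK : Clique K) (maxK : Maximal K) where

    module _ {B : List V} {u v P} (ext : Extremal K B u v P) where

      open Extremal ext

      K⊆P : ∀ {w} → w ∈ K → w ∈ P
      K⊆P {w} w∈ with w ≟F u
      ... | yes refl = first∈ path
      ... | no w≢u   = u-closed w∈ (clK u∈A w∈ (≢-sym w≢u))

      degree-u : length K ≤ suc (deg G u P)
      degree-u = ≤-trans (clique-degree unK clK u∈A) (s≤s (Σₗ-⊆ _ K P unK (λ w∈ _ → K⊆P w∈)))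

    -- On a longest path from `K` to `D` the end in `K` has at least `length K - 1` neighbours,
    -- which leaves at most `c + 1 - length K = s` for the other end `v`; and all neighbours of `v`
    -- in `D ++ K` lie on that path.
    low-degree : ∀ {s} → s + length K ≡ suc c → ∀ D → Uniq D → (∀ {x} → x ∈ D → x ∉ K) → ∀ {d} → d ∈ D →
                 ∃[ v ] (v ∈ D × deg G v (D ++ K) ≤ s)
    low-degree {s} eq D unD dis {d} d∈ with maxK (dis d∈)
    ... | w , w∈ , ¬e with extremal K D w∈ d∈ (λ { refl → dis d∈ w∈ }) ¬e
    ...   | u , v , P , ext = v , v∈B , linear 0
      (+-mono-≤ (+-mono-≤ (degree-u ext) (Σₗ-⊆ _ (D ++ K) P (Uniq-++ D unD unK dis) inP)) (+-mono-≤ degree-sum (≤-reflexive (sym eq))))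
      (lem (deg G v (D ++ K)) (deg G u P) (deg G v P) c s (length K))
      where
      open Extremal ext
      inP : ∀ {w} → w ∈ D ++ K → ind (adj G v w) ≢ 0 → w ∈ P
      inP w∈ nz = [ (λ w∈D → v-closed w∈D (ind≢0 G nz)) , K⊆P ext ]′ (∈-++⁻ D w∈)
      lem : ∀ e p q c s r → e + (suc p + q + (c + (s + r))) + 0 ≡ s + (r + e + (p + q + suc c))
      lem = solve-∀

-- The size of the clique


-- The difference of consecutive values, written without subtraction. Moving one vertex out of the
-- clique loses `c - j` edges, gives that vertex `j + 1` new ones, and adds one edge at each of the
-- other outside vertices. The difference increases with `j`, whence convexity.
f-step : ∀ n c j → j < c → c < n → f n j c + (n ∸ (c ∸ j + 1) + suc j) ≡ f n (suc j) c + (c ∸ j)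
f-step n c j j<c c<n = go (c ∸ suc j) (trans (cong (_∸ j) (sym (trans (+-suc j _) (m+[n∸m]≡n j<c)))) (m+n∸m≡n j _)) refl
  where
  shift : ∀ m → c ∸ j ≡ suc m → n ∸ (m + 1) ≡ suc (n ∸ (suc m + 1))
  shift m eq = trans (sym (m+[n∸m]≡n {1} {n ∸ (m + 1)} (m<n⇒0<n∸m (≤-trans (s≤s (subst (_≤ c) (trans eq (+-comm 1 m)) (m∸n≤m c j))) c<n))))
                     (cong suc (trans (∸-+-assoc n (m + 1) 1) (cong (n ∸_) (+-comm (m + 1) 1))))
  combine : ∀ {x y b N N′ d} m → x ≡ m + b → y ≡ b → N′ ≡ suc N → d ≡ m →
            x + j * N + (N + suc j) ≡ y + suc j * N′ + d
  combine {b = b} {N} m refl refl refl refl = lem m b j N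
    where
    lem : ∀ m b j N → m + b + j * N + (N + suc j) ≡ b + suc j * suc N + m
    lem = solve-∀
  go : ∀ m → c ∸ j ≡ suc m → c ∸ suc j ≡ m → f n j c + (n ∸ (c ∸ j + 1) + suc j) ≡ f n (suc j) c + (c ∸ j)
  go m eq eq′ = combine {x = (c ∸ j + 1) choose 2} {y = (c ∸ suc j + 1) choose 2} {b = (c ∸ suc j + 1) choose 2} (c ∸ j)
    (trans (cong (_choose 2) (trans (cong (_+ 1) (trans eq (cong suc (sym eq′)))) refl)) 
           (trans (choose-suc (c ∸ suc j + 1)) (cong (_+ (c ∸ suc j + 1) choose 2) (trans (cong (_+ 1) eq′) (trans (+-comm m 1) (sym eq))))))
    refl (trans (cong (λ z → n ∸ (z + 1)) eq′) (trans (shift m eq) (cong (λ z → suc (n ∸ (z + 1))) (sym eq)))) refl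

module _ {n c : ℕ} (c<n : c < n) where

  private
    Rising : ℕ → Set
    Rising j = c ∸ j ≤ n ∸ (c ∸ j + 1) + suc j

    rising-suc : ∀ {j j′} → j ≤ j′ → Rising j → Rising j′
    rising-suc {j} {j′} h r = ≤-trans (∸-monoʳ-≤ c h) (≤-trans r (+-mono-≤ (∸-monoʳ-≤ n (+-monoˡ-≤ 1 (∸-monoʳ-≤ c h))) (s≤s h)))

    rise : ∀ j m → Rising j → j + m ≤ c → f n j c ≤ f n (j + m) c
    rise j zero    r le = ≤-reflexive (cong (λ k → f n k c) (sym (+-identityʳ j)))
    rise j (suc m) r le = ≤-trans (linear 0 (+-mono-≤ r (≤-reflexive (f-step n c j (≤-trans (s≤s (m≤m+n j m)) le′) c<n)))
                                    (lem (f n j c) (n ∸ (c ∸ j + 1) + suc j) (f n (suc j) c) (c ∸ j)))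
                           (≤-trans (rise (suc j) m (rising-suc (n≤1+n j) r) le′) (≤-reflexive (cong (λ k → f n k c) (sym (+-suc j m)))))
      where
      le′ : suc (j + m) ≤ c
      le′ = subst (_≤ c) (+-suc j m) le
      lem : ∀ a N b d → a + (N + (b + d)) + 0 ≡ b + (d + (a + N))
      lem = solve-∀

    fall : ∀ j m → ¬ Rising (j + m) → j + m ≤ c → f n (j + m) c ≤ f n j c
    fall j zero    r le = ≤-reflexive (cong (λ k → f n k c) (+-identityʳ j))
    fall j (suc m) r le = ≤-trans (≤-reflexive (cong (λ k → f n k c) (+-suc j m)))
      (≤-trans (linear 1 (+-mono-≤ (≰⇒> ¬r) (≤-reflexive (sym (f-step n c (j + m) (subst (_≤ c) (+-suc j m) le) c<n))))
                 (lem (f n (j + m) c) (n ∸ (c ∸ (j + m) + 1) + suc (j + m)) (f n (suc (j + m)) c) (c ∸ (j + m))))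
        (fall j m ¬r (≤-trans (+-monoʳ-≤ j (n≤1+n m)) le)))
      where
      ¬r : ¬ Rising (j + m)
      ¬r h = r (rising-suc (+-monoʳ-≤ j (n≤1+n m)) h)
      lem : ∀ a N b d → b + (d + (a + N)) + 1 ≡ a + (suc N + (b + d))
      lem = solve-∀

  -- Once the difference is nonnegative it stays so. If it is nonnegative at `s`, the values rise
  -- from `s` to `t`; otherwise they fall from `a` to `s`.
  f-convex : ∀ {a s t} → a ≤ s → s ≤ t → t ≤ c → f n s c ≤ f n a c ⊎ f n s c ≤ f n t c
  f-convex {a} {s} {t} a≤s s≤t t≤c with c ∸ s ≤? n ∸ (c ∸ s + 1) + suc s
  ... | yes r = inj₂ (subst (λ k → f n s c ≤ f n k c) (m+[n∸m]≡n s≤t) (rise s (t ∸ s) r (subst (_≤ c) (sym (m+[n∸m]≡n s≤t)) t≤c)))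
  ... | no ¬r = inj₁ (subst (λ k → f n k c ≤ f n a c) eq (fall a (s ∸ a) (¬r ∘ subst Rising eq) (subst (_≤ c) (sym eq) (≤-trans s≤t t≤c))))
    where
    eq : a + (s ∸ a) ≡ s
    eq = m+[n∸m]≡n a≤s

module _ {n : ℕ} (G : Graph n) where

  -- A path leaving `v` that avoids the first neighbour found begins with a second one.
  two-neighbours : NoCutvertex G → ∀ {v u w} → u ≢ w → u ≢ v → w ≢ v → 2 ≤ deg G v (allFin n)
  two-neighbours tc {v} {u} {w} u≢w u≢v w≢v = finish (neighbour tc (≢-sym u≢w) u≢v w≢v)
    where
    neighbour : NoCutvertex G → ∀ {x y} → x ≢ y → y ≢ v → x ≢ v → ∃[ z ] (Edge G v z × z ≢ x)
    neighbour tc {x} {y} x≢y y≢v x≢v with tc x v y (≢-sym x≢v) (≢-sym x≢y)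
    ... | _ , stop , _ , _ = ⊥-elim (y≢v refl)
    ... | _ , e ◂ p , _ , x∉ = _ , e , λ { refl → x∉ (there (first∈ p)) }
    conclude : ∀ {z z′} → Edge G v z → Edge G v z′ → z ≢ z′ → 2 ≤ deg G v (allFin n)
    conclude {z} {z′} e e′ z≢z′ = ≤-trans
      (≤-reflexive (sym (cong₂ (λ a b → a + (b + 0)) (ind-true G e) (ind-true G e′))))
      (Σₗ-⊆ _ (z ∷ z′ ∷ []) (allFin n) (Uniq-∷ (λ { (here eq) → z≢z′ eq }) Uniq-[x]) (λ {x} _ _ → ∈-allFin x))
    finish : ∃[ z ] (Edge G v z × z ≢ w) → 2 ≤ deg G v (allFin n)
    finish (z , e , _) with z ≟F u
    ... | yes refl with neighbour tc u≢w w≢v u≢v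
    ...   | z′ , e′ , z′≢ = conclude e e′ (≢-sym z′≢)
    finish (z , e , _) | no z≢u with neighbour tc z≢u u≢v (λ { refl → irrefl G e refl })
    ...   | z′ , e′ , z′≢ = conclude e e′ (≢-sym z′≢)

module _ {n : ℕ} where

  outside : List (Fin n) → List (Fin n)
  outside K = filter (λ x → ¬? (x ∈? K)) (allFin n)

  outside-∉ : ∀ K {x} → x ∈ outside K → x ∉ K
  outside-∉ K x∈ = proj₂ (∈-filter⁻ (λ x → ¬? (x ∈? K)) {xs = allFin n} x∈)

  ∉-outside : ∀ K {x} → x ∉ K → x ∈ outside K
  ∉-outside K {x} x∉ = ∈-filter⁺ (λ x → ¬? (x ∈? K)) (∈-allFin x) x∉

  Uniq-outside : ∀ K → Uniq (outside K)
  Uniq-outside K = Uniq-filter _ Uniq-allFin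

  outside-cover : ∀ K x → x ∈ outside K ++ K
  outside-cover K x with x ∈? K
  ... | yes x∈ = ∈-++⁺ʳ (outside K) x∈
  ... | no x∉  = ∈-++⁺ˡ (∉-outside K x∉)

  outside-length : ∀ {K} → Uniq K → length (outside K) + length K ≡ n
  outside-length {K} un = trans (sym (length-++ (outside K))) (≤-antisym
    (length≤n (Uniq-++ (outside K) (Uniq-outside K) un (λ x∈ → outside-∉ K x∈)))
    (subst (_≤ length (outside K ++ K)) length-allFin (length-⊆ (allFin n) _ Uniq-allFin (λ {x} _ → outside-cover K x))))

module _ {n : ℕ} (G : Graph n) {c : ℕ} (10≤c : 10 ≤ c) (c<n : c < n) (nl : NoLong G c) (tc : NoCutvertex G)
         (settled : ∀ x y → Settled G c x y) where

  open Saturated G (≤-trans (s≤s (s≤s z≤n)) 10≤c) nl tc settled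

  -- `large` rewrites `f n (k + 1) c < f n k c` by means of `f-step`. It is what later gives
  -- `3k + 1 < c`.
  record BigClique (k : ℕ) : Set where
    field
      K       : List (Fin n)
      unK     : Uniq K
      clK     : Clique K
      maxK    : Maximal K
      size    : k + length K ≡ suc c
      2≤k     : 2 ≤ k
      k<c/2   : suc k + suc k ≤ c
      large   : n + k + 3 ≤ length K + length K

  -- The core is already larger than `c - t + 1`, so `s < t`. A vertex of low degree outside `K`
  -- gives both `k ≤ s` and, by 2-connectedness, `2 ≤ s`. If `k < s`, then `s` lies between `k + 1`
  -- and `t`, where `f` is at most the larger of the two excluded values.
  big-clique : ∀ k → (∀ v → k ≤ deg G v (allFin n)) → f n (k + 1) c < edgesIn G (allFin n) →
               ∀ {t} → t + t ≤ c → c ≤ suc (t + t) → f n t c < edgesIn G (allFin n) → BigClique k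
  big-clique k δ≥k bound₁ {t} 2t≤c c≤ bound₂ with disintegrate G t j (n ∸ j) (allFin n) Uniq-allFin (trans length-allFin (sym (m∸n+n≡m j≤n)))
    where
    j : ℕ
    j = c ∸ t + 1
    j≤n : j ≤ n
    j≤n = ≤-trans (≤-reflexive (+-comm (c ∸ t) 1)) (≤-trans (s≤s (m∸n≤m c t)) c<n)
  ... | inj₁ le = ⊥-elim (<⇒≱ bound₂ le)
  ... | inj₂ (Y , unY , j<Y , core) with maximal-clique n Y unY (core-clique t Y c≤ unY core) (m≤m+n n (length Y))
  ...   | K , unK , clK , maxK , Y≤K = record
    { K = K ; unK = unK ; clK = clK ; maxK = maxK ; size = trans (cong (_+ length K) k≡s) s+K ; 2≤k = subst (2 ≤_) (sym k≡s) 2≤s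
    ; k<c/2 = ≤-trans (+-mono-≤ (subst (λ z → suc z ≤ t) (sym k≡s) s<t) (subst (λ z → suc z ≤ t) (sym k≡s) s<t)) 2t≤c
    ; large = large }
    where
    open MaximalClique unK clK maxK
    s : ℕ
    s = suc c ∸ length K
    D : List (Fin n)
    D = outside K
    K≤c : length K ≤ c
    K≤c = clique-length K unK clK
    s+K : s + length K ≡ suc c
    s+K = m∸n+n≡m (m≤n⇒m≤1+n K≤c)
    t≤c : t ≤ c
    t≤c = ≤-trans (m≤m+n t t) 2t≤c
    s<t : s < t
    s<t = linear 0 (+-mono-≤ (≤-trans j<Y Y≤K) (+-mono-≤ (≤-reflexive s+K) (≤-reflexive (sym (m∸n+n≡m t≤c)))))
      (lem s (length K) c t (c ∸ t))
      where
      lem : ∀ s K c t d → suc s + (K + (suc c + (d + t))) + 0 ≡ t + (suc (d + 1) + (s + K + c))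
      lem = solve-∀
    2≤K : 2 ≤ length K
    2≤K = ≤-trans (s≤s (m≤n+m 1 (c ∸ t))) (≤-trans j<Y Y≤K)
    c∸s : c ∸ s + 1 ≡ length K
    c∸s = +-cancelʳ-≡ s _ _ (trans (trans (lem (c ∸ s) s) (cong suc (m∸n+n≡m (≤-trans (<⇒≤ s<t) t≤c)))) (trans (sym s+K) (+-comm s (length K))))
      where
      lem : ∀ a s → a + 1 + s ≡ suc (a + s)
      lem = solve-∀
    D+K : length D + length K ≡ n
    D+K = outside-length unK
    D≡ : n ∸ length K ≡ length D
    D≡ = trans (cong (_∸ length K) (sym D+K)) (m+n∸n≡m (length D) (length K))
    E≤ : edgesIn G (allFin n) ≤ f n s c
    E≤ = begin
      edgesIn G (allFin n)                         ≤⟨ edgesIn-⊆ G (allFin n) (D ++ K) Uniq-allFin (λ {x} _ → outside-cover K x) ⟩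
      edgesIn G (D ++ K)                           ≤⟨ peel G s K (length D) D refl (Uniq-outside K) (outside-∉ K) (low-degree s+K) ⟩
      s * length D + edgesIn G K                   ≤⟨ +-monoʳ-≤ (s * length D) (edgesIn≤choose G K) ⟩
      s * length D + (length K) choose 2                ≡⟨ +-comm (s * length D) _ ⟩
      (length K) choose 2 + s * length D                ≡⟨ cong (λ k → (length K) choose 2 + s * k) D≡ ⟨
      (length K) choose 2 + s * (n ∸ length K)          ≡⟨ cong (λ k → k choose 2 + s * (n ∸ k)) c∸s ⟨
      f n s c                                      ∎
      where open ≤-Reasoning
    D≢[] : 1 ≤ length D
    D≢[] = linear 0 (+-mono-≤ (≤-reflexive (sym D+K)) (+-mono-≤ K≤c c<n)) (lem (length D) (length K) c n)
      where
      lem : ∀ d k c n → 1 + (d + k + (c + n)) + 0 ≡ d + (n + (k + suc c))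
      lem = solve-∀
    element : ∀ L → 1 ≤ length L → ∃[ x ] x ∈ L
    element (x ∷ L) _ = x , here refl
    two : ∀ L → Uniq L → 2 ≤ length L → ∃[ x ] ∃[ y ] (x ∈ L × y ∈ L × x ≢ y)
    two (x ∷ []) u (s≤s ())
    two (x ∷ y ∷ L) u _ = x , y , here refl , there (here refl) , λ { refl → Uniq-head u (here refl) }
    low : ∃[ v ] (v ∈ D × deg G v (D ++ K) ≤ s)
    low = low-degree s+K D (Uniq-outside K) (outside-∉ K) (proj₂ (element D D≢[]))
    low-all : deg G (proj₁ low) (allFin n) ≤ s
    low-all = ≤-trans (Σₗ-⊆ _ (allFin n) (D ++ K) Uniq-allFin (λ {x} _ _ → outside-cover K x)) (proj₂ (proj₂ low))
    2≤s : 2 ≤ s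
    2≤s with two K unK 2≤K
    ... | x , y , x∈ , y∈ , x≢y = ≤-trans (two-neighbours G tc x≢y
      (λ { refl → outside-∉ K (proj₁ (proj₂ low)) x∈ }) (λ { refl → outside-∉ K (proj₁ (proj₂ low)) y∈ })) low-all
    k≡s : k ≡ s
    k≡s = [ (λ lt → ⊥-elim ([ (λ le → <⇒≱ bound₁ (≤-trans E≤ le)) , (λ le → <⇒≱ bound₂ (≤-trans E≤ le)) ]′
                (f-convex c<n (≤-trans (≤-reflexive (+-comm k 1)) lt) (<⇒≤ s<t) t≤c)))
          , id ]′ (m≤n⇒m<n∨m≡n (≤-trans (δ≥k (proj₁ low)) low-all))
    large : n + k + 3 ≤ length K + length K
    large = subst (λ z → n + z + 3 ≤ length K + length K) (sym k≡s) (arith bound′ step-s c∸s D+K)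
      where
      bound′ : f n (suc s) c < f n s c
      bound′ = ≤-trans (subst (λ z → f n z c < edgesIn G (allFin n)) (trans (cong (_+ 1) k≡s) (+-comm s 1)) bound₁) E≤
      step-s : f n s c + (length D + suc s) ≡ f n (suc s) c + (c ∸ s)
      step-s = trans (cong (λ z → f n s c + (z + suc s)) (sym (trans (cong (n ∸_) c∸s) D≡))) (f-step n c s (≤-trans s<t t≤c) c<n)
      arith : ∀ {a b d e K n s} → b < a → a + (d + suc s) ≡ b + e → e + 1 ≡ K → d + K ≡ n → n + s + 3 ≤ K + K
      arith {a} {b} {d} {e} {K} {n} {s} p q r t = linear 0 (+-mono-≤ (+-mono-≤ p (≤-reflexive q)) (+-mono-≤ (≤-reflexive r) (≤-reflexive (sym t))))
        (lem n s a b e d K)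
        where
        lem : ∀ n s a b e d K → n + s + 3 + (a + (b + e) + (K + (d + K))) + 0 ≡ K + K + (suc b + (a + (d + suc s)) + (e + 1 + n))
        lem = solve-∀

-- The last vertex of a longest path out of the clique

module _ {n : ℕ} where

  private V = Fin n

  prefix-closed : ∀ A F {x : V} {B E} → Uniq (A ++ x ∷ B) → A ++ x ∷ B ≡ F ++ E → x ∈ F → ∀ {z} → z ∈ A → z ∈ F
  prefix-closed (a ∷ A) (b ∷ F) u eq x∈ z∈ with ∷-injective eq
  prefix-closed (a ∷ A) (b ∷ F) u eq x∈ (here refl) | refl , eq′ = here refl
  prefix-closed (a ∷ A) (b ∷ F) u eq (here refl) (there z∈) | refl , eq′ = ⊥-elim (Uniq-head u (∈-insert A))
  prefix-closed (a ∷ A) (b ∷ F) u eq (there x∈) (there z∈) | refl , eq′ = there (prefix-closed A F (Uniq-tail u) eq′ x∈ z∈)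

  uniq-split : ∀ A F {x : V} {B D} → Uniq (A ++ x ∷ B) → A ++ x ∷ B ≡ F ++ x ∷ D → A ≡ F × B ≡ D
  uniq-split []      []      u eq = refl , proj₂ (∷-injective eq)
  uniq-split []      (y ∷ F) u eq with ∷-injective eq
  ... | refl , refl = ⊥-elim (Uniq-head u (∈-insert F))
  uniq-split (a ∷ A) []      u eq with ∷-injective eq
  ... | refl , refl = ⊥-elim (Uniq-head u (∈-insert A))
  uniq-split (a ∷ A) (y ∷ F) u eq with ∷-injective eq
  ... | refl , eq′ with uniq-split A F (Uniq-tail u) eq′
  ...   | refl , eq″ = refl , eq″

module Around {n : ℕ} (G : Graph n) {c : ℕ} (2≤c : 2 ≤ c) (nl : NoLong G c) (tc : NoCutvertex G)
              (settled : ∀ x y → Settled G c x y)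
              (K : List (Fin n)) (unK : Uniq K) (clK : Saturated.Clique G 2≤c nl tc settled K)
              (maxK : Saturated.Maximal G 2≤c nl tc settled K)
              {k : ℕ} (size : k + length K ≡ suc c) (δ≥k : ∀ v → k ≤ deg G v (allFin n)) where

  open Saturated G 2≤c nl tc settled
  open MaximalClique unK clK maxK

  private V = Fin n

  -- A union of components of the graph without `K`.
  Closed : List V → Set
  Closed D = (∀ {x} → x ∈ D → x ∉ K) × (∀ {x y} → x ∈ D → y ∉ K → Edge G x y → y ∈ D)

  Ext : List V → V → V → List V → Set
  Ext D = Extremal K D

  -- If this holds for every outside vertex, each component of the graph without `K` is a clique
  -- whose vertices see the same part of `K`.
  Twins : V → Set
  Twins w = ∀ y → y ∉ K → Edge G w y → ∀ x → x ≢ w → x ≢ y → adj G y x ≡ adj G w x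

  -- Rotation at the edge from `v` to `x`: the part of the path beyond `x` is reversed and `z`
  -- becomes the end. The vertices and the length are unchanged, so the path is again a longest one.
  rotate : ∀ {D u v P A x z B} → Ext D u v P → P ≡ A ++ x ∷ z ∷ B → Edge G v x → z ∈ D → Ext D u z (A ++ x ∷ reverse (z ∷ B))
  rotate {D} {u} {v} {_} {A} {x} {z} {B} ext refl e z∈D = record
    { u∈A = u∈A ; v∈B = z∈D
    ; path = subst (Path G u z) (++-assoc A [ x ] _)
        (path-++ (proj₁ cut) (sym-edge G e) (path-reverse (proj₂ (proj₂ cut))))
    ; unique = Uniq-≤ (λ w → ≤-reflexive (same (δ w))) unique
    ; long = subst (c <_) (sym len) long
    ; longest = λ x∈ y∈ p un → subst (_ ≤_) (sym len) (longest x∈ y∈ p un) }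
    where
    open Extremal ext
    cut : Path G u x (A ++ [ x ]) × Edge G x z × Path G z v (z ∷ B)
    cut = path-cut A path
    same : ∀ w → Σₗ w (A ++ x ∷ reverse (z ∷ B)) ≡ Σₗ w (A ++ x ∷ z ∷ B)
    same w rewrite Σₗ-++ w A (x ∷ reverse (z ∷ B)) | Σₗ-++ w A (x ∷ z ∷ B) | Σₗ-reverse w (z ∷ B) = refl
    len : length (A ++ x ∷ reverse (z ∷ B)) ≡ length (A ++ x ∷ z ∷ B)
    len = Σₗ⇒length (A ++ x ∷ reverse (z ∷ B)) (A ++ x ∷ z ∷ B) same

  module EndFacts {D : List V} (closed : Closed D) {u v : V} {P : List V} (ext : Ext D u v P) where

    open Extremal ext public renaming (u∈A to u∈K; v∈B to v∈D)

    v∉K : v ∉ K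
    v∉K = proj₁ closed v∈D

    nbr∈P : ∀ {w} → Edge G v w → w ∈ P
    nbr∈P {w} e with w ∈? K
    ... | yes w∈K = K⊆P ext w∈K
    ... | no w∉K  = v-closed (proj₂ closed v∈D w∉K e) e

    degree≤ : deg G v (allFin n) ≤ deg G v P
    degree≤ = Σₗ-⊆ _ (allFin n) P Uniq-allFin (λ _ nz → nbr∈P (ind≢0 G nz))

    -- All neighbours of `v` are on `P`, at least `k` of them, and `u` has at least `length K - 1`
    -- neighbours there; these bounds add up to `c`. As `c` is also the upper bound, both are
    -- attained, which gives `degree≡k` and `u-nbr∈K`.
    tight : c ≤ deg G u P + deg G v P
    tight = linear 0 (+-mono-≤ (+-mono-≤ (δ≥k v) degree≤) (+-mono-≤ (degree-u ext) (≤-reflexive (sym size))))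
      (lem c (deg G v (allFin n)) (deg G v P) (deg G u P) k (length K))
      where
      lem : ∀ c d p q k r → c + (d + p + (suc q + (k + r))) + 0 ≡ q + p + (k + d + (r + suc c))
      lem = solve-∀

    degree≡k : deg G v (allFin n) ≡ k
    degree≡k = ≤-antisym (linear 0 (+-mono-≤ (+-mono-≤ degree≤ degree-sum) (+-mono-≤ (degree-u ext) (≤-reflexive (sym size))))
      (lem c (deg G v (allFin n)) (deg G v P) (deg G u P) k (length K))) (δ≥k v)
      where
      lem : ∀ c d p q k r → d + (p + c + (suc q + (k + r))) + 0 ≡ k + (d + (q + p) + (r + suc c))
      lem = solve-∀

    u-nbr∈K : ∀ {w} → w ∈ P → Edge G u w → w ∈ K
    u-nbr∈K {w} w∈P e with w ∈? K
    ... | yes w∈K = w∈K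
    ... | no w∉K  = ⊥-elim (1+n≰n {c} (linear 0 (+-mono-≤ (+-mono-≤ (δ≥k v) (+-mono-≤ degree≤ degree-sum))
        (+-mono-≤ (+-mono-≤ (clique-degree unK clK u∈K) more) (≤-reflexive (sym size))))
      (lem c (deg G v (allFin n)) (deg G v P) (deg G u P) k (length K) (deg G u K))))
      where
      more : suc (deg G u K) ≤ deg G u P
      more = subst (λ i → i + deg G u K ≤ deg G u P) (ind-true G e)
        (Σₗ-⊆ _ (w ∷ K) P (Uniq-∷ w∉K unK) λ { (here refl) _ → w∈P ; (there x∈) _ → K⊆P ext x∈ })
      lem : ∀ c d p q k r h → suc c + (d + (p + c) + (suc h + q + (k + r))) + 0 ≡ c + (k + (d + (q + p)) + (r + suc h + suc c))
      lem = solve-∀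

    crossing-data : Crossing G nl u v P
    crossing-data with kopylov G nl (≤-trans (s≤s z≤n) 2≤c) tc path unique long
    ... | inj₁ lt = ⊥-elim (<⇒≱ lt tight)
    ... | inj₂ cr = cr

    open Crossing crossing-data public

    covered : Linked (λ x y → Edge G v x ⊎ Edge G u y ⊎ (x ∈ M × y ∈ M)) P
    covered = cover tight

    b∈P : b ∈ P
    b∈P = subst (b ∈_) (sym shape) (∈-++⁺ʳ X (there (∈-insert M)))

    b∈K : b ∈ K
    b∈K = u-nbr∈K b∈P ub

    M∉K : ∀ {w} → w ∈ M → w ∉ K
    M∉K {w} w∈M w∈K with w ≟F u
    ... | no w≢u = proj₁ (All.lookup gap w∈M) (clK u∈K w∈K (≢-sym w≢u))
    ... | yes refl = Uniq-disjoint (X ++ [ a ]) (subst Uniq (trans shape (sym (++-assoc X [ a ] _))) unique)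
      (first∈ (proj₁ (path-split X (subst (Path G u v) shape path)))) (∈-++⁺ˡ w∈M)

    M-nonadj : ∀ {w} → w ∈ M → ¬ Edge G v w
    M-nonadj w∈M = proj₂ (All.lookup gap w∈M)

    inP : ∀ A {x B} → P ≡ A ++ x ∷ B → x ∈ P
    inP A {x} eq = subst (x ∈_) (sym eq) (∈-insert A)

    -- Of the alternatives in `covered`, adjacency of `u` to `y` is excluded, since all neighbours
    -- of `u` on `P` lie in `K`.
    pred : ∀ A {x y B} → P ≡ A ++ x ∷ y ∷ B → y ∉ K → Edge G v x ⊎ (x ∈ M × y ∈ M)
    pred A {x} {y} {B} eq y∉K with linked-at A (subst (Linked _) eq covered)
    ... | inj₁ e        = inj₁ e
    ... | inj₂ (inj₁ e) = ⊥-elim (y∉K (u-nbr∈K (inP (A ++ [ x ]) (trans eq (sym (++-assoc A [ x ] (y ∷ B))))) e))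
    ... | inj₂ (inj₂ m) = inj₂ m

    exit : ∀ A {x y B} → P ≡ A ++ x ∷ y ∷ B → x ∈ K → y ∉ K → Edge G v x
    exit A eq x∈K y∉K = [ id , (λ { (x∈M , _) → ⊥-elim (M∉K x∈M x∈K) }) ]′ (pred A eq y∉K)

    not-first : ∀ A {x y B} → P ≡ A ++ x ∷ y ∷ B → y ≢ u
    not-first A {x} {y} {B} eq refl = Uniq-disjoint (A ++ [ x ]) (subst Uniq (trans eq (sym (++-assoc A [ x ] (y ∷ B)))) unique)
      (first∈ (proj₁ (path-cut A (subst (Path G u v) eq path)))) (here refl)

    succ∉K : ∀ A {x y B} → P ≡ A ++ x ∷ y ∷ B → Edge G v x → y ∉ K
    succ∉K A {x} {y} {B} eq e y∈K =
      no-crossing G nl A x y B eq path unique long e (clK u∈K y∈K (≢-sym (not-first A eq)))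

    -- Two consecutive clique vertices after the first exit x₀ from the clique could be pulled
    -- apart to absorb the initial clique segment R, closing P into a long cycle through v x₀.
    no-return : ∀ r R {x₀ z₀} A {w w′ B} → All (_∈ K) (r ∷ R) → P ≡ (r ∷ R) ++ x₀ ∷ z₀ ∷ A ++ w ∷ w′ ∷ B →
                Edge G v x₀ → w ∈ K → w′ ∈ K → ⊥
    no-return r R {x₀} {z₀} A {w} {w′} {B} R⊆K eq e w∈ w′∈ with snoc r R
    ... | R₁ , s , eqR = <⇒≱ long (subst (_≤ c) len (nl
        (path-++ (path-++ (proj₁ back) (clK w∈ u∈K w≢u) (proj₁ front)) (clK s∈ w′∈ s≢w′) (proj₂ (proj₂ back)))
        (Uniq-≤ (λ x → ≤-reflexive (same (δ x))) unique) e))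
      where
      eq′ : P ≡ R₁ ++ s ∷ x₀ ∷ z₀ ∷ A ++ w ∷ w′ ∷ B
      eq′ = trans eq (trans (cong (_++ x₀ ∷ z₀ ∷ A ++ w ∷ w′ ∷ B) eqR) (++-assoc R₁ [ s ] _))
      front : Path G u s (R₁ ++ [ s ]) × Edge G s x₀ × Path G x₀ v (x₀ ∷ z₀ ∷ A ++ w ∷ w′ ∷ B)
      front = path-cut R₁ (subst (Path G u v) eq′ path)
      back : Path G x₀ w (x₀ ∷ z₀ ∷ A ++ [ w ]) × Edge G w w′ × Path G w′ v (w′ ∷ B)
      back = path-cut (x₀ ∷ z₀ ∷ A) (proj₂ (proj₂ front))
      whole : List V
      whole = ((x₀ ∷ z₀ ∷ A ++ [ w ]) ++ R₁ ++ [ s ]) ++ w′ ∷ B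
      same : ∀ f → Σₗ f whole ≡ Σₗ f P
      same f rewrite eq′ | Σₗ-++ f ((x₀ ∷ z₀ ∷ A ++ [ w ]) ++ R₁ ++ [ s ]) (w′ ∷ B) | Σₗ-++ f (x₀ ∷ z₀ ∷ A ++ [ w ]) (R₁ ++ [ s ])
                   | Σₗ-++ f A [ w ] | Σₗ-++ f R₁ [ s ] | Σₗ-++ f R₁ (s ∷ x₀ ∷ z₀ ∷ A ++ w ∷ w′ ∷ B) | Σₗ-++ f A (w ∷ w′ ∷ B) =
        lem (f x₀) (f z₀) (Σₗ f A) (f w) (Σₗ f R₁) (f s) (f w′) (Σₗ f B)
        where
        lem : ∀ x z A w R s w′ B → x + (z + (A + (w + 0))) + (R + (s + 0)) + (w′ + B) ≡ R + (s + (x + (z + (A + (w + (w′ + B))))))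
        lem = solve-∀
      len : length whole ≡ length P
      len = Σₗ⇒length whole P same
      s∈ : s ∈ K
      s∈ = All.lookup R⊆K (subst (s ∈_) (sym eqR) (∈-++⁺ʳ R₁ (here refl)))
      dis : ∀ {x} → x ∈ R₁ ++ [ s ] → x ∈ x₀ ∷ z₀ ∷ A ++ w ∷ w′ ∷ B → ⊥
      dis = Uniq-disjoint (R₁ ++ [ s ]) (subst Uniq (trans eq′ (sym (++-assoc R₁ [ s ] _))) unique)
      w≢u : w ≢ u
      w≢u refl = dis (first∈ (proj₁ front)) (there (there (∈-insert A)))
      s≢w′ : s ≢ w′
      s≢w′ refl = dis (∈-++⁺ʳ R₁ (here refl)) (there (there (∈-++⁺ʳ A (there (here refl)))))

    -- `x₀` is the last vertex of the initial stretch of `P` inside `K`, and `R` is that stretch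
    -- without `x₀`, possibly empty.
    record Start (R : List V) : Set where
      field
        x₀ z₀ : V
        W     : List V
        R⊆K   : All (_∈ K) R
        x₀∈K  : x₀ ∈ K
        z₀∉K  : z₀ ∉ K
        begins : P ≡ R ++ x₀ ∷ z₀ ∷ W

    start : ∃[ R ] Start R
    start with first-split (λ x → ¬? (x ∈? K)) P
    ... | inj₁ none = ⊥-elim (All.lookup none (last∈ path) v∉K)
    ... | inj₂ ([] , z , W , eq , _ , z∉) = ⊥-elim (z∉ (subst (_∈ K) (path-head≡ (subst (Path G u v) eq path)) u∈K))
    ... | inj₂ (r ∷ N , z , W , eq , none , z∉) with snoc r N
    ...   | R , x₀ , eqN = R , record
      { x₀ = x₀ ; z₀ = z ; W = W ; R⊆K = All-++⁻ˡ R inK ; x₀∈K = All.head (All-++⁻ʳ R inK) ; z₀∉K = z∉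
      ; begins = trans eq (trans (cong (_++ z ∷ W) eqN) (++-assoc R [ x₀ ] (z ∷ W))) }
      where
      inK : All (_∈ K) (R ++ [ x₀ ])
      inK = subst (All (_∈ K)) eqN (All.map (λ {x} → decidable-stable (x ∈? K)) none)

    module _ {R : List V} (st : Start R) where

      open Start st

      -- Beyond `R` a clique vertex is never followed by a clique vertex (`no-return`), and `P` does
      -- not end in `K`; so `w` is followed by an outside vertex and `exit` applies.
      K-nbr : ∀ {w} → w ∈ K → w ∉ R → Edge G v w
      K-nbr {w} w∈K w∉R with ∈-++⁻ R (subst (w ∈_) begins (K⊆P ext w∈K))
      ... | inj₁ w∈R = ⊥-elim (w∉R w∈R)
      ... | inj₂ (here refl) = exit R begins x₀∈K z₀∉K
      ... | inj₂ (there (here refl)) = ⊥-elim (z₀∉K w∈K)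
      ... | inj₂ (there (there w∈W)) with ∈-∃++ w∈W
      ...   | A , [] , refl = ⊥-elim (v∉K (subst (_∈ K) (sym (path-last≡ (R ++ x₀ ∷ z₀ ∷ A)
                (subst (Path G u v) (trans begins (sym (++-assoc R (x₀ ∷ z₀ ∷ A) [ w ]))) path))) w∈K))
      ...   | A , w′ ∷ B , refl with w′ ∈? K
      ...     | no w′∉  = exit (R ++ x₀ ∷ z₀ ∷ A) (trans begins (sym (++-assoc R (x₀ ∷ z₀ ∷ A) (w ∷ w′ ∷ B)))) w∈K w′∉
      ...     | yes w′∈ = ⊥-elim (absurd R R⊆K begins)
        where
        absurd : ∀ R → All (_∈ K) R → P ≡ R ++ x₀ ∷ z₀ ∷ A ++ w ∷ w′ ∷ B → ⊥
        -- With `R` empty, `x₀` is `u` itself, and the edge from `v` to `x₀` contradicts the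
        -- nonadjacency of the ends.
        absurd []      R⊆K eq = nonadjacent (subst (λ t → Edge G t v) (sym (path-head≡ (subst (Path G u v) eq path)))
                                  (sym-edge G (exit R begins x₀∈K z₀∉K)))
        absurd (r ∷ R′) R⊆K eq = no-return r R′ A R⊆K eq (exit R begins x₀∈K z₀∉K) w∈K w′∈

      -- Every vertex of `R` is followed by a vertex of `K`, which `succ∉K` forbids after a
      -- neighbour of `v`.
      K-nonnbr : ∀ {w} → w ∈ R → ¬ Edge G v w
      K-nonnbr {w} w∈R e with ∈-∃++ w∈R
      ... | A , [] , refl = succ∉K A (trans begins (++-assoc A [ w ] (x₀ ∷ z₀ ∷ W))) e x₀∈K
      ... | A , w′ ∷ B , refl = succ∉K A (trans begins (++-assoc A (w ∷ w′ ∷ B) (x₀ ∷ z₀ ∷ W))) e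
              (All.lookup R⊆K (∈-++⁺ʳ A (there (here refl))))

    module LastRun {P₀ l Q} (ends : P ≡ P₀ ++ l ∷ Q) (l∈K : l ∈ K) (Q∉K : All (_∉ K) Q) where

      ends′ : P ≡ (P₀ ++ [ l ]) ++ Q
      ends′ = trans ends (sym (++-assoc P₀ [ l ] Q))

      K∈prefix : ∀ {w} → w ∈ K → w ∈ P₀ ++ [ l ]
      K∈prefix {w} w∈K with ∈-++⁻ (P₀ ++ [ l ]) (subst (w ∈_) ends′ (K⊆P ext w∈K))
      ... | inj₁ h   = h
      ... | inj₂ w∈Q = ⊥-elim (All.lookup Q∉K w∈Q w∈K)

      prefix∩Q : ∀ {w} → w ∈ P₀ ++ [ l ] → w ∈ Q → ⊥
      prefix∩Q = Uniq-disjoint (P₀ ++ [ l ]) (subst Uniq ends′ unique)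

      l∉P₀ : l ∉ P₀
      l∉P₀ l∈ = Uniq-disjoint P₀ (subst Uniq ends unique) l∈ (here refl)

      shape′ : P ≡ (X ++ a ∷ M) ++ b ∷ Y
      shape′ = trans shape (sym (++-assoc X (a ∷ M) (b ∷ Y)))

      before-b : ∀ {w} → w ∈ X ++ a ∷ M → w ∈ P₀ ++ [ l ]
      before-b = prefix-closed (X ++ a ∷ M) (P₀ ++ [ l ]) (subst Uniq shape′ unique) (trans (sym shape′) ends′) (K∈prefix b∈K)

      a∈P₀ : a ∈ P₀
      a∈P₀ with ∈-++⁻ P₀ (K∈prefix b∈K)
      ... | inj₁ b∈P₀ = prefix-closed (X ++ a ∷ M) P₀ (subst Uniq shape′ unique) (trans (sym shape′) ends) b∈P₀ (∈-insert X)
      ... | inj₂ (here b≡l) with ∈-++⁻ P₀ (before-b (∈-insert X))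
      ...   | inj₁ h = h
      ...   | inj₂ (here a≡l) = ⊥-elim (Uniq-disjoint (X ++ a ∷ M) (subst Uniq shape′ unique) (∈-insert X) (here (trans a≡l (sym b≡l))))

      Q∩M : ∀ {w} → w ∈ M → w ∈ Q → ⊥
      Q∩M w∈M = prefix∩Q (before-b (∈-++⁺ʳ X (there w∈M)))

      last≡v : ∀ E {w} → l ∷ Q ≡ E ++ [ w ] → v ≡ w
      last≡v E {w} eq = path-last≡ (P₀ ++ E) (subst (Path G u v) (trans ends (trans (cong (P₀ ++_) eq) (sym (++-assoc P₀ E [ w ])))) path)

      run-step : ∀ E {x y B} → l ∷ Q ≡ E ++ x ∷ y ∷ B → Edge G v x
      run-step E {x} {y} {B} eq = [ id , (λ { (_ , y∈M) → ⊥-elim (Q∩M y∈M y∈Q) }) ]′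
        (pred (P₀ ++ E) (trans ends (trans (cong (P₀ ++_) eq) (sym (++-assoc P₀ E (x ∷ y ∷ B))))) (All.lookup Q∉K y∈Q))
        where
        y∈Q : y ∈ Q
        y∈Q = go E eq
          where
          go : ∀ E → l ∷ Q ≡ E ++ x ∷ y ∷ B → y ∈ Q
          go []      refl = here refl
          go (_ ∷ E) refl = ∈-++⁺ʳ E (there (here refl))

      -- The gap `M` precedes `b`, which lies in `K`, so it precedes `Q`. Within the final stretch
      -- the exceptional alternative of `pred` therefore never occurs, and every vertex that has a
      -- successor is a neighbour of `v`.
      run-adjacent : ∀ {w} → w ∈ l ∷ Q → w ≢ v → Edge G v w
      run-adjacent w∈ w≢v with ∈-∃++ w∈
      ... | E , []    , eq = ⊥-elim (w≢v (sym (last≡v E eq)))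
      ... | E , _ ∷ B , eq = run-step E eq

      l≢v : l ≢ v
      l≢v refl = v∉K l∈K

      l-nbr : Edge G v l
      l-nbr = run-adjacent (here refl) l≢v

      Q⊆D : ∀ {y} → y ∈ Q → y ∈ D
      Q⊆D {y} y∈Q with y ≟F v
      ... | yes refl = v∈D
      ... | no y≢v   = proj₂ closed v∈D (All.lookup Q∉K y∈Q) (run-adjacent (there y∈Q) y≢v)

      v∈Q : v ∈ Q
      v∈Q with last∈ (proj₂ (path-split P₀ (subst (Path G u v) ends path)))
      ... | here eq = ⊥-elim (l≢v (sym eq))
      ... | there h = h

      record Reordered (y : V) : Set where
        field
          Q′    : List V
          ext′  : Ext D u y (P₀ ++ l ∷ Q′)
          Q′⊆Q  : ∀ {z} → z ∈ Q′ → z ∈ Q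
          Q⊆Q′  : ∀ {z} → z ∈ Q → z ∈ Q′

        Q′∉K : All (_∉ K) Q′
        Q′∉K = All.tabulate λ z∈ → All.lookup Q∉K (Q′⊆Q z∈)

        ends-prefix : (P₀ ++ [ l ]) ++ Q′ ≡ P₀ ++ l ∷ Q′
        ends-prefix = ++-assoc P₀ [ l ] Q′

      -- The predecessor of `y` is adjacent to `v`, so a rotation there makes `y` the last vertex.
      -- It permutes `Q` and leaves `P₀` and `l` in place, so facts about `v` carry over to all of
      -- `Q`.
      reorder : ∀ {y} → y ∈ Q → Reordered y
      reorder {y} y∈Q with ∈-∃++ y∈Q
      ... | Q₁ , Q₂ , eqQ with snoc l Q₁
      ...   | E , x , eqE = record
        { Q′ = Q₁ ++ reverse (y ∷ Q₂)
        ; ext′ = subst (Ext D u y) (cong (P₀ ++_) shift) (subst (Ext D u y) (++-assoc P₀ E _)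
            (rotate {A = P₀ ++ E} {x} {y} {Q₂} ext (trans ends (trans (cong (P₀ ++_) run) (sym (++-assoc P₀ E (x ∷ y ∷ Q₂))))) (run-step E run) (Q⊆D y∈Q)))
        ; Q′⊆Q = λ z∈ → subst (_ ∈_) (sym eqQ) ([ ∈-++⁺ˡ , (λ h → ∈-++⁺ʳ Q₁ (reverse⁻ h)) ]′ (∈-++⁻ Q₁ z∈))
        ; Q⊆Q′ = λ z∈ → [ ∈-++⁺ˡ , (λ h → ∈-++⁺ʳ Q₁ (reverse⁺ h)) ]′ (∈-++⁻ Q₁ (subst (_ ∈_) eqQ z∈)) }
        where
        run : l ∷ Q ≡ E ++ x ∷ y ∷ Q₂
        run = trans (cong (l ∷_) eqQ) (trans (cong (_++ y ∷ Q₂) eqE) (++-assoc E [ x ] (y ∷ Q₂)))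
        shift : E ++ x ∷ reverse (y ∷ Q₂) ≡ l ∷ Q₁ ++ reverse (y ∷ Q₂)
        shift = sym (trans (cong (_++ reverse (y ∷ Q₂)) eqE) (++-assoc E [ x ] (reverse (y ∷ Q₂))))

  module Ends {D : List V} (closed : Closed D) {u v : V} {P : List V} (ext : Ext D u v P)
              {P₀ l Q} (ends : P ≡ P₀ ++ l ∷ Q) (l∈K : l ∈ K) (Q∉K : All (_∉ K) Q) where

    open EndFacts closed ext
    open LastRun {P₀} {l} {Q} ends l∈K Q∉K public

    module At {y : V} (y∈Q : y ∈ Q) where
      open Reordered (reorder y∈Q) public
      open EndFacts closed ext′ public using ()
        renaming (exit to exit-at; succ∉K to succ∉K-at; nbr∈P to nbr∈P-at; degree≡k to degree≡k-at)
      open EndFacts.LastRun closed ext′ {P₀} {l} {Q′} refl l∈K Q′∉K public using ()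
        renaming (run-adjacent to run-adjacent-at)

    Q-adjacent : ∀ {y} → y ∈ Q → ∀ {w} → w ∈ l ∷ Q → w ≢ y → Edge G y w
    Q-adjacent y∈Q (here refl) = At.run-adjacent-at y∈Q (here refl)
    Q-adjacent y∈Q (there w∈Q) = At.run-adjacent-at y∈Q (there (At.Q⊆Q′ y∈Q w∈Q))

    prefix-at : ∀ {y} (y∈Q : y ∈ Q) A {x z B} → P₀ ++ [ l ] ≡ A ++ x ∷ z ∷ B → P₀ ++ l ∷ At.Q′ y∈Q ≡ A ++ x ∷ z ∷ B ++ At.Q′ y∈Q
    prefix-at y∈Q A {x} {z} {B} eq = trans (sym (At.ends-prefix y∈Q)) (trans (cong (_++ At.Q′ y∈Q) eq) (++-assoc A (x ∷ z ∷ B) (At.Q′ y∈Q)))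

    exit-Q : ∀ {y} → y ∈ Q → ∀ A {x z B} → P₀ ++ [ l ] ≡ A ++ x ∷ z ∷ B → x ∈ K → z ∉ K → Edge G y x
    exit-Q y∈Q A eq = At.exit-at y∈Q A (prefix-at y∈Q A eq)

    next-in-prefix : ∀ {x} → x ∈ P₀ → ∃[ A ] ∃[ z ] ∃[ B ] (P₀ ++ [ l ] ≡ A ++ x ∷ z ∷ B)
    next-in-prefix {x} x∈ with ∈-∃++ x∈
    ... | A , []    , eq = A , l , [] , trans (cong (_++ [ l ]) eq) (++-assoc A [ x ] [ l ])
    ... | A , z ∷ B , eq = A , z , B ++ [ l ] , trans (cong (_++ [ l ]) eq) (++-assoc A (x ∷ z ∷ B) [ l ])

    -- All these paths share the prefix up to `l`, and there the successor of `x` decides: it is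
    -- outside `K` if some end is adjacent to `x`, and then every end is.
    K-transfer : ∀ {y y′} → y ∈ Q → y′ ∈ Q → ∀ {x} → x ∈ K → Edge G y x → Edge G y′ x
    K-transfer {y} {y′} y∈ y′∈ {x} x∈K e with ∈-++⁻ P₀ (K∈prefix x∈K)
    ... | inj₂ (here refl) = Q-adjacent y′∈ (here refl) (λ { refl → All.lookup Q∉K y′∈ x∈K })
    ... | inj₁ x∈P₀ with next-in-prefix x∈P₀
    ...   | A , z , B , eq = exit-Q y′∈ A eq x∈K (At.succ∉K-at y∈ A (prefix-at y∈ A eq) e)

    -- A neighbour z ∈ P₀ of v outside the clique can be chosen right after a clique vertex x;
    -- then Q can be inserted between x and z.
    outer-nonadjacent : ∀ {z} → z ∈ P₀ → z ∉ K → ¬ Edge G v z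
    outer-nonadjacent {z} z∈ z∉K e with first-split (λ z → ¬? (z ∈? K) ×-dec edge? G v z) P₀
    ... | inj₁ none = All.lookup none z∈ (z∉K , e)
    ... | inj₂ ([] , z , B , refl , _ , z∉ , _) = z∉ (subst (_∈ K) (path-head≡ (subst (Path G u v) ends path)) u∈K)
    ... | inj₂ (r ∷ A , z , B , eqP , none , z∉ , ez) with snoc r A
    ...   | A₁ , x , eqA = absurd Q refl
      where
      eq₀ : P₀ ≡ A₁ ++ x ∷ z ∷ B
      eq₀ = trans eqP (trans (cong (_++ z ∷ B) eqA) (++-assoc A₁ [ x ] (z ∷ B)))
      eq₁ : P₀ ++ [ l ] ≡ A₁ ++ x ∷ z ∷ B ++ [ l ]
      eq₁ = trans (cong (_++ [ l ]) eq₀) (++-assoc A₁ (x ∷ z ∷ B) [ l ])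
      eq : P ≡ A₁ ++ x ∷ z ∷ B ++ l ∷ Q
      eq = trans ends (trans (cong (_++ l ∷ Q) eq₀) (++-assoc A₁ (x ∷ z ∷ B) (l ∷ Q)))
      ex : Edge G v x
      ex = [ id , (λ { (_ , z∈M) → ⊥-elim (M-nonadj z∈M ez) }) ]′ (pred A₁ eq z∉)
      x∈K : x ∈ K
      x∈K = decidable-stable (x ∈? K) λ x∉K → All.lookup none (subst (x ∈_) (sym eqA) (∈-++⁺ʳ A₁ (here refl))) (x∉K , ex)
      cut : Path G u x (A₁ ++ [ x ]) × Edge G x z × Path G z v (z ∷ B ++ l ∷ Q)
      cut = path-cut A₁ (subst (Path G u v) eq path)
      halves : Path G z l (z ∷ B ++ [ l ]) × Path G l v (l ∷ Q)
      halves = path-split (z ∷ B) (proj₂ (proj₂ cut))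
      absurd : ∀ Q₀ → Q ≡ Q₀ → ⊥
      absurd [] eqQ with subst (v ∈_) eqQ v∈Q
      ... | ()
      absurd (q ∷ Q′) eqQ = <⇒≱ long (subst (_≤ c) (Σₗ⇒length whole P same) (nl
          (path-++ (path-++ (proj₁ cut) (sym-edge G (exit-Q (subst (q ∈_) (sym eqQ) (here refl)) A₁ eq₁ x∈K z∉))
             (proj₂ (proj₂ (path-uncons (subst (λ Q → Path G l v (l ∷ Q)) eqQ (proj₂ halves)))))) ez (proj₁ halves))
          (Uniq-≤ (λ w → ≤-reflexive (same (δ w))) unique) (clK l∈K u∈K l≢u)))
        where
        whole : List V
        whole = ((A₁ ++ [ x ]) ++ q ∷ Q′) ++ z ∷ B ++ [ l ]
        same : ∀ f → Σₗ f whole ≡ Σₗ f P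
        same f rewrite trans eq (cong (λ Q → A₁ ++ x ∷ z ∷ B ++ l ∷ Q) eqQ) | Σₗ-++ f ((A₁ ++ [ x ]) ++ q ∷ Q′) (z ∷ B ++ [ l ]) | Σₗ-++ f (A₁ ++ [ x ]) (q ∷ Q′)
                     | Σₗ-++ f A₁ [ x ] | Σₗ-++ f B [ l ] | Σₗ-++ f A₁ (x ∷ z ∷ B ++ l ∷ q ∷ Q′) | Σₗ-++ f B (l ∷ q ∷ Q′) =
          lem (Σₗ f A₁) (f x) (f q) (Σₗ f Q′) (f z) (Σₗ f B) (f l)
          where
          lem : ∀ A x q Q z B l → A + (x + 0) + (q + Q) + (z + (B + (l + 0))) ≡ A + (x + (z + (B + (l + (q + Q)))))
          lem = solve-∀
        l≢u : l ≢ u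
        l≢u refl = Uniq-disjoint (A₁ ++ [ x ]) (subst Uniq (trans eq (sym (++-assoc A₁ [ x ] _))) unique)
          (first∈ (proj₁ cut)) (there (∈-insert B))

  module Ends₂ {D : List V} (closed : Closed D) {u v : V} {P : List V} (ext : Ext D u v P)
               {P₀ l Q} (ends : P ≡ P₀ ++ l ∷ Q) (l∈K : l ∈ K) (Q∉K : All (_∉ K) Q) where

    open EndFacts closed ext
    open Ends closed ext {P₀} {l} {Q} ends l∈K Q∉K public

    outer-nonadjacent-Q : ∀ {y} → y ∈ Q → ∀ {z} → z ∈ P₀ → z ∉ K → ¬ Edge G y z
    outer-nonadjacent-Q y∈Q = Ends.outer-nonadjacent closed (At.ext′ y∈Q) {P₀} {l} {At.Q′ y∈Q} refl l∈K (At.Q′∉K y∈Q)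

    -- Neighbours of `y` lie on the path reordered to end at `y`, and outside vertices of `P₀` are
    -- excluded. So `Q` is an entire component of the graph without `K`.
    nbr∈Q : ∀ {y} → y ∈ Q → ∀ {z} → z ∉ K → Edge G y z → z ∈ Q
    nbr∈Q y∈Q {z} z∉K e with ∈-++⁻ P₀ (At.nbr∈P-at y∈Q e)
    ... | inj₁ z∈P₀         = ⊥-elim (outer-nonadjacent-Q y∈Q z∈P₀ z∉K e)
    ... | inj₂ (here refl)  = ⊥-elim (z∉K l∈K)
    ... | inj₂ (there z∈Q′) = At.Q′⊆Q y∈Q z∈Q′

    transfer : ∀ {y y′} → y ∈ Q → y′ ∈ Q → ∀ {x} → x ≢ y′ → Edge G y x → Edge G y′ x
    transfer {y} {y′} y∈ y′∈ {x} x≢y′ e with x ∈? K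
    ... | yes x∈K = K-transfer y∈ y′∈ x∈K e
    ... | no x∉K  = Q-adjacent y′∈ (there (nbr∈Q y∈ x∉K e)) x≢y′

    twins : Twins v
    twins y y∉K e x x≢v x≢y = bool-ext (transfer y∈ v∈Q x≢v) (transfer v∈Q y∈ x≢y)
      where
      y∈ : y ∈ Q
      y∈ = nbr∈Q v∈Q y∉K e

    a∈K : a ∈ K
    a∈K = decidable-stable (a ∈? K) λ a∉K → prefix∩Q (∈-++⁺ˡ a∈P₀) (nbr∈Q v∈Q a∉K va)

    a≢l : a ≢ l
    a≢l eq = l∉P₀ (subst (_∈ P₀) eq a∈P₀)

  module _ {D : List V} (closed : Closed D) {u v : V} {P : List V} (ext : Ext D u v P) where

    open EndFacts closed ext

    abstract
      last-run : ∃[ P₀ ] ∃[ l ] ∃[ Q ] (P ≡ P₀ ++ l ∷ Q × All (_∉ K) Q × l ∈ K)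
      last-run with last-split (_∈? K) P
      ... | inj₁ none = ⊥-elim (All.lookup none (first∈ path) u∈K)
      ... | inj₂ run  = run

      end-twins : Twins v
      end-twins with last-run
      ... | P₀ , l , Q , eq , Q∉K , l∈K = Ends₂.twins closed ext {P₀} {l} {Q} eq l∈K Q∉K

      two-K-nbrs : ∃[ x ] ∃[ y ] (x ∈ K × y ∈ K × x ≢ y × Edge G v x × Edge G v y)
      two-K-nbrs with last-run
      ... | P₀ , l , Q , eq , Q∉K , l∈K = a , l , a∈K , l∈K , a≢l , va , l-nbr
        where open Ends₂ closed ext {P₀} {l} {Q} eq l∈K Q∉K

  module _ {D : List V} (closed : Closed D) where

    -- Up to `x₀` the path stays in `K`, so another step out of `K` is either the first one or lies
    -- wholly beyond it. Rotating there keeps `R`.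
    compare : ∀ R A {x₀ z₀ W x z B} → All (_∈ K) R → x₀ ∈ K → z₀ ∉ K → x ∈ K → z ∉ K →
              R ++ x₀ ∷ z₀ ∷ W ≡ A ++ x ∷ z ∷ B → R ≡ A ⊎ ∃[ A′ ] A ≡ R ++ x₀ ∷ z₀ ∷ A′
    compare [] []          _ x₀∈ z₀∉ x∈ z∉ eq = inj₁ refl
    compare [] (p ∷ [])    _ x₀∈ z₀∉ x∈ z∉ refl = ⊥-elim (z₀∉ x∈)
    compare [] (p ∷ q ∷ A) _ x₀∈ z₀∉ x∈ z∉ refl = inj₂ (A , refl)
    compare (r ∷ []) []      _        x₀∈ z₀∉ x∈ z∉ refl = ⊥-elim (z∉ x₀∈)
    compare (r ∷ s ∷ R) []   (_ ∷ s∈ ∷ _) x₀∈ z₀∉ x∈ z∉ refl = ⊥-elim (z∉ s∈)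
    compare (r ∷ R) (p ∷ A) (_ ∷ R⊆) x₀∈ z₀∉ x∈ z∉ eq with ∷-injective eq
    ... | refl , eq′ with compare R A R⊆ x₀∈ z₀∉ x∈ z∉ eq′
    ...   | inj₁ refl        = inj₁ refl
    ...   | inj₂ (A′ , refl) = inj₂ (A′ , refl)

    -- Both ends see exactly the clique vertices off the initial clique segment.
    rotate-K : ∀ {u v P A x z B} → Ext D u v P → P ≡ A ++ x ∷ z ∷ B → Edge G v x → z ∈ D → x ∈ K →
               ∀ {w} → w ∈ K → (Edge G v w → Edge G z w) × (Edge G z w → Edge G v w)
    rotate-K {u} {v} {P} {A} {x} {z} {B} ext eq e z∈D x∈K {w} w∈K with EndFacts.start closed ext
    ... | R , st = (λ evw → EndFacts.K-nbr closed ext^ st^ w∈K (λ w∈R → EndFacts.K-nonnbr closed ext st w∈R evw))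
                 , (λ ezw → EndFacts.K-nbr closed ext st w∈K (λ w∈R → EndFacts.K-nonnbr closed ext^ st^ w∈R ezw))
      where
      open EndFacts.Start st
      ext^ : Ext D u z (A ++ x ∷ reverse (z ∷ B))
      ext^ = rotate ext eq e z∈D
      z∉K : z ∉ K
      z∉K = proj₁ closed z∈D
      st^ : EndFacts.Start closed ext^ R
      st^ with compare R A R⊆K x₀∈K z₀∉K x∈K z∉K (trans (sym begins) eq)
      ... | inj₂ (A′ , refl) = record
        { R⊆K = R⊆K ; x₀∈K = x₀∈K ; z₀∉K = z₀∉K ; begins = ++-assoc R (x₀ ∷ z₀ ∷ A′) (x ∷ reverse (z ∷ B)) }
      -- After a rotation at the first exit the reversed part begins with `v`, which is outside `K`;
      -- the initial stretch is unchanged.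
      ... | inj₁ refl with path-head (path-reverse (proj₂ (proj₂ (path-cut A (subst (Path G u v) eq (Extremal.path ext))))))
      ...   | W′ , eq′ = record
        { R⊆K = R⊆K ; x₀∈K = x∈K ; z₀∉K = EndFacts.v∉K closed ext ; begins = cong (λ L → A ++ x ∷ L) eq′ }

-- The components outside the clique

module Assembly {n : ℕ} (G : Graph n) {c : ℕ} (2≤c : 2 ≤ c) (nl : NoLong G c) (tc : NoCutvertex G)
                (settled : ∀ x y → Settled G c x y)
                (K : List (Fin n)) (unK : Uniq K) (clK : Saturated.Clique G 2≤c nl tc settled K)
                (maxK : Saturated.Maximal G 2≤c nl tc settled K)
                {k : ℕ} (size : k + length K ≡ suc c) (δ≥k : ∀ v → k ≤ deg G v (allFin n)) where

  open Saturated G 2≤c nl tc settled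
  open Around G 2≤c nl tc settled K unK clK maxK size δ≥k

  private V = Fin n


  -- The clique vertices off `T` link `z` back to `x`, so `T` and all of `K` lie on one cycle. It
  -- contains at least `length D + length K` vertices, and `length K = c + 1 - k`.
  few-outside : ∀ {x z T D} → Path G x z T → Uniq T → x ∈ K → z ∈ K → x ≢ z →
                Uniq D → (∀ {w} → w ∈ D → w ∉ K) → (∀ {w} → w ∈ D → w ∈ T) → length D < k
  few-outside {x} {z} {T} {D} p unT x∈ z∈ x≢z unD D∉K D⊆T = linear 0 (+-mono-≤ (+-mono-≤ covers short) (≤-reflexive (sym size)))
    (lem (length D) (length K) (length (T ++ rest)) c k)
    where
    lem : ∀ d r t c k → suc d + (t + c + (k + r)) + 0 ≡ k + (d + r + t + suc c)
    lem = solve-∀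
    rest : List V
    rest = filter (λ w → ¬? (w ∈? T)) K
    rest-∈ : ∀ {w} → w ∈ rest → w ∈ K × w ∉ T
    rest-∈ = ∈-filter⁻ (λ w → ¬? (w ∈? T)) {xs = K}
    un : Uniq (T ++ rest)
    un = Uniq-++ T unT (Uniq-filter _ unK) (λ w∈T w∈r → proj₂ (rest-∈ w∈r) w∈T)
    short : length (T ++ rest) ≤ c
    short = go rest un (λ w∈ → rest-∈ w∈)
      where
      go : ∀ R → Uniq (T ++ R) → (∀ {w} → w ∈ R → w ∈ K × w ∉ T) → length (T ++ R) ≤ c
      go [] un h = nl (subst (Path G x z) (sym (++-identityʳ T)) p) un (clK z∈ x∈ (≢-sym x≢z))
      go (r ∷ R) un h with clique-path r R (Uniq-++⁻ʳ T un) (λ a b → clK (proj₁ (h a)) (proj₁ (h b)))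
      ... | y , y∈ , q = nl (path-++ p (clK z∈ (proj₁ (h (here refl))) (λ { refl → proj₂ (h (here refl)) (last∈ p) })) q) un
        (clK (proj₁ (h y∈)) x∈ (λ { refl → proj₂ (h y∈) (first∈ p) }))
    covers : length D + length K ≤ length (T ++ rest)
    covers = subst (_≤ length (T ++ rest)) (length-++ D) (length-⊆ (D ++ K) (T ++ rest) (Uniq-++ D unD unK D∉K) λ {w} w∈ →
      [ (λ w∈D → ∈-++⁺ˡ (D⊆T w∈D)) , (λ w∈K → in-rest w w∈K) ]′ (∈-++⁻ D w∈))
      where
      in-rest : ∀ w → w ∈ K → w ∈ T ++ rest
      in-rest w w∈K with w ∈? T
      ... | yes w∈T = ∈-++⁺ˡ w∈T
      ... | no w∉T  = ∈-++⁺ʳ T (∈-filter⁺ (λ w → ¬? (w ∈? T)) w∈K w∉T)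

  -- The path alternates between the two completely joined lists; `D` collects the `length S`
  -- vertices of `Z` that it uses.
  interleave : ∀ s S Z → Uniq (s ∷ S) → Uniq Z → (∀ {x} → x ∈ s ∷ S → x ∈ K) → (∀ {z} → z ∈ Z → z ∉ K) →
               (∀ {x z} → x ∈ s ∷ S → z ∈ Z → Edge G z x) → length S ≤ length Z →
               ∃[ s′ ] ∃[ L ] ∃[ D ] (Path G s s′ L × Uniq L × s′ ∈ s ∷ S × (∀ {w} → w ∈ L → w ∈ s ∷ S ⊎ w ∈ D) ×
                                      (∀ {w} → w ∈ D → w ∈ Z) × (∀ {w} → w ∈ D → w ∈ L) × Uniq D × length D ≡ length S)
  interleave s [] Z uS uZ S⊆ Z∉ adj′ le =
    s , [ s ] , [] , stop , Uniq-[x] , here refl , (λ { (here eq) → inj₁ (here eq) }) , (λ ()) , (λ ()) , Uniq-[] , refl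
  interleave s (x ∷ S) [] uS uZ S⊆ Z∉ adj′ ()
  interleave s (x ∷ S) (z ∷ Z) uS uZ S⊆ Z∉ adj′ (s≤s le)
    with interleave x S Z (Uniq-tail uS) (Uniq-tail uZ) (S⊆ ∘ there) (Z∉ ∘ there) (λ a b → adj′ (there a) (there b)) le
  ... | s′ , L , D , p , uL , s′∈ , L⊆ , D⊆Z , D⊆L , uD , len =
    s′ , s ∷ z ∷ L , z ∷ D , sym-edge G (adj′ (here refl) (here refl)) ◂ adj′ (there (here refl)) (here refl) ◂ p
    , Uniq-∷ s∉ (Uniq-∷ z∉ uL) , there s′∈
    , (λ { (here eq) → inj₁ (here eq) ; (there (here eq)) → inj₂ (here eq) ; (there (there w∈)) → map⊎ there there (L⊆ w∈) })
    , (λ { (here eq) → here eq ; (there w∈) → there (D⊆Z w∈) })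
    , (λ { (here eq) → there (here eq) ; (there w∈) → there (there (D⊆L w∈)) })
    , Uniq-∷ (λ z∈D → Uniq-head uZ (D⊆Z z∈D)) uD , cong suc len
    where
    z∉ : z ∉ L
    z∉ z∈ = [ (λ z∈S → Z∉ (here refl) (S⊆ (there z∈S))) , (λ z∈D → Uniq-head uZ (D⊆Z z∈D)) ]′ (L⊆ z∈)
    s∉ : s ∉ z ∷ L
    s∉ (here refl) = Z∉ (here refl) (S⊆ (here refl))
    s∉ (there s∈)  = [ Uniq-head uS , (λ s∈D → Z∉ (there (D⊆Z s∈D)) (S⊆ (here refl))) ]′ (L⊆ s∈)

  outside-closed : Closed (outside K)
  outside-closed = outside-∉ K , λ _ y∉ _ → ∉-outside K y∉

  extremal-in : ∀ {D d} → Closed D → d ∈ D → ∃[ u ] ∃[ v ] ∃[ P ] Ext D u v P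
  extremal-in {D} closed d∈ with maxK (proj₁ closed d∈)
  ... | x , x∈ , ¬e = extremal K D x∈ d∈ (λ { refl → proj₁ closed d∈ x∈ }) ¬e

  module _ (S : List V) where

    -- The description to be proved for all outside vertices. It is decidable, so a first violation
    -- on a path can be singled out.
    record Good (w : V) : Set where
      field
        degree-k : deg G w (allFin n) ≡ k
        twins  : Twins w
        K-nbr⊆ : ∀ x → x ∈ K → Edge G w x → x ∈ S
        S-nbr  : ∀ x → x ∈ S → Edge G w x

    infixr 2 _⇒?_
    _⇒?_ : ∀ {A B : Set} → Dec A → Dec B → Dec (A → B)
    _⇒?_ = _→-dec_

    good? : ∀ w → Dec (Good w)
    good? w = map′ (λ { (d , t , s , s′) → record { degree-k = d ; twins = t ; K-nbr⊆ = s ; S-nbr = s′ } })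
                   (λ g → Good.degree-k g , Good.twins g , Good.K-nbr⊆ g , Good.S-nbr g)
      ((deg G w (allFin n) ≟ k)
        ×-dec all? (λ y → ¬? (y ∈? K) ⇒? edge? G w y ⇒? all? λ x → ¬? (x ≟F w) ⇒? ¬? (x ≟F y) ⇒? (adj G y x ≟ᵇ adj G w x))
        ×-dec all? (λ x → (x ∈? K) ⇒? edge? G w x ⇒? (x ∈? S))
        ×-dec all? (λ x → (x ∈? S) ⇒? edge? G w x))

    -- Adjacent twins have equal closed neighbourhoods, hence the same degree and the same
    -- neighbours in `K`. So both `Good` and its failure are constant on components.
    good-spread : (∀ {x} → x ∈ S → x ∈ K) → ∀ {x y} → x ∉ K → y ∉ K → Edge G x y → Good y → Good x
    good-spread S⊆K {x} {y} x∉ y∉ e g = record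
      { degree-k = trans (+-cancelʳ-≡ _ _ _ (trans total (cong (deg G y (allFin n) +_) ones))) degree-k
      ; twins = tw
      ; K-nbr⊆ = λ z z∈K ez → K-nbr⊆ z z∈K (trans (sym (same z (λ { refl → x∉ z∈K }) (λ { refl → y∉ z∈K }))) ez)
      ; S-nbr = λ z z∈S → trans (same z (λ { refl → x∉ (S⊆K z∈S) }) (λ { refl → y∉ (S⊆K z∈S) })) (S-nbr z z∈S)
      }
      where
      open Good g
      same : ∀ z → z ≢ x → z ≢ y → adj G x z ≡ adj G y z
      same z z≢x z≢y = twins x x∉ (sym-edge G e) z z≢y z≢x
      tw : Twins x
      tw z z∉ ez q q≢x q≢z with q ≟F y | z ≟F y
      ... | yes refl | yes refl = ⊥-elim (q≢z refl)
      ... | no q≢y   | yes refl = sym (same q q≢x q≢y)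
      ... | yes refl | no z≢y   = trans (sym-edge G (trans (sym (same z (λ { refl → irrefl G ez refl }) z≢y)) ez)) (sym e)
      ... | no q≢y   | no z≢y   = trans (twins z z∉ (trans (sym (same z (λ { refl → irrefl G ez refl }) z≢y)) ez) q q≢y q≢z)
                                        (sym (same q q≢x q≢y))
      -- Adding the vertex itself to its neighbourhood makes the two neighbourhoods equal.
      closed-nbhd : ∀ z → ind (adj G x z) + δ x z ≡ ind (adj G y z) + δ y z
      closed-nbhd z with x ≟F z | y ≟F z
      ... | yes refl | yes refl = ⊥-elim (irrefl G e refl)
      ... | yes refl | no _ rewrite adj-irr G x | sym-edge G e = refl
      ... | no _ | yes refl rewrite adj-irr G y | e = refl
      ... | no x≢z | no y≢z = cong (λ b → ind b + 0) (same z (≢-sym x≢z) (≢-sym y≢z))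
      one : ∀ z → count z (allFin n) ≡ 1
      one z = ≤-antisym (count≤1 Uniq-allFin z) (∈⇒count (∈-allFin z))
      ones : count y (allFin n) ≡ count x (allFin n)
      ones = trans (one y) (sym (one x))
      total : deg G x (allFin n) + count x (allFin n) ≡ deg G y (allFin n) + count y (allFin n)
      total = trans (sym (Σₗ-+ _ (δ x) (allFin n))) (trans (Σₗ-cong (allFin n) (λ {z} _ → closed-nbhd z)) (Σₗ-+ _ (δ y) (allFin n)))

  -- The set `S` read off from one longest path into the complement of the clique

  module Longest {u v : V} {P : List V} (ext : Ext (outside K) u v P) where

    open EndFacts outside-closed ext

    S : List V
    S = filter (edge? G v) K

    S⊆K : ∀ {x} → x ∈ S → x ∈ K
    S⊆K x∈ = proj₁ (∈-filter⁻ (edge? G v) {xs = K} x∈)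

    S-nbr-v : ∀ {x} → x ∈ S → Edge G v x
    S-nbr-v x∈ = proj₂ (∈-filter⁻ (edge? G v) {xs = K} x∈)

    ∈S : ∀ {x} → x ∈ K → Edge G v x → x ∈ S
    ∈S x∈ e = ∈-filter⁺ (edge? G v) x∈ e

    unS : Uniq S
    unS = Uniq-filter _ unK

    good-end : ∀ {z P′} → Ext (outside K) u z P′ → (∀ {w} → w ∈ K → (Edge G v w → Edge G z w) × (Edge G z w → Edge G v w)) → Good S z
    good-end ext′ h = record
      { degree-k = EndFacts.degree≡k outside-closed ext′
      ; twins = end-twins outside-closed ext′
      ; K-nbr⊆ = λ x x∈ e → ∈S x∈ (proj₂ (h x∈) e)
      ; S-nbr = λ x x∈ → proj₁ (h (S⊆K x∈)) (S-nbr-v x∈) }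

    good-v : Good S v
    good-v = good-end ext (λ _ → id , id)

    -- A rotation at the exit makes `z` an end, and by `rotate-K` it sees the same clique vertices
    -- as `v`.
    good-exit : ∀ A {x z B} → P ≡ A ++ x ∷ z ∷ B → x ∈ K → z ∉ K → Good S z
    good-exit A eq x∈K z∉K = good-end (rotate ext eq e z∈) (rotate-K outside-closed ext eq e z∈ x∈K)
      where
      e  = exit A eq x∈K z∉K
      z∈ = ∉-outside K z∉K

    -- It meets at least `k - 1` outside vertices, all that `few-outside` allows; extending it to a
    -- clique vertex through one more outside vertex is contradictory.
    Chain : V → Set
    Chain s = ∃[ s′ ] ∃[ L ] ∃[ D ] (Path G s s′ L × Uniq L × s′ ∈ S × (∀ {w} → w ∈ L → w ∈ S ⊎ (w ∉ K × Good S w)) ×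
                (∀ {w} → w ∈ D → w ∉ K) × (∀ {w} → w ∈ D → w ∈ L) × Uniq D × k ≤ suc (length D))

    degree-bound : ∀ {w L} → Good S w → Uniq L → deg G w L ≤ k
    degree-bound {w} {L} g u = subst (deg G w L ≤_) (Good.degree-k g) (Σₗ-⊆ _ L (allFin n) u (λ {x} _ _ → ∈-allFin x))

    S≤k : length S ≤ k
    S≤k = subst (_≤ k) (deg-all G S S-nbr-v) (degree-bound good-v unS)

    isolated : length S ≡ k → ∀ {w z} → Good S w → z ∉ K → ¬ Edge G w z
    isolated eq {w} {z} g z∉ e = 1+n≰n (≤-trans (s≤s (≤-reflexive (sym eq))) (subst (_≤ k)
      (deg-all G (z ∷ S) λ { (here refl) → e ; (there x∈) → Good.S-nbr g _ x∈ })
      (degree-bound g (Uniq-∷ (λ z∈S → z∉ (S⊆K z∈S)) unS))))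

    Dichotomy : Set
    Dichotomy = (length S ≡ 2 × (∀ {s} → s ∈ S → Chain s)) ⊎ length S ≡ k

    -- If `S` consists of `a` and `l` only, at least `k - 2` neighbours of `v` lie in `Q`, so `l`,
    -- `Q`, `a` is a chain. A third vertex of `S` is followed on `P` by an outside vertex all of
    -- whose `k` neighbours lie in `S`, whence `length S = k`.
    dichotomy′ : Dichotomy
    dichotomy′ with last-run outside-closed ext
    ... | P₀ , l , Q , ends , Q∉K , l∈K = go (first-split (λ x → ¬? (x ≟F a) ×-dec ¬? (x ≟F l)) S)
      where
      open Ends₂ outside-closed ext {P₀} {l} {Q} ends l∈K Q∉K
      a∈S : a ∈ S
      a∈S = ∈S a∈K va
      l∈S : l ∈ S
      l∈S = ∈S l∈K l-nbr
      goodQ : ∀ {y} → y ∈ Q → Good S y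
      goodQ y∈ = good-end (At.ext′ y∈) (λ w∈K → K-transfer v∈Q y∈ w∈K , K-transfer y∈ v∈Q w∈K)
      unQ : Uniq Q
      unQ = Uniq-++⁻ʳ (P₀ ++ [ l ]) (subst Uniq ends′ unique)

      module Two (S⊆ : ∀ {x} → x ∈ S → x ∈ a ∷ l ∷ []) where
        S≡2 : length S ≡ 2
        S≡2 = ≤-antisym (length-⊆ S (a ∷ l ∷ []) unS S⊆)
          (length-⊆ (a ∷ l ∷ []) S (Uniq-∷ (λ { (here eq) → a≢l eq }) Uniq-[x]) λ { (here refl) → a∈S ; (there (here refl)) → l∈S })
        Q-large : k ≤ suc (length Q)
        Q-large = begin
          k                          ≡⟨ degree≡k ⟨
          deg G v (allFin n)         ≤⟨ Σₗ-⊆ _ (allFin n) (S ++ Q) Uniq-allFin (λ {x} _ nz → inSQ x (ind≢0 G nz)) ⟩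
          deg G v (S ++ Q)           ≡⟨ Σₗ-++ _ S Q ⟩
          deg G v S + deg G v Q      ≤⟨ +-monoˡ-≤ _ (≤-trans (deg≤length G v S) (≤-reflexive S≡2)) ⟩
          2 + deg G v Q              ≤⟨ s≤s (deg-∈ G v∈Q) ⟩
          suc (length Q)             ∎
          where
          open ≤-Reasoning
          inSQ : ∀ x → Edge G v x → x ∈ S ++ Q
          inSQ x e with x ∈? K
          ... | yes x∈K = ∈-++⁺ˡ (∈S x∈K e)
          ... | no x∉K  = ∈-++⁺ʳ S (nbr∈Q v∈Q x∉K e)
        L : List V
        L = (l ∷ Q) ++ [ a ]
        pL : Path G l a L
        pL = path-++ (proj₂ (path-split P₀ (subst (Path G u v) ends path))) va stop
        a∉lQ : a ∉ l ∷ Q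
        a∉lQ a∈ = Uniq-disjoint P₀ (subst Uniq ends unique) a∈P₀ a∈
        unL : Uniq L
        unL = Uniq-++ (l ∷ Q) (Uniq-++⁻ʳ P₀ (subst Uniq ends unique)) Uniq-[x] (λ { x∈ (here refl) → a∉lQ x∈ })
        L⊆ : ∀ {w} → w ∈ L → w ∈ S ⊎ (w ∉ K × Good S w)
        L⊆ w∈ with ∈-++⁻ (l ∷ Q) w∈
        ... | inj₁ (here refl)  = inj₁ l∈S
        ... | inj₁ (there w∈Q)  = inj₂ (All.lookup Q∉K w∈Q , goodQ w∈Q)
        ... | inj₂ (here refl)  = inj₁ a∈S
        Q⊆L : ∀ {w} → w ∈ Q → w ∈ L
        Q⊆L w∈ = ∈-++⁺ˡ {xs = l ∷ Q} (there w∈)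
        chain : ∀ {s} → s ∈ S → Chain s
        chain s∈ with S⊆ s∈
        ... | there (here refl) = a , L , Q , pL , unL , a∈S , L⊆ , All.lookup Q∉K , Q⊆L , unQ , Q-large
        ... | here refl = l , reverse L , Q , path-reverse pL , Uniq-reverse unL , l∈S , (λ w∈ → L⊆ (reverse⁻ w∈))
                        , All.lookup Q∉K , (λ w∈ → reverse⁺ (Q⊆L w∈)) , unQ , Q-large

      -- The vertex after a third clique neighbour x is a singleton component attached to all of S.
      singleton : ∀ {x} → x ∈ S → x ≢ a → x ≢ l → length S ≡ k
      singleton {x} x∈S x≢a x≢l with ∈-++⁻ P₀ (K∈prefix (S⊆K x∈S))
      ... | inj₂ (here eq) = ⊥-elim (x≢l eq)
      ... | inj₁ x∈P₀ with ∈-∃++ x∈P₀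
      ...   | A , [] , eqP = ⊥-elim (succ∉K A (trans ends (trans (cong (_++ l ∷ Q) eqP) (++-assoc A [ x ] (l ∷ Q)))) (S-nbr-v x∈S) l∈K)
      ...   | A , z ∷ B , eqP with next-in-prefix (subst (z ∈_) (sym eqP) (∈-++⁺ʳ A (there (here refl))))
      ...     | A′ , z′ , B′ , eq′ = ≤-antisym S≤k (subst₂ _≤_ (Good.degree-k good-z) refl
                  (≤-trans (Σₗ-⊆ _ (allFin n) S Uniq-allFin (λ {w} _ nz → nbr-z w (ind≢0 G nz))) (deg≤length G z S)))
        where
        eqz : P ≡ A ++ x ∷ z ∷ B ++ l ∷ Q
        eqz = trans ends (trans (cong (_++ l ∷ Q) eqP) (++-assoc A (x ∷ z ∷ B) (l ∷ Q)))
        z∉K : z ∉ K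
        z∉K = succ∉K A eqz (S-nbr-v x∈S)
        z∈P₀ : z ∈ P₀
        z∈P₀ = subst (z ∈_) (sym eqP) (∈-++⁺ʳ A (there (here refl)))
        eqz′ : P ≡ A′ ++ z ∷ z′ ∷ B′ ++ Q
        eqz′ = trans ends′ (trans (cong (_++ Q) eq′) (++-assoc A′ (z ∷ z′ ∷ B′) Q))
        good-z : Good S z
        good-z = good-exit A eqz (S⊆K x∈S) z∉K
        same-tail : (A ++ [ x ]) ≡ A′ × (B ++ l ∷ Q) ≡ z′ ∷ B′ ++ Q
        same-tail = uniq-split (A ++ [ x ]) A′ (subst Uniq (trans eqz (sym (++-assoc A [ x ] _))) unique)
          (trans (++-assoc A [ x ] (z ∷ B ++ l ∷ Q)) (trans (sym eqz) eqz′))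
        z∉M : z ∉ M
        z∉M z∈M with ∈-++⁻ X before
          where
          shift : A ++ x ∷ z ∷ B ++ l ∷ Q ≡ (A ++ [ x ]) ++ z ∷ B ++ l ∷ Q
          shift = sym (++-assoc A [ x ] (z ∷ B ++ l ∷ Q))
          before : x ∈ X ++ a ∷ M
          before = prefix-closed (A ++ [ x ]) (X ++ a ∷ M) (subst Uniq (trans eqz shift) unique)
            (trans (sym (trans eqz shift)) shape′) (∈-++⁺ʳ X (there z∈M)) (∈-++⁺ʳ A (here refl))
        ... | inj₂ (here eq)   = x≢a eq
        ... | inj₂ (there x∈M) = M∉K x∈M (S⊆K x∈S)
        ... | inj₁ x∈X = case ∈-∃++ x∈X of λ { (X₁ , X₂ , eqX) → after-X X₁ X₂ eqX }
          where
          after-X : ∀ X₁ X₂ → X ≡ X₁ ++ x ∷ X₂ → ⊥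
          after-X X₁ X₂ eqX = Uniq-disjoint (X ++ [ a ]) (subst Uniq (trans shape (sym (++-assoc X [ a ] _))) unique) (z∈Xa X₂ eqX tails) (∈-++⁺ˡ z∈M)
            where
            tails : z ∷ B ++ l ∷ Q ≡ X₂ ++ a ∷ M ++ b ∷ Y
            tails = proj₂ (uniq-split A X₁ (subst Uniq eqz unique)
              (trans (sym eqz) (trans shape (trans (cong (_++ a ∷ M ++ b ∷ Y) eqX) (++-assoc X₁ (x ∷ X₂) _)))))
            z∈Xa : ∀ X₂ → X ≡ X₁ ++ x ∷ X₂ → z ∷ B ++ l ∷ Q ≡ X₂ ++ a ∷ M ++ b ∷ Y → z ∈ X ++ [ a ]
            z∈Xa []       _   eq = ∈-++⁺ʳ X (here (proj₁ (∷-injective eq)))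
            z∈Xa (y ∷ X₃) eqX eq = ∈-++⁺ˡ (subst (_∈ X) (sym (proj₁ (∷-injective eq))) (subst (y ∈_) (sym eqX) (∈-++⁺ʳ X₁ (there (here refl)))))
        -- The pair `z`, `z′` must be covered. As `v` is not adjacent to `z` and `z` is not in the
        -- gap, `u` is adjacent to `z′`.
        z′∈K : z′ ∈ K
        z′∈K with linked-at A′ (subst (Linked _) eqz′ covered)
        ... | inj₁ e = ⊥-elim (outer-nonadjacent z∈P₀ z∉K e)
        ... | inj₂ (inj₁ e) = u-nbr∈K (inP (A′ ++ [ z ]) (trans eqz′ (sym (++-assoc A′ [ z ] (z′ ∷ B′ ++ Q))))) e
        ... | inj₂ (inj₂ (z∈M , _)) = ⊥-elim (z∉M z∈M)
        rotated : A ++ x ∷ reverse (z ∷ B ++ l ∷ Q) ≡ (A ++ x ∷ reverse (B′ ++ Q)) ++ z′ ∷ z ∷ []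
        rotated = begin
          A ++ x ∷ reverse (z ∷ B ++ l ∷ Q)
            ≡⟨ cong (λ R → A ++ x ∷ reverse (z ∷ R)) (proj₂ same-tail) ⟩
          A ++ x ∷ reverse (z ∷ z′ ∷ B′ ++ Q)
            ≡⟨ cong (λ R → A ++ x ∷ R) (trans (unfold-reverse z (z′ ∷ B′ ++ Q)) (cong (_++ [ z ]) (unfold-reverse z′ (B′ ++ Q)))) ⟩
          A ++ x ∷ (reverse (B′ ++ Q) ++ [ z′ ]) ++ [ z ]
            ≡⟨ cong (λ R → A ++ x ∷ R) (++-assoc (reverse (B′ ++ Q)) [ z′ ] [ z ]) ⟩
          A ++ x ∷ reverse (B′ ++ Q) ++ z′ ∷ z ∷ []
            ≡⟨ ++-assoc A (x ∷ reverse (B′ ++ Q)) (z′ ∷ z ∷ []) ⟨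
          (A ++ x ∷ reverse (B′ ++ Q)) ++ z′ ∷ z ∷ [] ∎
          where open ≡-Reasoning
        nbr-z : ∀ w → Edge G z w → w ∈ S
        nbr-z w e with w ∈? K
        ... | yes w∈K = Good.K-nbr⊆ good-z w w∈K e
        ... | no w∉K with Ends₂.nbr∈Q outside-closed (rotate ext eqz (S-nbr-v x∈S) (∉-outside K z∉K))
                            {A ++ x ∷ reverse (B′ ++ Q)} {z′} {[ z ]} rotated z′∈K (z∉K ∷ []) (here refl) w∉K e
        ...   | here refl = ⊥-elim (irrefl G e refl)

      go : All (λ x → ¬ (x ≢ a × x ≢ l)) S ⊎ ∃[ A ] ∃[ x ] ∃[ B ] (S ≡ A ++ x ∷ B × All (λ x → ¬ (x ≢ a × x ≢ l)) A × x ≢ a × x ≢ l) → Dichotomy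
      go (inj₂ (A , x , B , eq , _ , x≢a , x≢l)) = inj₂ (singleton (subst (x ∈_) (sym eq) (∈-insert A)) x≢a x≢l)
      go (inj₁ none) = inj₁ (Two.S≡2 S⊆ , Two.chain S⊆)
        where
        S⊆ : ∀ {x} → x ∈ S → x ∈ a ∷ l ∷ []
        S⊆ {x} x∈ with x ≟F a | x ≟F l
        ... | yes eq | _      = here eq
        ... | no _   | yes eq = there (here eq)
        ... | no p   | no q   = ⊥-elim (All.lookup none x∈ (p , q))

    abstract
      dichotomy : Dichotomy
      dichotomy = dichotomy′

    module Singletons (S≡k : length S ≡ k) where

      -- The predecessor of the first violating outside vertex would be either in `K`, where
      -- `good-exit` applies, or a good outside vertex, whose `k` neighbours are exhausted by `S`.
      on-path : ∀ {z} → z ∈ P → z ∉ K → Good S z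
      on-path {z} z∈ z∉ with first-split (λ w → ¬? (w ∈? K) ×-dec ¬? (good? S w)) P
      ... | inj₁ none = decidable-stable (good? S z) λ bad → All.lookup none z∈ (z∉ , bad)
      ... | inj₂ ([] , w , B , eq , _ , w∉ , _) = ⊥-elim (w∉ (subst (_∈ K) (path-head≡ (subst (Path G u v) eq path)) u∈K))
      ... | inj₂ (r ∷ A , w , B , eq , none , w∉ , bad) with snoc r A
      ...   | A₁ , x , eqA with x ∈? K
      ...     | yes x∈ = ⊥-elim (bad (good-exit A₁ (trans eq (trans (cong (_++ w ∷ B) eqA) (++-assoc A₁ [ x ] (w ∷ B)))) x∈ w∉))
      ...     | no x∉  = ⊥-elim (isolated S≡k good-x w∉
                  (proj₁ (proj₂ (path-cut A₁ (subst (Path G u v) (trans eq (trans (cong (_++ w ∷ B) eqA) (++-assoc A₁ [ x ] (w ∷ B)))) path)))))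
        where
        good-x : Good S x
        good-x = decidable-stable (good? S x) λ b → All.lookup none (subst (x ∈_) (sym eqA) (∈-++⁺ʳ A₁ (here refl))) (x∉ , b)

      Z : List V
      Z = filter (λ w → ¬? (w ∈? K)) P

      Z-∈ : ∀ {w} → w ∈ Z → w ∈ P × w ∉ K
      Z-∈ = ∈-filter⁻ (λ w → ¬? (w ∈? K)) {xs = P}

      Z-good : ∀ {w} → w ∈ Z → Good S w
      Z-good w∈ = on-path (proj₁ (Z-∈ w∈)) (proj₂ (Z-∈ w∈))

      k≤Z : k ≤ length Z
      k≤Z = linear 0 (+-mono-≤ (+-mono-≤ long covers) (≤-reflexive size)) (lem k (length P) (length Z) (length K) c)
        where
        lem : ∀ k p z r c → k + (p + (z + r) + suc c) + 0 ≡ z + (suc c + p + (k + r))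
        lem = solve-∀
        covers : length P ≤ length Z + length K
        covers = subst (length P ≤_) (length-++ Z) (length-⊆ P (Z ++ K) unique λ {w} w∈ → cover′ w w∈)
          where
          cover′ : ∀ w → w ∈ P → w ∈ Z ++ K
          cover′ w w∈ with w ∈? K
          ... | yes w∈K = ∈-++⁺ʳ Z w∈K
          ... | no w∉K  = ∈-++⁺ˡ (∈-filter⁺ (λ w → ¬? (w ∈? K)) w∈ w∉K)

      alternate : ∀ s S′ → Uniq (s ∷ S′) → (∀ {x} → x ∈ s ∷ S′ → x ∈ S) → suc (length S′) ≤ k →
                  ∃[ s′ ] ∃[ L ] ∃[ D ] (Path G s s′ L × Uniq L × s′ ∈ s ∷ S′ × (∀ {w} → w ∈ L → w ∈ s ∷ S′ ⊎ w ∈ D) ×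
                                         (∀ {w} → w ∈ D → w ∈ Z) × (∀ {w} → w ∈ D → w ∈ L) × Uniq D × length D ≡ length S′)
      alternate s S′ un ⊆S le = interleave s S′ Z un (Uniq-filter _ unique) (S⊆K ∘ ⊆S) (proj₂ ∘ Z-∈)
        (λ x∈ z∈ → Good.S-nbr (Z-good z∈) _ (⊆S x∈)) (≤-trans (<⇒≤ le) k≤Z)

      -- All `k` vertices of `S` are interleaved with `k - 1` outside vertices of `P`, of which
      -- there are at least `k` because `P` has more than `c` vertices.
      chain : ∀ {s} → s ∈ S → Chain s
      chain {s} s∈ with ∈-∃++ s∈
      ... | A , B , eq with alternate s (A ++ B) un ⊆S (≤-reflexive (trans len S≡k))
        where
        len : suc (length (A ++ B)) ≡ length S
        len = trans (cong suc (length-++ A)) (sym (trans (cong length eq) (trans (length-++ A) (+-suc (length A) (length B)))))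
        un : Uniq (s ∷ A ++ B)
        un = Uniq-∷ (Uniq-middle A (subst Uniq eq unS)) (Uniq-remove A (subst Uniq eq unS))
        ⊆S : ∀ {x} → x ∈ s ∷ A ++ B → x ∈ S
        ⊆S (here refl) = s∈
        ⊆S (there x∈)  = subst (_ ∈_) (sym eq) (∈-weaken A x∈)
      ...   | s′ , L , D , p , uL , s′∈ , L⊆ , D⊆Z , D⊆L , uD , len′ =
        s′ , L , D , p , uL , ⊆S s′∈ , (λ w∈ → map⊎ ⊆S (λ w∈D → proj₂ (Z-∈ (D⊆Z w∈D)) , Z-good (D⊆Z w∈D)) (L⊆ w∈)) , (λ w∈ → proj₂ (Z-∈ (D⊆Z w∈)))
        , D⊆L , uD , ≤-reflexive (trans (sym S≡k) (trans len (cong suc (sym len′))))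
        where
        len : length S ≡ suc (length (A ++ B))
        len = trans (cong length eq) (trans (trans (length-++ A) (+-suc (length A) (length B))) (cong suc (sym (length-++ A))))
        ⊆S : ∀ {x} → x ∈ s ∷ A ++ B → x ∈ S
        ⊆S (here refl) = s∈
        ⊆S (there x∈)  = subst (_ ∈_) (sym eq) (∈-weaken A x∈)

    abstract
      chain : ∀ {s} → s ∈ S → Chain s
      chain = [ proj₂ , Singletons.chain ]′ dichotomy

    -- Outside vertices violating the description

    module Bad {D′ : List V} (closed′ : Closed D′) {u′ v′ : V} {P′ : List V} (ext′ : Ext D′ u′ v′ P′) (bad : ¬ Good S v′) where

      private
        v′∉K : v′ ∉ K
        v′∉K = EndFacts.v∉K closed′ ext′

        deg-v′ : deg G v′ (allFin n) ≡ k
        deg-v′ = EndFacts.degree≡k closed′ ext′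

        ∉chain : ∀ {L : List V} → (∀ {w} → w ∈ L → w ∈ S ⊎ (w ∉ K × Good S w)) → v′ ∉ L
        ∉chain L⊆ v′∈ = [ (λ v′∈S → v′∉K (S⊆K v′∈S)) , bad ∘ proj₂ ]′ (L⊆ v′∈)

        K∉chain : ∀ {L : List V} → (∀ {w} → w ∈ L → w ∈ S ⊎ (w ∉ K × Good S w)) → ∀ {w} → w ∈ K → w ∉ S → w ∉ L
        K∉chain L⊆ w∈K w∉S w∈L = [ w∉S , (λ h → proj₁ h w∈K) ]′ (L⊆ w∈L)

      -- Let `y` be a second clique neighbour of `v′`. The path from `x` through `v′` to `y`,
      -- continued by a chain (after one more clique edge if `y` is not in `S`), joins distinct
      -- clique vertices and meets at least `k` outside vertices, against `few-outside`.
      no-escape : ∀ {x} → x ∈ K → Edge G v′ x → x ∉ S → ⊥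
      no-escape {x} x∈K ex x∉S = finish second
        where
        second : ∃[ y ] (y ∈ K × y ≢ x × Edge G v′ y)
        second with two-K-nbrs closed′ ext′
        ... | p , q , p∈ , q∈ , p≢q , ep , eq with p ≟F x
        ...   | no p≢x   = p , p∈ , p≢x , ep
        ...   | yes refl = q , q∈ , ≢-sym p≢q , eq
        through-S : ∀ {y} → y ∈ S → Edge G v′ y → ⊥
        through-S y∈S ey =
          let s′ , L , D , p , uL , s′∈ , L⊆ , D∉K , D⊆L , uD , k≤ = chain y∈S
          in <⇒≱ (few-outside (sym-edge G ex ◂ ey ◂ p)
               (Uniq-∷ (λ { (here refl) → v′∉K x∈K ; (there x∈) → K∉chain L⊆ x∈K x∉S x∈ }) (Uniq-∷ (∉chain L⊆) uL))
               x∈K (S⊆K s′∈) (λ { refl → x∉S s′∈ })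
               (Uniq-∷ (λ v′∈D → ∉chain L⊆ (D⊆L v′∈D)) uD)
               (λ { (here refl) → v′∉K ; (there w∈) → D∉K w∈ })
               (λ { (here refl) → there (here refl) ; (there w∈) → there (there (D⊆L w∈)) })) k≤
        around-S : ∀ {y s} → y ∈ K → y ≢ x → Edge G v′ y → y ∉ S → s ∈ S → ⊥
        around-S {y} {s} y∈K y≢x ey y∉S s∈S =
          let s′ , L , D , p , uL , s′∈ , L⊆ , D∉K , D⊆L , uD , k≤ = chain s∈S
          in <⇒≱ (few-outside (sym-edge G ex ◂ ey ◂ clK y∈K (S⊆K s∈S) (λ { refl → y∉S s∈S }) ◂ p)
               (Uniq-∷ (λ { (here refl) → v′∉K x∈K ; (there (here refl)) → y≢x refl ; (there (there x∈)) → K∉chain L⊆ x∈K x∉S x∈ })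
               (Uniq-∷ (λ { (here refl) → v′∉K y∈K ; (there v′∈) → ∉chain L⊆ v′∈ }) (Uniq-∷ (K∉chain L⊆ y∈K y∉S) uL)))
               x∈K (S⊆K s′∈) (λ { refl → x∉S s′∈ })
               (Uniq-∷ (λ v′∈D → ∉chain L⊆ (D⊆L v′∈D)) uD)
               (λ { (here refl) → v′∉K ; (there w∈) → D∉K w∈ })
               (λ { (here refl) → there (here refl) ; (there w∈) → there (there (there (D⊆L w∈))) })) k≤
        finish : ∃[ y ] (y ∈ K × y ≢ x × Edge G v′ y) → ⊥
        finish (y , y∈K , y≢x , ey) with y ∈? S
        ... | yes y∈S = through-S y∈S ey
        ... | no y∉S  = let s , _ , s∈K , _ , _ , es , _ = two-K-nbrs outside-closed ext
                        in around-S y∈K y≢x ey y∉S (∈S s∈K es)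

      K-nbr∈S : ∀ {x} → x ∈ K → Edge G v′ x → x ∈ S
      K-nbr∈S {x} x∈K e = decidable-stable (x ∈? S) (no-escape x∈K e)

      complete-few : length S ≡ 2 → ∀ {s} → s ∈ S → ¬ ¬ Edge G v′ s
      complete-few S≡2 {s} s∈ ¬e =
        let p , q , p∈ , q∈ , p≢q , ep , eq = two-K-nbrs closed′ ext′ in 1+n≰n (subst (3 ≤_) S≡2 (length-⊆ (s ∷ p ∷ q ∷ []) S
        (Uniq-∷ (λ { (here refl) → ¬e ep ; (there (here refl)) → ¬e eq }) (Uniq-∷ (λ { (here e) → p≢q e }) Uniq-[x]))
        λ { (here refl) → s∈ ; (there (here refl)) → K-nbr∈S p∈ ep ; (there (there (here refl))) → K-nbr∈S q∈ eq }))

      no-outer-nbr : length S ≡ k → ∀ {s} → s ∈ S → ¬ Edge G v′ s → (∀ x → Edge G v′ x → x ∈ K) → ⊥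
      no-outer-nbr S≡k {s} s∈ ¬e nbr∈K = 1+n≰n (begin-strict
        k                          ≡⟨ deg-v′ ⟨
        deg G v′ (allFin n)        ≤⟨ Σₗ-⊆ _ (allFin n) S Uniq-allFin (λ {x} _ nz → K-nbr∈S (nbr∈K x (ind≢0 G nz)) (ind≢0 G nz)) ⟩
        deg G v′ S                 <⟨ missing (∈-∃++ s∈) ⟩
        length S                   ≡⟨ S≡k ⟩
        k                          ∎)
        where
        open ≤-Reasoning
        missing : ∃[ A ] ∃[ B ] S ≡ A ++ [ s ] ++ B → deg G v′ S < length S
        missing (A , B , eq) = begin-strict
          deg G v′ S                                   ≡⟨ trans (cong (deg G v′) eq) (Σₗ-insert _ A s B) ⟩
          ind (adj G v′ s) + deg G v′ (A ++ B)         ≡⟨ cong (_+ deg G v′ (A ++ B)) (ind-false G ¬e) ⟩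
          deg G v′ (A ++ B)                            ≤⟨ deg≤length G v′ (A ++ B) ⟩
          length (A ++ B)                              <⟨ ≤-reflexive (sym (length-insert A)) ⟩
          length (A ++ s ∷ B)                          ≡⟨ cong length eq ⟨
          length S                                     ∎

      module OuterNbr (S≡k : length S ≡ k) {g x y : V} (g∉K : g ∉ K) (eg : Edge G v′ g) (x∈K : x ∈ K) (ex : Edge G v′ x)
                      (y∈K : y ∈ K) (ey : Edge G v′ y) {A B A′ B′ : List V} (eqS : S ≡ A ++ x ∷ B) (eqS′ : A ++ B ≡ A′ ++ y ∷ B′) where

        open Singletons S≡k

        unAB : Uniq (A′ ++ y ∷ B′)
        unAB = subst Uniq eqS′ (Uniq-remove A (subst Uniq eqS unS))

        un : Uniq (y ∷ A′ ++ B′)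
        un = Uniq-∷ (Uniq-middle A′ unAB) (Uniq-remove A′ unAB)

        ⊆S : ∀ {w} → w ∈ y ∷ A′ ++ B′ → w ∈ S × w ≢ x
        ⊆S {w} w∈ = subst (w ∈_) (sym eqS) (∈-weaken A w∈AB) , λ { refl → Uniq-middle A (subst Uniq eqS unS) w∈AB }
          where
          back : w ∈ y ∷ A′ ++ B′ → w ∈ A′ ++ y ∷ B′
          back (here refl) = ∈-insert A′
          back (there h)   = ∈-weaken A′ h
          w∈AB : w ∈ A ++ B
          w∈AB = subst (w ∈_) (sym eqS′) (back w∈)

        len : suc (suc (length (A′ ++ B′))) ≡ k
        len = trans (cong suc (sym (trans (cong length eqS′) (length-insert A′)))) (trans (sym (trans (cong length eqS) (length-insert A))) S≡k)

        gy : Edge G g y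
        gy = trans (end-twins closed′ ext′ g g∉K eg y (λ { refl → v′∉K y∈K }) (λ { refl → g∉K y∈K })) ey

        module _ {s′ : V} {L D : List V} (p : Path G y s′ L) (uL : Uniq L) (s′∈ : s′ ∈ y ∷ A′ ++ B′)
                 (L⊆ : ∀ {w} → w ∈ L → w ∈ y ∷ A′ ++ B′ ⊎ w ∈ D) (D⊆Z : ∀ {w} → w ∈ D → w ∈ Z) (D⊆L : ∀ {w} → w ∈ D → w ∈ L)
                 (uD : Uniq D) (lenD : length D ≡ length (A′ ++ B′)) where

          x∉L : x ∉ L
          x∉L x∈ = [ (λ h → proj₂ (⊆S h) refl) , (λ h → proj₂ (Z-∈ (D⊆Z h)) x∈K) ]′ (L⊆ x∈)

          v′∉L : v′ ∉ L
          v′∉L v′∈ = [ (λ h → v′∉K (S⊆K (proj₁ (⊆S h)))) , (λ h → bad (Z-good (D⊆Z h))) ]′ (L⊆ v′∈)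

          g∉L : g ∉ L
          g∉L g∈ = [ (λ h → g∉K (S⊆K (proj₁ (⊆S h)))) , (λ h → bad (good-spread S S⊆K v′∉K g∉K eg (Z-good (D⊆Z h)))) ]′ (L⊆ g∈)

          too-many : ⊥
          too-many = <⇒≱ (few-outside (sym-edge G ex ◂ eg ◂ gy ◂ p)
                 (Uniq-∷ (λ { (here refl) → v′∉K x∈K ; (there (here refl)) → g∉K x∈K ; (there (there x∈)) → x∉L x∈ })
                 (Uniq-∷ (λ { (here refl) → irrefl G eg refl ; (there v′∈) → v′∉L v′∈ }) (Uniq-∷ g∉L uL)))
                 x∈K (S⊆K (proj₁ (⊆S s′∈))) (≢-sym (proj₂ (⊆S s′∈)))
                 (Uniq-∷ (λ { (here refl) → irrefl G eg refl ; (there v′∈D) → v′∉L (D⊆L v′∈D) }) (Uniq-∷ (λ g∈D → g∉L (D⊆L g∈D)) uD))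
                 (λ { (here refl) → v′∉K ; (there (here refl)) → g∉K ; (there (there w∈)) → proj₂ (Z-∈ (D⊆Z w∈)) })
                 (λ { (here refl) → there (here refl) ; (there (here refl)) → there (there (here refl))
                    ; (there (there w∈)) → there (there (there (D⊆L w∈))) }))
              (≤-reflexive (trans (sym len) (cong (suc ∘ suc) (sym lenD))))

        contradictory : ⊥
        contradictory =
          let _ , _ , _ , p , uL , s′∈ , L⊆ , D⊆Z , D⊆L , uD , lenD = alternate y (A′ ++ B′) un (λ w∈ → proj₁ (⊆S w∈)) (<⇒≤ (≤-reflexive len))
          in too-many p uL s′∈ L⊆ D⊆Z D⊆L uD lenD

      -- Missing one of the `k` vertices of `S` forces an outside neighbour `g` of `v′`, which is
      -- its twin. The path `x`, `v′`, `g`, `y`, continued alternately through the rest of `S`,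
      -- meets `v′`, `g` and `k - 2` further outside vertices, one too many.
      complete-many : length S ≡ k → ∀ {s} → s ∈ S → ¬ ¬ Edge G v′ s
      complete-many S≡k {s} s∈ ¬e = no-outer-nbr S≡k s∈ ¬e λ g eg → decidable-stable (g ∈? K) λ g∉K →
        let x , y , x∈K , y∈K , x≢y , ex , ey = two-K-nbrs closed′ ext′
            A , B , eqS = ∈-∃++ (K-nbr∈S x∈K ex)
            A′ , B′ , eqS′ = ∈-∃++ (∈-remove A (subst (y ∈_) eqS (K-nbr∈S y∈K ey)) (≢-sym x≢y))
        in OuterNbr.contradictory S≡k g∉K eg x∈K ex y∈K ey {A} {B} {A′} {B′} eqS eqS′

      impossible : ⊥
      impossible = bad record
        { degree-k = deg-v′ ; twins = end-twins closed′ ext′ ; K-nbr⊆ = λ x → K-nbr∈S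
        ; S-nbr = λ s s∈ → decidable-stable (edge? G v′ s) ([ (λ h → complete-few (proj₁ h) s∈) , (λ h → complete-many h s∈) ]′ dichotomy) }

    -- By `good-spread` the violating vertices form a union of components. If there were any, a
    -- longest path from `K` into that union would end in a violating vertex, which `Bad` rules out.
    all-good : ∀ {w} → w ∉ K → Good S w
    all-good {w} w∉ = decidable-stable (good? S w) λ bad → contra (∈-filter⁺ bad? (∉-outside K w∉) bad)
      where
      bad? : ∀ x → Dec (¬ Good S x)
      bad? x = ¬? (good? S x)
      D : List V
      D = filter bad? (outside K)
      D-∈ : ∀ {x} → x ∈ D → x ∈ outside K × ¬ Good S x
      D-∈ = ∈-filter⁻ bad? {xs = outside K}
      D-closed : Closed D
      D-closed = (λ x∈ → outside-∉ K (proj₁ (D-∈ x∈)))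
               , λ x∈ y∉ e → ∈-filter⁺ bad? (∉-outside K y∉) λ g → proj₂ (D-∈ x∈) (good-spread S S⊆K (outside-∉ K (proj₁ (D-∈ x∈))) y∉ e g)
      contra : w ∈ D → ⊥
      contra w∈ = let _ , _ , _ , ext′ = extremal-in D-closed w∈ in Bad.impossible D-closed ext′ (proj₂ (D-∈ (Extremal.v∈B ext′)))

    S-size : length S ≡ 2 ⊎ length S ≡ k
    S-size = map⊎ proj₁ id dichotomy

-- Bijections from enumerations

module _ {n : ℕ} where

  private V = Fin n

  pos : V → List V → ℕ
  pos x []      = 0
  pos x (y ∷ L) with x ≟F y
  ... | yes _ = 0
  ... | no _  = suc (pos x L)

  pos-++ˡ : ∀ {x} A {B} → x ∈ A → pos x (A ++ B) < length A
  pos-++ˡ {x} (y ∷ A) x∈ with x ≟F y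
  ... | yes _ = s≤s z≤n
  pos-++ˡ {x} (y ∷ A) (here eq)   | no x≢y = ⊥-elim (x≢y eq)
  pos-++ˡ {x} (y ∷ A) (there x∈)  | no x≢y = s≤s (pos-++ˡ A x∈)

  pos-++ʳ : ∀ {x} A {B} → x ∉ A → pos x (A ++ B) ≡ length A + pos x B
  pos-++ʳ {x} []      x∉ = refl
  pos-++ʳ {x} (y ∷ A) x∉ with x ≟F y
  ... | yes eq = ⊥-elim (x∉ (here eq))
  ... | no _   = cong suc (pos-++ʳ A (x∉ ∘ there))

  pos<length : ∀ {x L} → x ∈ L → pos x L < length L
  pos<length {x} {L} x∈ = subst (λ M → pos x M < length L) (++-identityʳ L) (pos-++ˡ L x∈)

  lookup-pos : ∀ {x} L → x ∈ L → (i : Fin (length L)) → toℕ i ≡ pos x L → lookup L i ≡ x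
  lookup-pos {x} (y ∷ L) x∈ i eq with x ≟F y
  lookup-pos {x} (y ∷ L) x∈         fzero    eq | yes x≡y = sym x≡y
  lookup-pos {x} (y ∷ L) (here x≡y) (fsuc i) eq | no x≢y  = ⊥-elim (x≢y x≡y)
  lookup-pos {x} (y ∷ L) (there x∈) (fsuc i) eq | no x≢y  = lookup-pos L x∈ i (suc-injective eq)

  pos-lookup : ∀ L → Uniq L → (i : Fin (length L)) → pos (lookup L i) L ≡ toℕ i
  pos-lookup (y ∷ L) u fzero with y ≟F y
  ... | yes _ = refl
  ... | no h  = ⊥-elim (h refl)
  pos-lookup (y ∷ L) u (fsuc i) with lookup L i ≟F y
  ... | yes eq = ⊥-elim (Uniq-head u (subst (_∈ L) eq (∈-lookup i)))
  ... | no _   = cong suc (pos-lookup L (Uniq-tail u) i)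

  module Enumeration (L : List V) (unL : Uniq L) (all∈ : ∀ x → x ∈ L) where

    len : length L ≡ n
    len = ≤-antisym (length≤n unL) (subst (_≤ length L) length-allFin (length-⊆ (allFin n) L Uniq-allFin (λ {x} _ → all∈ x)))

    pos<n : ∀ x → pos x L < n
    pos<n x = subst (pos x L <_) len (pos<length (all∈ x))

    index : V → V
    index x = fromℕ< (pos<n x)

    toℕ-index : ∀ x → toℕ (index x) ≡ pos x L
    toℕ-index x = toℕ-fromℕ< (pos<n x)

    bijection : V ↔ V
    bijection = mk↔ₛ′ index (λ i → lookup L (cast (sym len) i))
      (λ i → toℕ-injective (trans (toℕ-index _) (trans (pos-lookup L unL (cast (sym len) i)) (toℕ-cast (sym len) i))))
      (λ x → lookup-pos L (all∈ x) _ (trans (toℕ-cast (sym len) (index x)) (toℕ-index x)))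

    index-≟ : ∀ x y → ⌊ index x ≟F index y ⌋ ≡ ⌊ x ≟F y ⌋
    index-≟ x y with x ≟F y | index x ≟F index y
    ... | yes _    | yes _ = refl
    ... | yes refl | no h  = ⊥-elim (h refl)
    ... | no _     | no _  = refl
    ... | no x≢y   | yes e = ⊥-elim (x≢y (trans (sym (lookup-pos L (all∈ x) _ (trans (toℕ-cast (sym len) (index x)) (toℕ-index x))))
                                     (trans (cong (λ i → lookup L (cast (sym len) i)) e)
                                            (lookup-pos L (all∈ y) _ (trans (toℕ-cast (sym len) (index y)) (toℕ-index y))))))

  <ᵇ-true : ∀ {a b} → a < b → (a <ᵇ b) ≡ true
  <ᵇ-true {a} {b} h with a <ᵇ b | <⇒<ᵇ h
  ... | true | _ = refl

  <ᵇ-false : ∀ {a b} → b ≤ a → (a <ᵇ b) ≡ false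
  <ᵇ-false {a} {b} h with a <ᵇ b in eq
  ... | false = refl
  ... | true  = ⊥-elim (<⇒≱ (<ᵇ⇒< a b (subst T (sym eq) tt)) h)

  ≤ᵇ-true : ∀ {a b} → a ≤ b → (a ≤ᵇ b) ≡ true
  ≤ᵇ-true {a} {b} h with a ≤ᵇ b | ≤⇒≤ᵇ h
  ... | true | _ = refl

  ≤ᵇ-false : ∀ {a b} → b < a → (a ≤ᵇ b) ≡ false
  ≤ᵇ-false {a} {b} h with a ≤ᵇ b in eq
  ... | false = refl
  ... | true  = ⊥-elim (<⇒≱ h (≤ᵇ⇒≤ a b (subst T (sym eq) tt)))

  pos-<ᵇ : ∀ A {B} x → (pos x (A ++ B) <ᵇ length A) ≡ ⌊ x ∈? A ⌋
  pos-<ᵇ A {B} x with x ∈? A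
  ... | yes x∈ = <ᵇ-true (pos-++ˡ A x∈)
  ... | no x∉  = <ᵇ-false (subst (length A ≤_) (sym (pos-++ʳ A x∉)) (m≤m+n _ _))

  pos-≤ᵇ : ∀ A {B} x → (length A ≤ᵇ pos x (A ++ B)) ≡ not ⌊ x ∈? A ⌋
  pos-≤ᵇ A {B} x with x ∈? A
  ... | yes x∈ = ≤ᵇ-false (pos-++ˡ A x∈)
  ... | no x∉  = ≤ᵇ-true (subst (length A ≤_) (sym (pos-++ʳ A x∉)) (m≤m+n _ _))

  -- Lists cut into clique blocks of equal size

  module _ (G : Graph n) (j : ℕ) where

    -- Blocks are consecutive and of size `suc j`, so that the position divided by `suc j` is the
    -- block number, as in `blk`.
    data Blocks : List V → Set where
      []    : Blocks []
      block : ∀ B {L} → length B ≡ suc j → (∀ {x y} → x ∈ B → y ∈ B → x ≡ y ⊎ Edge G x y) →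
              (∀ {x y} → x ∈ B → y ∈ L → ¬ Edge G x y) → (∀ {x} → x ∈ B → x ∈ L → ⊥) → Blocks L → Blocks (B ++ L)

    blocks-divide : ∀ {L} → Blocks L → suc j ∣ length L
    blocks-divide [] = suc j ∣0
    blocks-divide (block B {L} len _ _ _ bs) =
      subst (suc j ∣_) (sym (length-++ B)) (∣m∣n⇒∣m+n (subst (suc j ∣_) (sym len) ∣-refl) (blocks-divide bs))

    private
      first : ∀ {x B L} → length B ≡ suc j → x ∈ B → pos x (B ++ L) / suc j ≡ 0
      first {x} {B} {L} len x∈ = m<n⇒m/n≡0 (subst (pos x (B ++ L) <_) len (pos-++ˡ B x∈))

      later : ∀ {x B L} → length B ≡ suc j → x ∉ B → pos x (B ++ L) / suc j ≡ suc (pos x L / suc j)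
      later {x} {B} {L} len x∉ = begin
        pos x (B ++ L) / suc j               ≡⟨ cong (_/ suc j) (trans (pos-++ʳ B x∉) (cong (_+ pos x L) len)) ⟩
        (suc j + pos x L) / suc j            ≡⟨ m/n≡1+[m∸n]/n (m≤m+n (suc j) (pos x L)) ⟩
        suc ((suc j + pos x L ∸ suc j) / suc j) ≡⟨ cong (λ m → suc (m / suc j)) (m+n∸m≡n (suc j) (pos x L)) ⟩
        suc (pos x L / suc j)                ∎
        where open ≡-Reasoning

    blocks-sound : ∀ {L} → Blocks L → ∀ {x y} → x ∈ L → y ∈ L → pos x L / suc j ≡ pos y L / suc j → x ≡ y ⊎ Edge G x y
    blocks-sound (block B {L} len inside between dis bs) {x} {y} x∈ y∈ eq with x ∈? B | y ∈? B
    ... | yes x∈B | yes y∈B = inside x∈B y∈B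
    ... | yes x∈B | no y∉B  = ⊥-elim (0≢1+n (trans (sym (first {L = L} len x∈B)) (trans eq (later len y∉B))))
    ... | no x∉B  | yes y∈B = ⊥-elim (0≢1+n (trans (sym (first {L = L} len y∈B)) (trans (sym eq) (later len x∉B))))
    ... | no x∉B  | no y∉B  = blocks-sound bs ([ (λ h → ⊥-elim (x∉B h)) , id ]′ (∈-++⁻ B x∈)) ([ (λ h → ⊥-elim (y∉B h)) , id ]′ (∈-++⁻ B y∈))
                                (suc-injective (trans (sym (later len x∉B)) (trans eq (later len y∉B))))

    blocks-complete : ∀ {L} → Blocks L → ∀ {x y} → x ∈ L → y ∈ L → Edge G x y → pos x L / suc j ≡ pos y L / suc j
    blocks-complete (block B {L} len inside between dis bs) {x} {y} x∈ y∈ e with x ∈? B | y ∈? B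
    ... | yes x∈B | yes y∈B = trans (first {L = L} len x∈B) (sym (first {L = L} len y∈B))
    ... | yes x∈B | no y∉B  = ⊥-elim (between x∈B ([ (λ h → ⊥-elim (y∉B h)) , id ]′ (∈-++⁻ B y∈)) e)
    ... | no x∉B  | yes y∈B = ⊥-elim (between y∈B ([ (λ h → ⊥-elim (x∉B h)) , id ]′ (∈-++⁻ B x∈)) (sym-edge G e))
    ... | no x∉B  | no y∉B  = trans (later len x∉B) (trans (cong suc (blocks-complete bs ([ (λ h → ⊥-elim (x∉B h)) , id ]′ (∈-++⁻ B x∈))
                                ([ (λ h → ⊥-elim (y∉B h)) , id ]′ (∈-++⁻ B y∈)) e)) (sym (later len y∉B)))

-- The closure of the cycle

-- The structure of the edge-maximal graph with its longest paths forgotten, in the form used for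
-- the closure and for the isomorphisms.
record Layered {n : ℕ} (G : Graph n) (k : ℕ) (K S : List (Fin n)) : Set where
  field
    unK    : Uniq K
    unS    : Uniq S
    S⊆K    : ∀ {x} → x ∈ S → x ∈ K
    clique : ∀ {x y} → x ∈ K → y ∈ K → x ≢ y → Edge G x y
    deg≡k  : ∀ {w} → w ∉ K → deg G w (allFin n) ≡ k
    twin   : ∀ {w y x} → w ∉ K → y ∉ K → Edge G w y → x ≢ w → x ≢ y → adj G y x ≡ adj G w x
    K-nbr  : ∀ {w x} → w ∉ K → x ∈ K → Edge G w x → x ∈ S
    S-nbr  : ∀ {w x} → w ∉ K → x ∈ S → Edge G w x

module _ {n : ℕ} (G : Graph n) where

  private V = Fin n

  tabulate-path : ∀ m (g : Fin (suc m) → V) → (∀ i j → suc (toℕ i) ≡ toℕ j → Edge G (g i) (g j)) →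
                  ∃[ y ] (Path G (g fzero) y (tabulate g) × (∀ i → toℕ i ≡ m → g i ≡ y))
  tabulate-path zero    g h = g fzero , stop , λ { fzero _ → refl }
  tabulate-path (suc m) g h with tabulate-path m (g ∘ fsuc) (λ i j eq → h (fsuc i) (fsuc j) (cong suc eq))
  ... | y , p , last = y , h fzero (fsuc fzero) refl ◂ p , λ { fzero () ; (fsuc i) eq → last i (suc-injective eq) }

  cycle-path : ∀ c (C : Fin c → V) → IsCycle G c C → ∃[ x ] ∃[ y ] (Path G x y (tabulate C) × Edge G y x × Uniq (tabulate C))
  cycle-path (suc m) C (_ , inj , consec) with tabulate-path m C (λ i j eq → consec i j (inj₁ eq))
  ... | y , p , last = C fzero , y , p
      , subst (λ t → Edge G t (C fzero)) (last (fromℕ< (n<1+n m)) (toℕ-fromℕ< (n<1+n m)))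
          (consec (fromℕ< (n<1+n m)) fzero (inj₂ (cong suc (toℕ-fromℕ< (n<1+n m)) , refl)))
      , Uniq-tabulate C inj

  path-linked : ∀ {x y L} → Path G x y L → Linked (Edge G) L
  path-linked stop = [-]
  path-linked (e ◂ stop)    = e ∷ [-]
  path-linked (e ◂ e′ ◂ p) = e ∷ path-linked (e′ ◂ p)

module _ {n c : ℕ} (C : Fin c → Fin n) (H : Graph n) where

  degC≡deg : ∀ v → degC C H v ≡ deg H v (tabulate C)
  degC≡deg v = trans (sym (Σₗ≡sum _ (allFin c))) (go c id)
    where
    go : ∀ m (g : Fin m → Fin c) → Σₗ (λ i → ind (adj H v (C i))) (tabulate g) ≡ deg H v (tabulate (C ∘ g))
    go zero    g = refl
    go (suc m) g = cong (ind (adj H v (C (g fzero))) +_) (go m (g ∘ fsuc))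

module Closure {n c k : ℕ} {G Ĝ : Graph n} (G⊑Ĝ : G ⊑ Ĝ) (nl : NoLong Ĝ c) {K S : List (Fin n)} (layered : Layered Ĝ k K S)
               (size : k + length K ≡ suc c) (k<c/2 : suc k + suc k ≤ c) (large : n + k + 3 ≤ length K + length K) (c<n : c < n)
               (S-size : length S ≡ 2 ⊎ length S ≡ k) (2≤k : 2 ≤ k)
               (δ≥k : ∀ v → k ≤ deg G v (allFin n)) (dense : f n (k + 1) c < edgesIn G (allFin n))
               (C : Fin c → Fin n) (isC : IsCycle G c C) where

  open Layered layered
  private
    V = Fin n
    L : List V
    L = tabulate C

  -- `w` has at least `k` neighbours in `G` and exactly `k` in the larger graph, so none of them is
  -- new.
  agree : ∀ {w x} → w ∉ K → Edge Ĝ w x → Edge G w x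
  agree {w} {x} w∉ e = ind≢0 G λ eq → 1+n≰n (subst₂ _≤_ (ind-true Ĝ e) eq
    (Σₗ-tight (allFin n) (λ {y} _ → ind-mono y) (subst (_≤ deg G w (allFin n)) (sym (deg≡k w∉)) (δ≥k w)) (∈-allFin x)))
    where
    ind-mono : ∀ y → ind (adj G w y) ≤ ind (adj Ĝ w y)
    ind-mono y with adj G w y in eq
    ... | false = z≤n
    ... | true  = ≤-reflexive (sym (ind-true Ĝ (G⊑Ĝ eq)))

  deg≤all : ∀ {H} → H ⊑ Ĝ → ∀ v {M} → Uniq M → deg H v M ≤ deg Ĝ v (allFin n)
  deg≤all {H} h v {M} u = ≤-trans (deg-mono {G = H} {Ĝ} h v M) (Σₗ-⊆ _ M (allFin n) u (λ {x} _ _ → ∈-allFin x))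

  uniqC : Uniq L
  uniqC = Uniq-tabulate C (proj₁ (proj₂ isC))

  -- `x` is not in `S`, since `y` is joined to all of `S`. So the neighbours of `x` lie in `K`;
  -- there are at most `length K - 1 = c - k` of them, and `y` adds `k`.
  mixed-bound : ∀ {x y} → x ∈ K → y ∉ K → ¬ Edge Ĝ x y → deg Ĝ x (allFin n) + deg Ĝ y (allFin n) ≤ c
  mixed-bound {x} {y} x∈ y∉ ¬e = linear 0 (+-mono-≤ (+-mono-≤ degx (≤-reflexive (deg≡k y∉))) (≤-reflexive size))
      (lem (deg Ĝ x (allFin n)) (deg Ĝ y (allFin n)) (length K) k c)
    where
    lem : ∀ a b r k c → a + b + (r + k + suc c) + 0 ≡ c + (suc a + b + (k + r))
    lem = solve-∀
    inK : ∀ w → Edge Ĝ x w → w ∈ K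
    inK w e = decidable-stable (w ∈? K) λ w∉ → ¬e (sym-edge Ĝ (S-nbr y∉ (K-nbr w∉ x∈ (sym-edge Ĝ e))))
    degx : deg Ĝ x (allFin n) < length K
    degx = ≤-trans (s≤s (Σₗ-⊆ _ (allFin n) K Uniq-allFin (λ {w} _ nz → inK w (ind≢0 Ĝ nz)))) (deg-∈ Ĝ x∈)

  nonedge-bound : ∀ {x y} → x ≢ y → ¬ Edge Ĝ x y → deg Ĝ x (allFin n) + deg Ĝ y (allFin n) ≤ c
  nonedge-bound {x} {y} x≢y ¬e with x ∈? K | y ∈? K
  ... | yes x∈ | yes y∈ = ⊥-elim (¬e (clique x∈ y∈ x≢y))
  ... | yes x∈ | no y∉  = mixed-bound x∈ y∉ ¬e
  ... | no x∉  | yes y∈ = subst (_≤ c) (+-comm (deg Ĝ y (allFin n)) _) (mixed-bound y∈ x∉ (¬e ∘ sym-edge Ĝ))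
  ... | no x∉  | no y∉  = subst₂ (λ a b → a + b ≤ c) (sym (deg≡k x∉)) (sym (deg≡k y∉)) (≤-trans (+-mono-≤ (n≤1+n k) (n≤1+n k)) k<c/2)

  -- Degrees on the cycle are at most degrees in `Ĝ`, where nonadjacent vertices have degree sum at
  -- most `c`. Hence closure steps never leave `Ĝ`.
  eligible⇒edge : ∀ {H} → H ⊑ Ĝ → ∀ {x y} → x ≢ y → suc c ≤ degC C H x + degC C H y → Edge Ĝ x y
  eligible⇒edge {H} h {x} {y} x≢y le = decidable-stable (edge? Ĝ x y) λ ¬e → 1+n≰n (≤-trans le (≤-trans
    (≤-reflexive (cong₂ _+_ (degC≡deg C H x) (degC≡deg C H y)))
    (≤-trans (+-mono-≤ (deg≤all {H} h x uniqC) (deg≤all {H} h y uniqC)) (nonedge-bound x≢y ¬e))))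

  closure-step⊑ : ∀ {H H′} → ClosureStep C H H′ → H ⊑ Ĝ → H′ ⊑ Ĝ
  closure-step⊑ {H} {H′} (i , j , Ci≢Cj , _ , le , step≡) h {x} {y} e with adj H x y in eq | trans (sym (step≡ x y)) e
  ... | true  | _ = h eq
  ... | false | e′ with sameEdge-true (C i) (C j) x y e′
  ...   | inj₁ (refl , refl) = eligible⇒edge {H} h Ci≢Cj le
  ...   | inj₂ (refl , refl) = sym-edge Ĝ (eligible⇒edge {H} h Ci≢Cj le)

  closure⊑ : ∀ {H H′} → Star (ClosureStep C) H H′ → H ⊑ Ĝ → H′ ⊑ Ĝ
  closure⊑ ε h = h
  closure⊑ {H} (_◅_ {j = H₁} s ss) h = closure⊑ ss (closure-step⊑ {H} {H₁} s h)

  ⊑closure : ∀ {H H′} → Star (ClosureStep C) H H′ → H ⊑ H′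
  ⊑closure ε e = e
  ⊑closure ((_ , _ , _ , _ , _ , step≡) ◅ ss) {x} {y} e = ⊑closure ss (trans (step≡ x y) (cong (_∨ _) e))

  run-adjacent : ∀ {w z R} → w ∉ K → Edge Ĝ w z → Linked (Edge Ĝ) (z ∷ R) → All (_∉ K) (z ∷ R) → w ∉ z ∷ R → Uniq (z ∷ R) → All (Edge Ĝ w) (z ∷ R)
  run-adjacent w∉K e [-] _ w∉ u = e ∷ []
  run-adjacent {w} {z} {z′ ∷ R} w∉K e (e′ ∷ lk) (z∉K ∷ h) w∉ u =
    e ∷ run-adjacent w∉K (trans (sym (twin w∉K z∉K e (λ { refl → w∉ (there (here refl)) }) (λ { refl → Uniq-head u (here refl) }))) e′)
          lk h (w∉ ∘ there) (Uniq-tail u)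

  -- Adjacency spreads along a run by `twin`, so its first vertex is joined to the rest of the run
  -- and to `S`, while its degree is `k`.
  run-short : ∀ R → Linked (Edge Ĝ) R → All (_∉ K) R → Uniq R → length S + length R ≤ suc k
  run-short [] _ _ _ = ≤-trans (≤-reflexive (+-identityʳ (length S))) ([ (λ eq → ≤-trans (≤-reflexive eq) (m≤n⇒m≤1+n 2≤k)) , (λ eq → m≤n⇒m≤1+n (≤-reflexive eq)) ]′ S-size)
  run-short (w ∷ R) lk (w∉ ∷ R∉) u = ≤-trans (≤-reflexive (+-suc (length S) (length R))) (s≤s (subst₂ _≤_
      (trans (deg-all Ĝ (S ++ R) λ x∈ → [ S-nbr w∉ , All.lookup (adjacent R lk R∉ u) ]′ (∈-++⁻ S x∈)) (length-++ S)) (deg≡k w∉)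
      (Σₗ-⊆ _ (S ++ R) (allFin n) (Uniq-++ S unS (Uniq-tail u) λ x∈S x∈R → All.lookup R∉ x∈R (S⊆K x∈S)) (λ {x} _ _ → ∈-allFin x))))
    where
    adjacent : ∀ R → Linked (Edge Ĝ) (w ∷ R) → All (_∉ K) R → Uniq (w ∷ R) → All (Edge Ĝ w) R
    adjacent []      _          _  _ = []
    adjacent (z ∷ R) (e ∷ lk) h u = run-adjacent w∉ e lk h (Uniq-head u) (Uniq-tail u)

  inK : V → ℕ
  inK x = ind ⌊ x ∈? K ⌋

  -- Each clique vertex of `M` pays for itself and for the run after it, at most `suc b` vertices;
  -- `R` is the run before the first clique vertex.
  runs : ∀ b → (∀ R → Linked (Edge Ĝ) R → All (_∉ K) R → Uniq R → length R ≤ b) → ∀ M → Linked (Edge Ĝ) M → Uniq M →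
         ∃[ R ] ∃[ M′ ] (M ≡ R ++ M′ × All (_∉ K) R × length M′ ≤ Σₗ inK M * suc b)
  runs b short []      lk u = [] , [] , refl , [] , z≤n
  runs b short (x ∷ M) lk u with runs b short M (Linked.tail lk) (Uniq-tail u) | x ∈? K
  ... | R , M′ , refl , R∉ , le | no x∉ = x ∷ R , M′ , refl , x∉ ∷ R∉ , le
  ... | R , M′ , refl , R∉ , le | yes x∈ = [] , x ∷ R ++ M′ , refl , [] , s≤s (≤-trans (≤-reflexive (length-++ R))
          (+-mono-≤ (short R (linked-prefix R (Linked.tail lk)) R∉ (Uniq-++⁻ˡ R (Uniq-tail u))) le))

  -- `h` stands for `length S` and `b` for the maximal length of a run. The left side is `3k - 1`
  -- for `h = 2` and `2k + 1` for `h = k`.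
  few-bound : ∀ h b → h + b ≡ suc k → (h ≡ 2 ⊎ h ≡ k) → b + h * suc b ≤ suc (k + k + k)
  few-bound h b eq (inj₁ refl) = linear 2 (+-mono-≤ (≤-reflexive eq) (+-mono-≤ (≤-reflexive eq) (≤-reflexive eq))) (lem b k)
    where
    lem : ∀ b k → b + 2 * suc b + (suc k + (suc k + suc k)) + 2 ≡ suc (k + k + k) + (2 + b + (2 + b + (2 + b)))
    lem = solve-∀
  few-bound h b eq (inj₂ refl) with +-cancelˡ-≡ k b 1 (trans eq (+-comm 1 k))
  ... | refl = ≤-trans (≤-reflexive (lem k)) (s≤s (m≤m+n (k + k) k))
    where
    lem : ∀ k → 1 + k * 2 ≡ suc (k + k)
    lem = solve-∀

  -- Combine `n + k + 3 ≤ 2 (c + 1 - k)`, which is `large`, with `c + 1 ≤ n`.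
  3k+1<c : suc (k + k + k) < c
  3k+1<c = linear 0 (+-mono-≤ (+-mono-≤ large c<n) (+-mono-≤ (≤-reflexive size) (≤-reflexive size))) (lem k c n (length K))
    where
    lem : ∀ k c n r → suc (suc (k + k + k)) + (r + r + n + (suc c + suc c)) + 0 ≡ c + (n + k + 3 + suc c + (k + r + (k + r)))
    lem = solve-∀

  KK-pair : ∀ M → (∃[ A ] ∃[ x ] ∃[ y ] ∃[ B ] (M ≡ A ++ x ∷ y ∷ B × x ∈ K × y ∈ K)) ⊎ Linked (λ x y → ¬ (x ∈ K × y ∈ K)) M
  KK-pair []          = inj₂ []
  KK-pair (x ∷ [])    = inj₂ [-]
  KK-pair (x ∷ y ∷ M) with (x ∈? K) ×-dec (y ∈? K) | KK-pair (y ∷ M)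
  ... | yes (x∈ , y∈) | _ = inj₁ ([] , x , y , M , refl , x∈ , y∈)
  ... | no _  | inj₁ (A , a , b , B , eq , a∈ , b∈) = inj₁ (x ∷ A , a , b , B , cong (x ∷_) eq , a∈ , b∈)
  ... | no ¬p | inj₂ h = inj₂ (¬p ∷ h)

  cycle-data : ∃[ x ] ∃[ y ] (Path Ĝ x y L × Edge Ĝ y x)
  cycle-data = let x , y , p , e , _ = cycle-path G c C isC in x , y , path-mono {G = G} {Ĝ} G⊑Ĝ p , G⊑Ĝ e

  length-L : length L ≡ c
  length-L = length-tabulate C

  isolatedK⇒S : ∀ {x y M} → Path Ĝ x y M → Linked (λ x y → ¬ (x ∈ K × y ∈ K)) M → 2 ≤ length M → ∀ {z} → z ∈ M → z ∈ K → z ∈ S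
  isolatedK⇒S {x} {y} {M} p none 2≤ {z} z∈M z∈K with ∈-∃++ z∈M
  ... | A , w ∷ B , refl = K-nbr w∉ z∈K (sym-edge Ĝ (proj₁ (proj₂ (path-cut A p))))
    where
    w∉ : w ∉ K
    w∉ w∈ = linked-at A none (z∈K , w∈)
  ... | [] , [] , refl = ⊥-elim (1+n≰n 2≤)
  ... | a ∷ A , [] , refl with snoc a A
  ...   | A₁ , w , eq = K-nbr w∉ z∈K (proj₁ (proj₂ (path-cut A₁ (subst (Path Ĝ x y) shift p))))
    where
    shift : (a ∷ A) ++ [ z ] ≡ A₁ ++ w ∷ z ∷ []
    shift = trans (cong (_++ [ z ]) eq) (++-assoc A₁ [ w ] [ z ])
    w∉ : w ∉ K
    w∉ w∈ = linked-at A₁ (subst (Linked _) shift none) (w∈ , z∈K)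

  -- If no two clique vertices are consecutive, each clique vertex of the cycle has an outside
  -- neighbour on it and so lies in `S`. Then there are too few runs, all too short, for length `c`.
  no-KK-short : Linked (λ x y → ¬ (x ∈ K × y ∈ K)) L → ⊥
  no-KK-short none = <⇒≱ 3k+1<c (begin
    c                                  ≡⟨ length-L ⟨
    length L                           ≡⟨ cong length eq ⟩
    length (R ++ M′)                   ≡⟨ length-++ R ⟩
    length R + length M′               ≤⟨ +-mono-≤ (short R linkedR R∉ (Uniq-++⁻ˡ R (subst Uniq eq uniqC))) le ⟩
    b + Σₗ inK L * suc b               ≤⟨ +-monoʳ-≤ b (*-monoˡ-≤ (suc b) K∩L≤S) ⟩
    b + length S * suc b               ≤⟨ few-bound (length S) b S+b S-size ⟩
    suc (k + k + k)                    ∎)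
    where
    open ≤-Reasoning
    b : ℕ
    b = suc k ∸ length S
    S+b : length S + b ≡ suc k
    S+b = m+[n∸m]≡n ([ (λ e → ≤-trans (≤-reflexive e) (m≤n⇒m≤1+n 2≤k)) , (λ e → m≤n⇒m≤1+n (≤-reflexive e)) ]′ S-size)
    short : ∀ R → Linked (Edge Ĝ) R → All (_∉ K) R → Uniq R → length R ≤ b
    short R lk R∉ u = +-cancelˡ-≤ (length S) _ _ (≤-trans (run-short R lk R∉ u) (≤-reflexive (sym S+b)))
    pL : Path Ĝ (proj₁ cycle-data) (proj₁ (proj₂ cycle-data)) L
    pL = proj₁ (proj₂ (proj₂ cycle-data))
    result = runs b short L (path-linked Ĝ pL) uniqC
    R M′ : List V
    R = proj₁ result
    M′ = proj₁ (proj₂ result)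
    eq : L ≡ R ++ M′
    eq = proj₁ (proj₂ (proj₂ result))
    R∉ : All (_∉ K) R
    R∉ = proj₁ (proj₂ (proj₂ (proj₂ result)))
    le : length M′ ≤ Σₗ inK L * suc b
    le = proj₂ (proj₂ (proj₂ (proj₂ result)))
    linkedR : Linked (Edge Ĝ) R
    linkedR = linked-prefix R (subst (Linked (Edge Ĝ)) eq (path-linked Ĝ pL))
    K∩L≤S : Σₗ inK L ≤ length S
    K∩L≤S = ≤-trans (Σₗ-⊆ inK L S uniqC in-S) (≤-trans (Σₗ-mono S (λ {x} _ → ind≤1 Ĝ ⌊ x ∈? K ⌋)) (≤-reflexive (Σₗ-one S)))
      where
      in-S : ∀ {x} → x ∈ L → inK x ≢ 0 → x ∈ S
      in-S {x} x∈ nz with x ∈? K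
      ... | yes x∈K = isolatedK⇒S pL none (≤-trans (s≤s (s≤s z≤n)) (≤-trans (proj₁ isC) (≤-reflexive (sym length-L)))) x∈ x∈K
      ... | no _    = ⊥-elim (nz refl)

  -- A clique vertex off the cycle could be inserted between two consecutive clique vertices.
  K⊆C : ∀ {z} → z ∈ K → z ∈ L
  K⊆C {z} z∈K = [ (λ { (A , x , y , B , eq , x∈ , y∈) → insert A x y B eq x∈ y∈ }) , (λ h → ⊥-elim (no-KK-short h)) ]′ (KK-pair L)
    where
    insert : ∀ A x y B → L ≡ A ++ x ∷ y ∷ B → x ∈ K → y ∈ K → z ∈ L
    insert A x y B eq x∈ y∈ = decidable-stable (z ∈? L) λ z∉ →
      let s , t , p , e = cycle-data
          p₁ , _ , p₂ = path-cut A (subst (Path Ĝ s t) eq p)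
          z≢ : ∀ {w} → w ∈ L → w ≢ z
          z≢ w∈ = λ { refl → z∉ w∈ }
          whole = (A ++ [ x ]) ++ z ∷ y ∷ B
          L≡ : L ≡ (A ++ [ x ]) ++ y ∷ B
          L≡ = trans eq (sym (++-assoc A [ x ] (y ∷ B)))
          un : Uniq whole
          un = Uniq-≤ (λ w → ≤-reflexive (Σₗ-insert (δ w) (A ++ [ x ]) z (y ∷ B)))
                 (Uniq-∷ {x = z} {(A ++ [ x ]) ++ y ∷ B} (z∉ ∘ subst (z ∈_) (sym L≡)) (subst Uniq L≡ uniqC))
          len : length whole ≡ suc c
          len = trans (length-++ (A ++ [ x ])) (trans (+-suc (length (A ++ [ x ])) (length (y ∷ B)))
                  (cong suc (trans (sym (length-++ (A ++ [ x ]))) (trans (cong length (sym L≡)) length-L))))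
      in 1+n≰n (subst (_≤ c) len (nl
           (path-++ p₁ (clique x∈ z∈K (z≢ (subst (x ∈_) (sym eq) (∈-insert A)))) (clique z∈K y∈ (≢-sym (z≢ (subst (y ∈_) (sym eq) (∈-++⁺ʳ A (there (here refl)))))) ◂ p₂))
           un e))

  -- With `m = length K - 2`, `G` has at most `k * length D + deg x + deg y + (m choose
  -- 2)` edges, the degrees being taken in `K`. It has more than `f n (k + 1) c`, which equals `m +
  -- (m choose 2) + (k + 1) * (length D + 1)`. As `m + k + 1 = c`, the degree sum exceeds `c +
  -- length D`.
  clique-degrees : ∀ {x y} → x ∈ K → y ∈ K → x ≢ y → ¬ Edge G x y → suc c ≤ deg G x K + deg G y K
  clique-degrees {x} {y} x∈ y∈ x≢y ¬e =
    let A , B , eqK = ∈-∃++ x∈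
        A′ , B′ , eqK′ = ∈-∃++ (∈-remove A (subst (y ∈_) eqK y∈) (≢-sym x≢y))
    in go A B A′ B′ eqK eqK′
    where
    D : List V
    D = outside K
    outer : edgesIn G (D ++ K) ≤ k * length D + edgesIn G K
    outer = peel G k K (length D) D refl (Uniq-outside K) (outside-∉ K)
      (λ D′ u dis {d} d∈ → d , d∈ , ≤-trans (deg≤all {G} G⊑Ĝ d (Uniq-++ D′ u unK dis)) (≤-reflexive (deg≡k (dis d∈))))
    go : ∀ A B A′ B′ → K ≡ A ++ [ x ] ++ B → A ++ B ≡ A′ ++ [ y ] ++ B′ → suc c ≤ deg G x K + deg G y K
    go A B A′ B′ eqK eqK′ = arith (m + m choose 2) (edgesIn G (allFin n)) (edgesIn G R) {deg G x K} {deg G y K}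
        dense′ (≤-trans (edgesIn-⊆ G (allFin n) (D ++ K) Uniq-allFin (λ {x} _ → outside-cover K x)) outer) inner (edgesIn≤choose G R) refl
      where
      R : List V
      R = A′ ++ B′
      m : ℕ
      m = length R
      K≡ : length K ≡ suc (suc m)
      K≡ = trans (cong length eqK) (trans (length-insert A) (cong suc (trans (cong length eqK′) (length-insert A′))))
      D+K : length D + length K ≡ n
      D+K = outside-length unK
      degx : deg G x K ≡ deg G x (A ++ B)
      degx = trans (cong (deg G x) eqK) (deg-insert-self G A x B)
      degy : deg G y K ≡ deg G y R
      degy = begin
        deg G y K                          ≡⟨ trans (cong (deg G y) eqK) (Σₗ-insert _ A x B) ⟩
        ind (adj G y x) + deg G y (A ++ B) ≡⟨ cong (_+ deg G y (A ++ B)) (ind-false G (¬e ∘ sym-edge G)) ⟩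
        deg G y (A ++ B)                   ≡⟨ trans (cong (deg G y) eqK′) (deg-insert-self G A′ y B′) ⟩
        deg G y R                          ∎
        where open ≡-Reasoning
      inner : edgesIn G K ≡ deg G x K + (deg G y K + edgesIn G R)
      inner = begin
        edgesIn G K                                        ≡⟨ trans (cong (edgesIn G) eqK) (edgesIn-insert G A x B) ⟩
        deg G x (A ++ B) + edgesIn G (A ++ B)              ≡⟨ cong₂ _+_ (sym degx) (trans (cong (edgesIn G) eqK′) (edgesIn-insert G A′ y B′)) ⟩
        deg G x K + (deg G y R + edgesIn G R)              ≡⟨ cong (λ d → deg G x K + (d + edgesIn G R)) degy ⟨
        deg G x K + (deg G y K + edgesIn G R)              ∎
        where open ≡-Reasoning
      c-k : c ∸ (k + 1) + 1 ≡ suc m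
      c-k = trans (+-comm _ 1) (cong suc (trans (cong (_∸ (k + 1)) c≡) (m+n∸m≡n (k + 1) m)))
        where
        c≡ : c ≡ k + 1 + m
        c≡ = suc-injective (trans (sym size) (trans (cong (k +_) K≡) (lem k m)))
          where
          lem : ∀ k m → k + suc (suc m) ≡ suc (k + 1 + m)
          lem = solve-∀
      n-m : n ∸ suc m ≡ suc (length D)
      n-m = trans (cong (_∸ suc m) (trans (sym D+K) (trans (cong (length D +_) K≡) (+-suc (length D) (suc m)))))
                  (m+n∸n≡m (suc (length D)) (suc m))
      dense′ : m + m choose 2 + (k + 1) * suc (length D) < edgesIn G (allFin n)
      dense′ = subst (_< edgesIn G (allFin n))
        (cong₂ _+_ (trans (cong (_choose 2) c-k) (choose-suc m)) (cong ((k + 1) *_) (trans (cong (n ∸_) c-k) n-m))) dense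
      arith : ∀ b E e {dx dy eK q} → b + (k + 1) * suc (length D) < E → E ≤ k * length D + eK → eK ≡ dx + (dy + e) → e ≤ q → b ≡ m + q →
              suc c ≤ dx + dy
      arith b E e {dx} {dy} {eK} {q} p r s t refl = linear (length D) (+-mono-≤ (+-mono-≤ p r) (+-mono-≤ (≤-reflexive s) (+-mono-≤ t
          (+-mono-≤ (≤-reflexive (sym size)) (≤-reflexive K≡)))))
        (lem k (length D) E eK dx dy e q m c (length K))
        where
        lem : ∀ k d E eK dx dy e q m c r →
              suc c + (E + (k * d + eK) + (dx + (dy + e) + (q + (k + r + suc (suc m))))) + d
              ≡ dx + dy + (suc (m + q + (k + 1) * suc d) + E + (eK + (e + (suc c + r))))
        lem = solve-∀

  -- Edges with an end outside `K` are already in `G`. A pair of `K` still missing in `H` would be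
  -- eligible, since `K` lies on the cycle and degrees only grow from `G` to `H`, against stability.
  closure≡Ĝ : ∀ {H} → IsCClosure G C H → ∀ x y → adj H x y ≡ adj Ĝ x y
  closure≡Ĝ {H} (steps , stable) x y = bool-ext (closure⊑ steps G⊑Ĝ) full
    where
    G⊑H : G ⊑ H
    G⊑H = ⊑closure steps
    inside : x ∈ K → y ∈ K → x ≢ y → Edge H x y
    inside x∈ y∈ x≢y = decidable-stable (edge? H x y) λ ¬e →
      let i , x≡ = ∈-tabulate⁻ (K⊆C x∈)
          j , y≡ = ∈-tabulate⁻ (K⊆C y∈)
          degH : ∀ z → deg G z K ≤ degC C H z
          degH z = ≤-trans (deg-mono {G = G} {H} G⊑H z K)
            (≤-trans (Σₗ-⊆ _ K L unK (λ w∈ _ → K⊆C w∈)) (≤-reflexive (sym (degC≡deg C H z))))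
      in stable i j (λ eq → x≢y (trans x≡ (trans eq (sym y≡))))
           (subst₂ (λ a b → adj H a b ≡ false) x≡ y≡ (¬true⇒false ¬e))
           (subst₂ (λ a b → suc c ≤ degC C H a + degC C H b) x≡ y≡
             (≤-trans (clique-degrees x∈ y∈ x≢y (¬e ∘ G⊑H)) (+-mono-≤ (degH x) (degH y))))
    full : Edge Ĝ x y → Edge H x y
    full e with x ∈? K | y ∈? K
    ... | yes x∈ | yes y∈ = inside x∈ y∈ (irrefl Ĝ e)
    ... | no x∉  | _      = G⊑H (agree x∉ e)
    ... | yes _  | no y∉  = sym-edge H (G⊑H (agree y∉ (sym-edge Ĝ e)))

-- Isomorphism with the extremal graphs

module Models {n k c : ℕ} {G : Graph n} {K S : List (Fin n)} (layered : Layered G k K S) (K-size : c ∸ k + 1 ≡ length K) where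

  open Layered layered
  private
    V = Fin n
    -- `S` is listed first, so that the indices below `length S` belong to `S` and those below
    -- `c - k + 1` to `K`, as both model graphs require.
    rest KS : List V
    rest = filter (λ x → ¬? (x ∈? S)) K
    KS = S ++ rest

  KS⇒K : ∀ {x} → x ∈ KS → x ∈ K
  KS⇒K x∈ = [ S⊆K , (λ h → proj₁ (∈-filter⁻ (λ x → ¬? (x ∈? S)) {xs = K} h)) ]′ (∈-++⁻ S x∈)

  K⇒KS : ∀ {x} → x ∈ K → x ∈ KS
  K⇒KS {x} x∈ with x ∈? S
  ... | yes x∈S = ∈-++⁺ˡ x∈S
  ... | no x∉S  = ∈-++⁺ʳ S (∈-filter⁺ (λ x → ¬? (x ∈? S)) x∈ x∉S)

  uniqKS : Uniq KS
  uniqKS = Uniq-++ S unS (Uniq-filter _ unK) (λ x∈S x∈r → proj₂ (∈-filter⁻ (λ x → ¬? (x ∈? S)) {xs = K} x∈r) x∈S)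

  length-KS : length KS ≡ c ∸ k + 1
  length-KS = trans (≤-antisym (length-⊆ KS K uniqKS KS⇒K) (length-⊆ K KS unK K⇒KS)) (sym K-size)

  ∈?-KS : ∀ x → ⌊ x ∈? KS ⌋ ≡ ⌊ x ∈? K ⌋
  ∈?-KS x with x ∈? KS | x ∈? K
  ... | yes _ | yes _ = refl
  ... | no _  | no _  = refl
  ... | yes h | no k  = ⊥-elim (k (KS⇒K h))
  ... | no h  | yes k = ⊥-elim (h (K⇒KS k))

  module Listed (O : List V) (uniqO : Uniq O) (O∉K : ∀ {x} → x ∈ O → x ∉ K) (∉K⇒O : ∀ {x} → x ∉ K → x ∈ O) where

    L : List V
    L = KS ++ O

    all∈ : ∀ x → x ∈ L
    all∈ x with x ∈? K
    ... | yes x∈ = ∈-++⁺ˡ (K⇒KS x∈)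
    ... | no x∉  = ∈-++⁺ʳ KS (∉K⇒O x∉)

    open Enumeration L (Uniq-++ KS uniqKS uniqO (λ x∈ x∈O → O∉K x∈O (KS⇒K x∈))) all∈ public

    index-K : ∀ x → (toℕ (index x) <ᵇ c ∸ k + 1) ≡ ⌊ x ∈? K ⌋
    index-K x = trans (cong₂ _<ᵇ_ (toℕ-index x) (sym length-KS)) (trans (pos-<ᵇ KS x) (∈?-KS x))

    index-∉K : ∀ x → (c ∸ k + 1 ≤ᵇ toℕ (index x)) ≡ not ⌊ x ∈? K ⌋
    index-∉K x = trans (cong₂ _≤ᵇ_ (sym length-KS) (toℕ-index x)) (trans (pos-≤ᵇ KS x) (cong not (∈?-KS x)))

    index-S : ∀ x → (toℕ (index x) <ᵇ length S) ≡ ⌊ x ∈? S ⌋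
    index-S x = trans (cong (_<ᵇ length S) (trans (toℕ-index x) (cong (pos x) (++-assoc S rest O)))) (pos-<ᵇ S x)

    index-O : ∀ {x} → x ∉ K → toℕ (index x) ∸ (c ∸ k + 1) ≡ pos x O
    index-O {x} x∉ = trans (cong₂ _∸_ (trans (toℕ-index x) (pos-++ʳ KS (x∉ ∘ KS⇒K))) (sym length-KS)) (m+n∸m≡n (length KS) (pos x O))

    length-O : length O ≡ n ∸ (c ∸ k + 1)
    length-O = trans (sym (m+n∸m≡n (length KS) (length O))) (cong₂ _∸_ (trans (sym (length-++ KS)) len) length-KS)

  -- The disjunction follows the shape of `Zadj`, with adjacency between outside vertices left open
  -- as `E`: constantly false for `W`, equality of block numbers for `Z`.
  adjacency : ∀ (E : V → V → Bool) → (∀ {u v} → u ∉ K → v ∉ K → u ≢ v → adj G u v ≡ E u v) → ∀ u v →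
              adj G u v ≡ not ⌊ u ≟F v ⌋ ∧ (⌊ u ∈? S ⌋ ∨ ⌊ v ∈? S ⌋ ∨ (⌊ u ∈? K ⌋ ∧ ⌊ v ∈? K ⌋) ∨ (not ⌊ u ∈? K ⌋ ∧ not ⌊ v ∈? K ⌋ ∧ E u v))
  adjacency E outer u v with u ≟F v
  ... | yes refl = adj-irr G u
  ... | no u≢v with u ∈? S | v ∈? S | u ∈? K | v ∈? K
  ...   | yes u∈S | _       | _      | yes v∈ = clique (S⊆K u∈S) v∈ u≢v
  ...   | yes u∈S | _       | _      | no v∉  = sym-edge G (S-nbr v∉ u∈S)
  ...   | no u∉S  | yes v∈S | yes u∈ | _      = clique u∈ (S⊆K v∈S) u≢v
  ...   | no u∉S  | yes v∈S | no u∉  | _      = S-nbr u∉ v∈S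
  ...   | no u∉S  | no v∉S  | yes u∈ | yes v∈ = clique u∈ v∈ u≢v
  ...   | no u∉S  | no v∉S  | yes u∈ | no v∉  = ¬true⇒false λ e → u∉S (K-nbr v∉ u∈ (sym-edge G e))
  ...   | no u∉S  | no v∉S  | no u∉  | yes v∈ = ¬true⇒false λ e → v∉S (K-nbr u∉ v∈ e)
  ...   | no u∉S  | no v∉S  | no u∉  | no v∉  = outer u∉ v∉ u≢v

  W-model : length S ≡ k → G ≅ Wadj n k c
  W-model S≡k = bijection , λ u v → trans (adjacency (λ _ _ → false) (λ u∉ v∉ _ → ¬true⇒false (isolated u∉ v∉)) u v) (sym (model u v))
    where
    isolated : ∀ {w z} → w ∉ K → z ∉ K → ¬ Edge G w z
    isolated {w} {z} w∉ z∉ e = 1+n≰n (subst₂ _≤_ (trans (deg-all G (z ∷ S) λ { (here refl) → e ; (there x∈) → S-nbr w∉ x∈ }) (cong suc S≡k)) (deg≡k w∉)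
      (Σₗ-⊆ _ (z ∷ S) (allFin n) (Uniq-∷ (z∉ ∘ S⊆K) unS) (λ {x} _ _ → ∈-allFin x)))
    open Listed (outside K) (Uniq-outside K) (outside-∉ K) (∉-outside K)
    shuffle : ∀ e a b p q → e ∧ ((a ∧ b) ∨ p ∨ q) ≡ e ∧ (p ∨ q ∨ (a ∧ b) ∨ (not a ∧ not b ∧ false))
    shuffle false _     _     _     _     = refl
    shuffle true  true  true  true  _     = refl
    shuffle true  true  true  false true  = refl
    shuffle true  true  true  false false = refl
    shuffle true  true  false true  _     = refl
    shuffle true  true  false false true  = refl
    shuffle true  true  false false false = refl
    shuffle true  false true  true  _     = refl
    shuffle true  false true  false true  = refl
    shuffle true  false true  false false = refl
    shuffle true  false false true  _     = refl
    shuffle true  false false false true  = refl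
    shuffle true  false false false false = refl
    model : ∀ u v → Wadj n k c (index u) (index v) ≡
            not ⌊ u ≟F v ⌋ ∧ (⌊ u ∈? S ⌋ ∨ ⌊ v ∈? S ⌋ ∨ (⌊ u ∈? K ⌋ ∧ ⌊ v ∈? K ⌋) ∨ (not ⌊ u ∈? K ⌋ ∧ not ⌊ v ∈? K ⌋ ∧ false))
    model u v = trans
      (cong₂ _∧_ (cong not (index-≟ u v)) (cong₂ _∨_ (cong₂ _∧_ (index-K u) (index-K v)) (cong₂ _∨_ (in-S u) (in-S v))))
      (shuffle (not ⌊ u ≟F v ⌋) ⌊ u ∈? K ⌋ ⌊ v ∈? K ⌋ ⌊ u ∈? S ⌋ ⌊ v ∈? S ⌋)
      where
      in-S : ∀ x → (toℕ (index x) <ᵇ k) ≡ ⌊ x ∈? S ⌋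
      in-S x = trans (cong (toℕ (index x) <ᵇ_) (sym S≡k)) (index-S x)

  module _ {j : ℕ} (k≡ : k ≡ suc (suc j)) (S≡2 : length S ≡ 2) where

    -- The first block is `d` with its outside neighbours. Since `d` has degree `k` and is joined to
    -- both vertices of `S`, the block has `k - 1 = suc j` vertices. By the twin property it is a
    -- clique without edges to `R`, and `R` is closed again; `m` bounds the recursion.
    make-blocks : ∀ m D → length D ≤ m → Uniq D → (∀ {x} → x ∈ D → x ∉ K) → (∀ {x y} → x ∈ D → y ∉ K → Edge G x y → y ∈ D) →
                  ∃[ O ] (Blocks G j O × Uniq O × (∀ {x} → x ∈ O → x ∈ D) × (∀ {x} → x ∈ D → x ∈ O))
    make-blocks m [] _ _ _ _ = [] , [] , Uniq-[] , (λ ()) , (λ ())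
    make-blocks (suc m) (d ∷ D) (s≤s le) un D∉K closed =
      let O , bs , unO , O⊆ , ⊆O = make-blocks m R (≤-trans (length-⊆ R D (Uniq-filter _ (Uniq-tail un)) R⊆D) le)
                                     (Uniq-filter _ (Uniq-tail un)) (D∉K ∘ there ∘ R⊆D) R-closed
          disj : ∀ {x} → x ∈ d ∷ F → x ∈ O → ⊥
          disj x∈ x∈O = B∩R x∈ (O⊆ x∈O)
      in (d ∷ F) ++ O
         , block (d ∷ F) F-length inside (λ x∈ y∈ → between x∈ (O⊆ y∈)) disj bs
         , Uniq-++ (d ∷ F) unB unO disj
         , (λ x∈ → [ B⊆D , (λ x∈O → there (R⊆D (O⊆ x∈O))) ]′ (∈-++⁻ (d ∷ F) x∈))
         , λ x∈ → [ ∈-++⁺ˡ , (λ x∈R → ∈-++⁺ʳ (d ∷ F) (⊆O x∈R)) ]′ (split x∈)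
      where
      d∉K : d ∉ K
      d∉K = D∉K (here refl)
      F R : List V
      F = filter (edge? G d) D
      R = filter (λ x → ¬? (edge? G d x)) D
      F-∈ : ∀ {x} → x ∈ F → x ∈ D × Edge G d x
      F-∈ = ∈-filter⁻ (edge? G d) {xs = D}
      R-∈ : ∀ {x} → x ∈ R → x ∈ D × ¬ Edge G d x
      R-∈ = ∈-filter⁻ (λ x → ¬? (edge? G d x)) {xs = D}
      R⊆D : ∀ {x} → x ∈ R → x ∈ D
      R⊆D = proj₁ ∘ R-∈
      unF : Uniq F
      unF = Uniq-filter _ (Uniq-tail un)
      unB : Uniq (d ∷ F)
      unB = Uniq-∷ (λ d∈ → Uniq-head un (proj₁ (F-∈ d∈))) unF
      B⊆D : ∀ {x} → x ∈ d ∷ F → x ∈ d ∷ D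
      B⊆D (here eq)  = here eq
      B⊆D (there x∈) = there (proj₁ (F-∈ x∈))
      B∩R : ∀ {x} → x ∈ d ∷ F → x ∈ R → ⊥
      B∩R (here refl) x∈R = Uniq-head un (R⊆D x∈R)
      B∩R (there x∈F) x∈R = proj₂ (R-∈ x∈R) (proj₂ (F-∈ x∈F))
      split : ∀ {x} → x ∈ d ∷ D → x ∈ d ∷ F ⊎ x ∈ R
      split (here eq) = inj₁ (here eq)
      split {x} (there x∈) with edge? G d x
      ... | yes e = inj₁ (there (∈-filter⁺ (edge? G d) x∈ e))
      ... | no ¬e = inj₂ (∈-filter⁺ (λ x → ¬? (edge? G d x)) x∈ ¬e)
      D∌d : ∀ {x} → x ∈ D → x ≢ d
      D∌d x∈ refl = Uniq-head un x∈
      F-length : length (d ∷ F) ≡ suc j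
      F-length = +-cancelˡ-≡ 1 _ _ (trans (cong (_+ length F) (sym S≡2)) (trans (sym (length-++ S)) (trans (≤-antisym lower upper) k≡)))
        where
        lower : length (S ++ F) ≤ k
        lower = subst₂ _≤_ (deg-all G (S ++ F) λ x∈ → [ S-nbr d∉K , proj₂ ∘ F-∈ ]′ (∈-++⁻ S x∈)) (deg≡k d∉K)
          (Σₗ-⊆ _ (S ++ F) (allFin n) (Uniq-++ S unS unF λ x∈S x∈F → D∉K (there (proj₁ (F-∈ x∈F))) (S⊆K x∈S)) (λ {x} _ _ → ∈-allFin x))
        upper : k ≤ length (S ++ F)
        upper = subst (_≤ length (S ++ F)) (deg≡k d∉K)
          (≤-trans (Σₗ-⊆ _ (allFin n) (S ++ F) Uniq-allFin (λ {x} _ nz → nbr x (ind≢0 G nz))) (deg≤length G d (S ++ F)))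
          where
          nbr : ∀ x → Edge G d x → x ∈ S ++ F
          nbr x e with x ∈? K
          ... | yes x∈K = ∈-++⁺ˡ (K-nbr d∉K x∈K e)
          ... | no x∉K with closed (here refl) x∉K e
          ...   | here refl = ⊥-elim (irrefl G e refl)
          ...   | there x∈D = ∈-++⁺ʳ S (∈-filter⁺ (edge? G d) x∈D e)
      inside : ∀ {x y} → x ∈ d ∷ F → y ∈ d ∷ F → x ≡ y ⊎ Edge G x y
      inside (here refl) (here refl) = inj₁ refl
      inside (here refl) (there y∈)  = inj₂ (proj₂ (F-∈ y∈))
      inside (there x∈)  (here refl) = inj₂ (sym-edge G (proj₂ (F-∈ x∈)))
      inside {x} {y} (there x∈) (there y∈) with x ≟F y
      ... | yes eq = inj₁ eq
      ... | no x≢y = inj₂ (trans (twin d∉K (D∉K (there (proj₁ (F-∈ x∈)))) (proj₂ (F-∈ x∈)) (D∌d (proj₁ (F-∈ y∈))) (≢-sym x≢y)) (proj₂ (F-∈ y∈)))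
      between : ∀ {x y} → x ∈ d ∷ F → y ∈ R → ¬ Edge G x y
      between (here refl) y∈ e = proj₂ (R-∈ y∈) e
      between (there x∈)  y∈ e = proj₂ (R-∈ y∈)
        (trans (sym (twin d∉K (D∉K (there (proj₁ (F-∈ x∈)))) (proj₂ (F-∈ x∈)) (D∌d (R⊆D y∈)) (≢-sym (irrefl G e)))) e)
      R-closed : ∀ {x y} → x ∈ R → y ∉ K → Edge G x y → y ∈ R
      R-closed {x} {y} x∈ y∉ e with closed (there (R⊆D x∈)) y∉ e
      ... | here refl = ⊥-elim (proj₂ (R-∈ x∈) (sym-edge G e))
      ... | there y∈D = ∈-filter⁺ (λ x → ¬? (edge? G d x)) y∈D λ ey → proj₂ (R-∈ x∈)
              (trans (sym (twin d∉K y∉ ey (D∌d (R⊆D x∈)) (irrefl G e))) (sym-edge G e))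

    Z-model : 2 ≤ k × (k ∸ 1) ∣ (n ∸ (c ∸ k + 1)) × G ≅ Zadj n k c
    Z-model = let O , bs , unO , O⊆ , ⊆O = make-blocks (length (outside K)) (outside K) ≤-refl (Uniq-outside K) (outside-∉ K) (λ _ y∉ _ → ∉-outside K y∉)
              in finish O bs unO (outside-∉ K ∘ O⊆) (⊆O ∘ ∉-outside K)
      where
      finish : ∀ O → Blocks G j O → Uniq O → (∀ {x} → x ∈ O → x ∉ K) → (∀ {x} → x ∉ K → x ∈ O) →
               2 ≤ k × (k ∸ 1) ∣ (n ∸ (c ∸ k + 1)) × G ≅ Zadj n k c
      finish O bs unO O∉K ∉K⇒O = subst (2 ≤_) (sym k≡) (s≤s (s≤s z≤n))
        , subst₂ _∣_ (sym k-1) length-O (blocks-divide G j bs)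
        , bijection , λ u v → trans (adjacency E outer u v) (sym (model u v))
        where
        open Listed O unO O∉K ∉K⇒O
        k-1 : k ∸ 1 ≡ suc j
        k-1 = cong (_∸ 1) k≡
        E : V → V → Bool
        E u v = blk (k ∸ 1) (toℕ (index u) ∸ (c ∸ k + 1)) ≡ᵇ blk (k ∸ 1) (toℕ (index v) ∸ (c ∸ k + 1))
        blk-index : ∀ {x} → x ∉ K → blk (k ∸ 1) (toℕ (index x) ∸ (c ∸ k + 1)) ≡ pos x O / suc j
        blk-index x∉ = cong₂ blk k-1 (index-O x∉)
        outer : ∀ {u v} → u ∉ K → v ∉ K → u ≢ v → adj G u v ≡ E u v
        outer {u} {v} u∉ v∉ u≢v = trans (bool-ext
            (λ e → ≡⇒≡ᵇ-true (blocks-complete G j bs (∉K⇒O u∉) (∉K⇒O v∉) e))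
            (λ e → [ (λ eq → ⊥-elim (u≢v eq)) , id ]′ (blocks-sound G j bs (∉K⇒O u∉) (∉K⇒O v∉) (≡ᵇ⇒≡ _ _ (subst T (sym e) tt)))))
          (sym (cong₂ _≡ᵇ_ (blk-index u∉) (blk-index v∉)))
          where
          ≡⇒≡ᵇ-true : ∀ {a b} → a ≡ b → (a ≡ᵇ b) ≡ true
          ≡⇒≡ᵇ-true {a} {b} eq with a ≡ᵇ b | ≡⇒≡ᵇ a b eq
          ... | true | _ = refl
        model : ∀ u v → Zadj n k c (index u) (index v) ≡
                not ⌊ u ≟F v ⌋ ∧ (⌊ u ∈? S ⌋ ∨ ⌊ v ∈? S ⌋ ∨ (⌊ u ∈? K ⌋ ∧ ⌊ v ∈? K ⌋) ∨ (not ⌊ u ∈? K ⌋ ∧ not ⌊ v ∈? K ⌋ ∧ E u v))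
        model u v = cong₂ _∧_ (cong not (index-≟ u v)) (cong₂ _∨_ (in-S u) (cong₂ _∨_ (in-S v)
          (cong₂ _∨_ (cong₂ _∧_ (index-K u) (index-K v)) (cong₂ _∧_ (index-∉K u) (cong (_∧ E u v) (index-∉K v))))))
          where
          in-S : ∀ x → (toℕ (index x) <ᵇ 2) ≡ ⌊ x ∈? S ⌋
          in-S x = trans (cong (toℕ (index x) <ᵇ_) (sym S≡2)) (index-S x)

-- From the edge-maximal graph to the closure of the given one

module _ {n k c : ℕ} {G : Graph n} {C : Fin c → Fin n} (two-connected : TwoConnected G) (δ≥k : MinDegree≥ G k)
         (longest : IsLongestCycle G c C) (10≤c : 10 ≤ c) (c<n : c < n) where

  private
    2≤c : 2 ≤ c
    2≤c = ≤-trans (s≤s (s≤s z≤n)) 10≤c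

  module Extension {Ĝ : Graph n} (G⊑Ĝ : G ⊑ Ĝ) (nl : NoLong Ĝ c) (settled : ∀ x y → Settled Ĝ c x y) where

    tc : NoCutvertex Ĝ
    tc = twoConnected⇒NoCutvertex {G = G} {Ĝ} G⊑Ĝ two-connected

    δG : ∀ v → k ≤ deg G v (allFin n)
    δG v = subst (k ≤_) (degree≡deg G v) (δ≥k v)

    δĜ : ∀ v → k ≤ deg Ĝ v (allFin n)
    δĜ v = ≤-trans (δG v) (deg-mono {G = G} {Ĝ} G⊑Ĝ v (allFin n))

    module _ (big : BigClique Ĝ 10≤c c<n nl tc settled k) where

      open BigClique big
      open Assembly Ĝ 2≤c nl tc settled K unK clK maxK size δĜ

      module _ {u v : Fin n} {P : List (Fin n)} (ext : Saturated.Extremal Ĝ 2≤c nl tc settled K (outside K) u v P) where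

        open Longest ext

        layered : Layered Ĝ k K S
        layered = record
          { unK = unK ; unS = unS ; S⊆K = S⊆K ; clique = clK
          ; deg≡k = λ w∉ → Good.degree-k (all-good w∉)
          ; twin = λ w∉ y∉ e x≢w x≢y → Good.twins (all-good w∉) _ y∉ e _ x≢w x≢y
          ; K-nbr = λ w∉ x∈ e → Good.K-nbr⊆ (all-good w∉) _ x∈ e
          ; S-nbr = λ w∉ x∈ → Good.S-nbr (all-good w∉) _ x∈ }

        c∸k : c ∸ k + 1 ≡ length K
        c∸k = trans (+-comm (c ∸ k) 1) (trans (sym (+-∸-assoc 1 k≤c)) (trans (cong (_∸ k) (sym size)) (m+n∸m≡n k (length K))))
          where
          k≤c : k ≤ c
          k≤c = ≤-trans (n≤1+n k) (≤-trans (m≤m+n (suc k) (suc k)) k<c/2)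

        conclude : f n (k + 1) c < edgesIn G (allFin n) → ∀ {H} → IsCClosure G C H →
                   (H ≅ Wadj n k c) ⊎ (2 ≤ k × (k ∸ 1) ∣ (n ∸ (c ∸ k + 1)) × H ≅ Zadj n k c)
        conclude dense {H} closure = model S-size
          where
          H≡Ĝ : ∀ x y → adj H x y ≡ adj Ĝ x y
          H≡Ĝ = Closure.closure≡Ĝ {G = G} {Ĝ} G⊑Ĝ nl layered size k<c/2 large c<n S-size 2≤k δG dense C (proj₁ longest) {H} closure
          transport : ∀ A → Ĝ ≅ A → H ≅ A
          transport A (π , h) = π , λ u v → trans (H≡Ĝ u v) (h u v)
          model : length S ≡ 2 ⊎ length S ≡ k → (H ≅ Wadj n k c) ⊎ (2 ≤ k × (k ∸ 1) ∣ (n ∸ (c ∸ k + 1)) × H ≅ Zadj n k c)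
          model (inj₂ S≡k) = inj₁ (transport (Wadj n k c) (Models.W-model layered c∸k S≡k))
          model (inj₁ S≡2) =
            let 2≤k′ , blocks∣ , iso = Models.Z-model layered c∸k {k ∸ 2} (sym (m+[n∸m]≡n 2≤k)) S≡2
            in inj₂ (2≤k′ , blocks∣ , transport (Zadj n k c) iso)

      clique-theorem : f n (k + 1) c < edgesIn G (allFin n) → ∀ {H} → IsCClosure G C H →
                       (H ≅ Wadj n k c) ⊎ (2 ≤ k × (k ∸ 1) ∣ (n ∸ (c ∸ k + 1)) × H ≅ Zadj n k c)
      clique-theorem dense closure =
        let _ , _ , _ , ext = extremal-in outside-closed (proj₂ (member (outside K) outside≢[])) in conclude ext dense closure
        where
        member : ∀ (D : List (Fin n)) → 1 ≤ length D → ∃[ d ] d ∈ D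
        member (d ∷ D) _ = d , here refl
        outside≢[] : 1 ≤ length (outside K)
        outside≢[] = linear 0 (+-mono-≤ (+-mono-≤ c<n (≤-reflexive size)) (+-mono-≤ (≤-reflexive (sym (outside-length unK))) (≤-trans (n≤1+n 1) 2≤k)))
          (lem (length (outside K)) (length K) n c k)
          where
          lem : ∀ d r n c k → 1 + (n + suc c + (d + r + k)) + 0 ≡ d + (suc c + (k + r) + (n + 1))
          lem = solve-∀

    extension-theorem : f n (k + 1) c < edges G → f n (c / 2) c < edges G → ∀ {H} → IsCClosure G C H →
                        (H ≅ Wadj n k c) ⊎ (2 ≤ k × (k ∸ 1) ∣ (n ∸ (c ∸ k + 1)) × H ≅ Zadj n k c)
    extension-theorem bound₁ bound₂ = clique-theorem
        (big-clique Ĝ 10≤c c<n nl tc settled k δĜ (≤-trans bound₁ edges≤) {c / 2} 2t≤c c≤ (≤-trans bound₂ edges≤))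
        (≤-trans bound₁ (edges≤edgesIn G))
      where
      edges≤ : edges G ≤ edgesIn Ĝ (allFin n)
      edges≤ = ≤-trans (edges≤edgesIn G) (edgesIn-mono {G = G} {Ĝ} G⊑Ĝ (allFin n))
      2t≤c : c / 2 + c / 2 ≤ c
      2t≤c = ≤-trans (≤-reflexive (lem (c / 2))) (≤-trans (m≤n+m (c / 2 * 2) (c % 2)) (≤-reflexive (sym (m≡m%n+[m/n]*n c 2))))
        where
        lem : ∀ t → t + t ≡ t * 2
        lem = solve-∀
      c≤ : c ≤ suc (c / 2 + c / 2)
      c≤ = ≤-trans (≤-reflexive (m≡m%n+[m/n]*n c 2)) (≤-trans (+-monoˡ-≤ (c / 2 * 2) (s≤s⁻¹ (m%n<n c 2))) (≤-reflexive (lem (c / 2))))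
        where
        lem : ∀ t → 1 + t * 2 ≡ suc (t + t)
        lem = solve-∀

theorem1p9 : (n k c : ℕ) (G : Graph n) (C : Fin c → Fin n) →
    TwoConnected G → MinDegree≥ G k →
    IsLongestCycle G c C → 10 ≤ c → c ≤ n ∸ 1 →
    f n (k + 1) c < edges G → f n (c / 2) c < edges G →
    (H : Graph n) → IsCClosure G C H →
    (H ≅ Wadj n k c) ⊎
    (2 ≤ k × (k ∸ 1) ∣ (n ∸ (c ∸ k + 1)) × H ≅ Zadj n k c)
theorem1p9 n k c G C two-connected δ≥k longest 10≤c c≤n-1 bound₁ bound₂ H closure =
  let Ĝ , G⊑Ĝ , nl , settled = saturate (≤-trans (s≤s (s≤s z≤n)) 10≤c) G (longest⇒NoLong G c C longest)
  in Extension.extension-theorem two-connected δ≥k longest 10≤c (below c≤n-1) {Ĝ} G⊑Ĝ nl settled bound₁ bound₂ closure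
  where
  below : ∀ {n} → c ≤ n ∸ 1 → c < n
  -- For `n = 0` truncated subtraction turns the hypothesis into `c ≤ 0`, which contradicts
  -- `10 ≤ c`.
  below {zero}  h = ⊥-elim (1+n≰n (≤-trans (≤-trans (s≤s z≤n) 10≤c) h))
  below {suc n} h = s≤s h
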